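{- Let $Q$ be the set of prime powers, and let $N\ge 2$, $k$, $m$, $h$ be fixed integers with $1\le k\le N$, $1\le m\le N-k$ and $1\leq h\leq m-1$. Let $(X_q)_{q\in Q}$ be a sequence where $X_q$ is an $N$-dimensional vector space over $\mathbb{F}_q$, and let $(\mathcal{A}_q)_{q\in Q}$ be a sequence where $\mathcal{A}_q$ is a partial $m$-spread of $X_q$ with $|\mathcal{A}_q|\ge 2$ for all $q\in Q$. Let $\gamma=(h+1)(N+h+1-k-m)$ and let $\binom{N}{k}_q$ denote the number of $k$-dimensional subspaces of $\mathbb{F}_q^N$. Then $$\lim_{q\to+\infty}\frac{|\{U_q\leq X_q : \dim(U_q)=k,\ U_q \text{ is } (\mathcal{A}_q,h)\text{ -evasive}\}|}{\binom{N}{k}_q}=\begin{cases}1 & \text{if } |\mathcal{A}_q|\in o(q^{\gamma}) \text{ as } q\to+\infty,\\ 0 & \text{if } q^{\gamma}\in o(|\mathcal{A}_q|) \text{ as } q\to+\infty.\end{cases}$$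
   Context: A partial $m$-spread of a vector space $X$ over $\mathbb{F}_q$ is a collection $\mathcal{A}$ of $m$-dimensional $\mathbb{F}_q$-subspaces of $X$ with $S\cap S'=\{0\}$ for all distinct $S,S'\in\mathcal{A}$. An $\mathbb{F}_q$-subspace $U\le X$ is $(\mathcal{A},h)$-evasive if $\dim_{\mathbb{F}_q}(U\cap S)\leq h$ for all $S\in\mathcal{A}$. Limits and little-$o$ notation are with $q$ ranging over the prime powers, $q\to+\infty$. -}

module Defs where

open import Algebra.Bundles using (CommutativeRing)
open import Algebra.Module.Bundles using (Module)
open import Algebra.Module.Structures.Biased using (IsModuleFromLeft)
import Algebra.Properties.CommutativeMonoid.Sum as Sum
open import Data.Bool.Base using (Bool; true; false; T)
open import Data.Fin.Base using (Fin; zero; suc; toℕ; combine; inject≤; fromℕ<; punchIn; finToFun; funToFin)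
open import Data.Fin.Properties as Fin
  using (any?; all?; 2↔Bool; funToFin-finToFin; finToFun-funToFin; punchInᵢ≢i)
open import Data.Integer.Base using (+_)
open import Data.List.Base using (List)
open import Data.List.Relation.Unary.All as All using (All)
import Data.List.Membership.Setoid as Membership
import Data.List.Relation.Unary.Unique.Setoid as UniqueSetoid
open import Data.Nat.Base using (ℕ; zero; suc; _^_; _≤_; s≤s; s≤s⁻¹; NonZero)
open import Data.Nat.Primality using (Prime)
open import Data.Nat.Properties using (anyUpTo?; _≤?_)
import Data.Nat.Properties as ℕ
open import Data.Product using (Σ; ∃; ∃₂; _×_; _,_; proj₁; proj₂)
open import Data.Rational.Base as ℚ using (ℚ; 0ℚ)
open import Data.Unit.Base using (⊤; tt)
open import Data.Vec.Functional using (Vector)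
import Data.Vec.Functional.Relation.Binary.Equality.Setoid as VecEq
open import Function.Base using (_∘_; case_of_)
open import Function.Bundles using (Inverse)
import Function.Construct.Composition as Compose
import Function.Construct.Symmetry as Symmetry
open import Level using (Level; _⊔_; 0ℓ) renaming (suc to lsuc)
open import Relation.Binary.Bundles using (Setoid)
import Relation.Binary.Construct.On as On
open import Relation.Binary.Definitions using (_Respects_)
import Relation.Binary.Definitions as B
open import Relation.Binary.PropositionalEquality as ≡ using (_≡_; _≢_)
open import Relation.Nullary using (¬_; Dec; yes; no; contradiction)
open import Relation.Nullary.Decidable
  using (map′; _×-dec_; _→-dec_; ⌊_⌋; True; toWitness; fromWitness; T?)
open import Relation.Unary using (Pred; Decidable; _≐_)

private variable
  a ℓ p c m ℓm : Level

HasSize : Setoid a ℓ → ℕ → Set (a ⊔ ℓ)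
HasSize S n = Inverse S (≡.setoid (Fin n))

Finite : Setoid a ℓ → Set (a ⊔ ℓ)
Finite S = ∃ λ n → HasSize S n

∣_∣ : {S : Setoid a ℓ} → Finite S → ℕ
∣ n , _ ∣ = n

Subsetoid : (S : Setoid a ℓ) → Pred (Setoid.Carrier S) p → Setoid (a ⊔ p) ℓ
Subsetoid S P = On.setoid {B = Σ (Setoid.Carrier S) P} S proj₁

module _ {S : Setoid a ℓ} {n : ℕ} (size : HasSize S n) where
  private module S = Setoid S
  open Inverse size

  from∘to : ∀ x → from (to x) S.≈ x
  from∘to = strictlyInverseʳ

  finite-any? : {P : Pred S.Carrier p} → P Respects S._≈_ → Decidable P → Dec (∃ P)
  finite-any? resp P? =
    map′ (λ (i , Pi) → from i , Pi)
         (λ (x , Px) → to x , resp (S.sym (from∘to x)) Px)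
         (any? (P? ∘ from))

  finite-all? : {P : Pred S.Carrier p} → P Respects S._≈_ → Decidable P → Dec (∀ x → P x)
  finite-all? resp P? =
    map′ (λ all x → resp (from∘to x) (all (to x))) (_∘ from) (all? (P? ∘ from))

  finite-≈? : B.Decidable S._≈_
  finite-≈? x y =
    map′ (λ eq → S.trans (S.sym (from∘to x)) (S.trans (from-cong eq) (from∘to y)))
         to-cong (to x Fin.≟ to y)

funToFin-cong : ∀ {k n} {f g : Fin k → Fin n} → (∀ i → f i ≡ g i) → funToFin f ≡ funToFin g
funToFin-cong {zero}  f≗g = ≡.refl
funToFin-cong {suc k} f≗g = ≡.cong₂ combine (f≗g zero) (funToFin-cong (f≗g ∘ suc))

vectorSetoid : Setoid a ℓ → ℕ → Setoid a ℓ
vectorSetoid S k = VecEq.≋-setoid S k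

vector-size : {S : Setoid a ℓ} {n : ℕ} → HasSize S n → ∀ k → HasSize (vectorSetoid S k) (n ^ k)
vector-size {S = S} {n} size k = record
  { to        = λ v → funToFin (to ∘ v)
  ; from      = λ i → from ∘ finToFun i
  ; to-cong   = λ v≋w → funToFin-cong (λ i → to-cong (v≋w i))
  ; from-cong = λ i≡j t → S.reflexive (≡.cong (λ i → from (finToFun i t)) i≡j)
  ; inverse   =
      (λ {i} {v} v≋ → ≡.trans
        (funToFin-cong (λ t → ≡.trans (to-cong (v≋ t)) (strictlyInverseˡ (finToFun i t))))
        (funToFin-finToFin {k} {n} i))
    , (λ {v} {i} i≡ t → S.trans
        (from-cong (≡.trans (≡.cong (λ j → finToFun j t) i≡) (finToFun-funToFin (to ∘ v) t)))
        (strictlyInverseʳ (v t)))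
  }
  where
  open Inverse size
  module S = Setoid S

private
  fin-subset-finite : ∀ {n} {P : Pred (Fin n) p} → Decidable P →
                      Finite (Subsetoid (≡.setoid (Fin n)) P)
  fin-subset-finite {n = zero} P? = 0 , record
    { to = λ () ; from = λ () ; to-cong = λ { {() , _} } ; from-cong = λ { {()} }
    ; inverse = (λ { {()} }) , (λ { {() , _} }) }
  fin-subset-finite {n = suc n} {P} P? with fin-subset-finite {P = P ∘ suc} (P? ∘ suc) | P? zero
  ... | k , size | yes P0 = suc k , record
    { to = to′ ; from = from′
    ; to-cong = λ {x} {y} → to′-cong x y
    ; from-cong = λ { ≡.refl → ≡.refl }
    ; inverse = (λ {i} {x} eq → ≡.trans (to′-cong x (from′ i) eq) (invˡ i))
              , (λ { {x} ≡.refl → invʳ x }) }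
    where
    open Inverse size
    to′ : Σ (Fin (suc n)) P → Fin (suc k)
    to′ (zero  , _)  = zero
    to′ (suc i , Pi) = suc (to (i , Pi))
    from′ : Fin (suc k) → Σ (Fin (suc n)) P
    from′ zero    = zero , P0
    from′ (suc j) = suc (proj₁ (from j)) , proj₂ (from j)
    to′-cong : ∀ x y → proj₁ x ≡ proj₁ y → to′ x ≡ to′ y
    to′-cong (zero  , _) (zero  , _) eq = ≡.refl
    to′-cong (suc i , _) (suc j , _) eq = ≡.cong suc (to-cong (Fin.suc-injective eq))
    invˡ : ∀ i → to′ (from′ i) ≡ i
    invˡ zero    = ≡.refl
    invˡ (suc i) = ≡.cong suc (strictlyInverseˡ i)
    invʳ : ∀ x → proj₁ (from′ (to′ x)) ≡ proj₁ x
    invʳ (zero  , _)  = ≡.refl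
    invʳ (suc i , Pi) = ≡.cong suc (strictlyInverseʳ (i , Pi))
  ... | k , size | no ¬P0 = k , record
    { to = to′ ; from = from′
    ; to-cong = λ {x} {y} → to′-cong x y
    ; from-cong = λ { ≡.refl → ≡.refl }
    ; inverse = (λ {i} {x} eq → ≡.trans (to′-cong x (from′ i) eq) (strictlyInverseˡ i))
              , (λ { {x} ≡.refl → invʳ x }) }
    where
    open Inverse size
    to′ : Σ (Fin (suc n)) P → Fin k
    to′ (zero  , P0) = contradiction P0 ¬P0
    to′ (suc i , Pi) = to (i , Pi)
    from′ : Fin k → Σ (Fin (suc n)) P
    from′ j = suc (proj₁ (from j)) , proj₂ (from j)
    to′-cong : ∀ x y → proj₁ x ≡ proj₁ y → to′ x ≡ to′ y
    to′-cong (zero  , P0) _           eq = contradiction P0 ¬P0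
    to′-cong (suc i , _)  (suc j , _) eq = to-cong (Fin.suc-injective eq)
    invʳ : ∀ x → proj₁ (from′ (to′ x)) ≡ proj₁ x
    invʳ (zero  , P0) = contradiction P0 ¬P0
    invʳ (suc i , Pi) = ≡.cong suc (strictlyInverseʳ (i , Pi))

abstract
  subsetoid-finite : (S : Setoid a ℓ) → Finite S →
                     {P : Pred (Setoid.Carrier S) p} → P Respects (Setoid._≈_ S) →
                     Decidable P → Finite (Subsetoid S P)
  subsetoid-finite S (n , size) {P} resp P? with fin-subset-finite (P? ∘ Inverse.from size)
  ... | k , size′ = k , Compose.inverse (record
    { to        = λ (x , Px) → to x , resp (S.sym (from∘to size x)) Px
    ; from      = λ (i , Pi) → from i , Pi
    ; to-cong   = to-cong
    ; from-cong = from-cong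
    ; inverse   = inverseˡ , inverseʳ
    }) size′
    where
    open Inverse size
    module S = Setoid S

record FiniteField (q : ℕ) c ℓ : Set (lsuc (c ⊔ ℓ)) where
  field
    commutativeRing : CommutativeRing c ℓ
  open CommutativeRing commutativeRing public
  field
    0≉1        : ¬ 0# ≈ 1#
    invertible : ∀ x → ¬ x ≈ 0# → ∃ λ y → x * y ≈ 1#
    size       : HasSize setoid q

VectorSpace : ∀ {q} → FiniteField q c ℓ → ∀ m ℓm → Set (c ⊔ ℓ ⊔ lsuc (m ⊔ ℓm))
VectorSpace 𝔽 m ℓm = Module (FiniteField.commutativeRing 𝔽) m ℓm

module _ {𝔽 : CommutativeRing c ℓ} (X : Module 𝔽 m ℓm) where
  private
    module 𝔽 = CommutativeRing 𝔽
    module X = Module X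
    module ΣX = Sum X.+ᴹ-commutativeMonoid

  -- Over a finite space every subset is decidable classically, so asking for
  -- decidable membership excludes no subspace.
  record Subspace : Set (c ⊔ m ⊔ ℓm ⊔ lsuc 0ℓ) where
    field
      Member  : Pred X.Carrierᴹ 0ℓ
      member? : Decidable Member
      resp    : Member Respects X._≈ᴹ_
      0ᴹ∈     : Member X.0ᴹ
      +ᴹ∈     : ∀ {x y} → Member x → Member y → Member (x X.+ᴹ y)
      *ₗ∈     : ∀ s {x} → Member x → Member (s X.*ₗ x)

  subspaceSetoid : Setoid (c ⊔ m ⊔ ℓm ⊔ lsuc 0ℓ) m
  subspaceSetoid = record
    { Carrier = Subspace
    ; _≈_ = λ U V → Subspace.Member U ≐ Subspace.Member V
    ; isEquivalence = record
      { refl  = (λ x∈ → x∈) , (λ x∈ → x∈)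
      ; sym   = λ (f , g) → g , f
      ; trans = λ (f , g) (f′ , g′) → (λ x∈ → f′ (f x∈)) , (λ x∈ → g (g′ x∈)) } }

  linearCombination : ∀ {k} → Vector 𝔽.Carrier k → Vector X.Carrierᴹ k → X.Carrierᴹ
  linearCombination s b = ΣX.sum (λ i → s i X.*ₗ b i)

  LinearlyIndependent : ∀ {k} → Vector X.Carrierᴹ k → Set (c ⊔ ℓ ⊔ ℓm)
  LinearlyIndependent b =
    ∀ s → linearCombination s b X.≈ᴹ X.0ᴹ → ∀ i → s i 𝔽.≈ 𝔽.0#

  record IsBasis (U : Subspace) {k : ℕ} (b : Vector X.Carrierᴹ k) : Set (c ⊔ ℓ ⊔ m ⊔ ℓm) where
    open Subspace U
    field
      members     : ∀ i → Member (b i)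
      independent : LinearlyIndependent b
      spanning    : ∀ x → Member x → ∃ λ s → x X.≈ᴹ linearCombination s b

  HasDim : Subspace → ℕ → Set (c ⊔ ℓ ⊔ m ⊔ ℓm)
  HasDim U k = ∃ λ (b : Vector X.Carrierᴹ k) → IsBasis U b

  wholeSpace : Subspace
  wholeSpace = record
    { Member = λ _ → ⊤ ; member? = λ _ → yes tt ; resp = λ _ _ → tt
    ; 0ᴹ∈ = tt ; +ᴹ∈ = λ _ _ → tt ; *ₗ∈ = λ _ _ → tt }

  Dimension : ℕ → Set (c ⊔ ℓ ⊔ m ⊔ ℓm)
  Dimension = HasDim wholeSpace

  _∩_ : Subspace → Subspace → Subspace
  U ∩ V = record
    { Member  = λ x → U.Member x × V.Member x
    ; member? = λ x → U.member? x ×-dec V.member? x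
    ; resp    = λ x≈y (x∈U , x∈V) → U.resp x≈y x∈U , V.resp x≈y x∈V
    ; 0ᴹ∈     = U.0ᴹ∈ , V.0ᴹ∈
    ; +ᴹ∈     = λ (x∈U , x∈V) (y∈U , y∈V) → U.+ᴹ∈ x∈U y∈U , V.+ᴹ∈ x∈V y∈V
    ; *ₗ∈     = λ s (x∈U , x∈V) → U.*ₗ∈ s x∈U , V.*ₗ∈ s x∈V
    }
    where
    module U = Subspace U
    module V = Subspace V

  IsTrivial : Subspace → Set (m ⊔ ℓm)
  IsTrivial U = ∀ x → Subspace.Member U x → x X.≈ᴹ X.0ᴹ

  open Setoid subspaceSetoid using () renaming (_≈_ to _≋_)
  open Membership subspaceSetoid using (_∈_)
  open UniqueSetoid subspaceSetoid using (Unique)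

  -- A finite collection of subspaces is a duplicate-free list, so its
  -- cardinality is the length of the list.
  record IsPartialSpread (r : ℕ) (𝒜 : List Subspace) : Set (lsuc 0ℓ ⊔ c ⊔ ℓ ⊔ m ⊔ ℓm) where
    field
      distinct     : Unique 𝒜
      dimension    : ∀ {S} → S ∈ 𝒜 → HasDim S r
      intersection : ∀ {S S′} → S ∈ 𝒜 → S′ ∈ 𝒜 → ¬ S ≋ S′ → IsTrivial (S ∩ S′)

  -- dim (U ∩ S) ≤ h, with the dimension given relationally by HasDim.
  IsEvasive : List Subspace → ℕ → Subspace → Set (lsuc 0ℓ ⊔ c ⊔ ℓ ⊔ m ⊔ ℓm)
  IsEvasive 𝒜 h U = All (λ S → ∃ λ d → d ≤ h × HasDim (U ∩ S) d) 𝒜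

  subspacesOfDim : ℕ → Setoid (lsuc 0ℓ ⊔ c ⊔ ℓ ⊔ m ⊔ ℓm) m
  subspacesOfDim k = Subsetoid subspaceSetoid (λ U → HasDim U k)

  evasiveSubspacesOfDim : List Subspace → ℕ → ℕ → Setoid (lsuc 0ℓ ⊔ c ⊔ ℓ ⊔ m ⊔ ℓm) m
  evasiveSubspacesOfDim 𝒜 h k =
    Subsetoid subspaceSetoid (λ U → HasDim U k × IsEvasive 𝒜 h U)

  private
    lc-cong : ∀ {k} {s s′ : Vector 𝔽.Carrier k} {b b′ : Vector X.Carrierᴹ k} →
              (∀ i → s i 𝔽.≈ s′ i) → (∀ i → b i X.≈ᴹ b′ i) →
              linearCombination s b X.≈ᴹ linearCombination s′ b′
    lc-cong s≋ b≋ = ΣX.sum-cong-≋ (λ i → X.*ₗ-cong (s≋ i) (b≋ i))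

    lc-+ : ∀ {k} (s s′ : Vector 𝔽.Carrier k) (b : Vector X.Carrierᴹ k) →
           linearCombination (λ i → s i 𝔽.+ s′ i) b X.≈ᴹ
           linearCombination s b X.+ᴹ linearCombination s′ b
    lc-+ s s′ b = X.≈ᴹ-trans (ΣX.sum-cong-≋ (λ i → X.*ₗ-distribʳ (b i) (s i) (s′ i)))
                             (ΣX.∑-distrib-+ (λ i → s i X.*ₗ b i) (λ i → s′ i X.*ₗ b i))

    lc-0 : ∀ {k} (b : Vector X.Carrierᴹ k) → linearCombination (λ _ → 𝔽.0#) b X.≈ᴹ X.0ᴹ
    lc-0 {k} b = X.≈ᴹ-trans (ΣX.sum-cong-≋ (λ i → X.*ₗ-zeroˡ (b i))) (ΣX.sum-replicate-zero k)

    lc-injective : ∀ {k} {b : Vector X.Carrierᴹ k} → LinearlyIndependent b → ∀ s s′ →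
                   linearCombination s b X.≈ᴹ linearCombination s′ b → ∀ i → s i 𝔽.≈ s′ i
    lc-injective {b = b} indep s s′ eq i =
      x∙y⁻¹≈ε⇒x≈y (s i) (s′ i)
        (indep (λ j → s j 𝔽.+ 𝔽.- s′ j)
          (X.≈ᴹ-trans (lc-+ s (λ j → 𝔽.- s′ j) b)
            (X.≈ᴹ-trans (X.+ᴹ-congʳ eq)
              (X.≈ᴹ-trans (X.≈ᴹ-sym (lc-+ s′ (λ j → 𝔽.- s′ j) b))
                (X.≈ᴹ-trans (lc-cong (λ j → 𝔽.-‿inverseʳ (s′ j)) (λ _ → X.≈ᴹ-refl)) (lc-0 b)))))
          i)
      where open import Algebra.Properties.Group 𝔽.+-group using (x∙y⁻¹≈ε⇒x≈y)

  HasDim-resp : ∀ k → (λ U → HasDim U k) Respects _≋_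
  HasDim-resp k (U⊆V , V⊆U) (b , basis) = b , record
    { members     = λ i → U⊆V (members i)
    ; independent = independent
    ; spanning    = λ x x∈V → spanning x (V⊆U x∈V) }
    where open IsBasis basis

  IsEvasive-resp : ∀ 𝒜 h → IsEvasive 𝒜 h Respects _≋_
  IsEvasive-resp 𝒜 h {U} {V} (U⊆V , V⊆U) =
    All.map λ {S} (d , d≤h , dim) → d , d≤h ,
      HasDim-resp d {U ∩ S} {V ∩ S}
        ((λ (x∈U , x∈S) → U⊆V x∈U , x∈S) , (λ (x∈V , x∈S) → V⊆U x∈V , x∈S)) dim

  module _ {q N : ℕ} (𝔽-size : HasSize 𝔽.setoid q) (dimX : Dimension N) where
    private
      b₀ = proj₁ dimX
      module b₀ = IsBasis (proj₂ dimX)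

    space-size : HasSize X.≈ᴹ-setoid (q ^ N)
    space-size = Compose.inverse (record
      { to        = coords
      ; from      = λ s → linearCombination s b₀
      ; to-cong   = λ {x} {y} x≈y → coords-unique (X.≈ᴹ-trans x≈y (coords-eq y))
      ; from-cong = λ s≋ → lc-cong s≋ (λ _ → X.≈ᴹ-refl)
      ; inverse   = coords-unique
                  , λ {x} s≋ → X.≈ᴹ-trans (lc-cong s≋ (λ _ → X.≈ᴹ-refl)) (X.≈ᴹ-sym (coords-eq x))
      }) (vector-size {S = 𝔽.setoid} 𝔽-size N)
      where
      coords : X.Carrierᴹ → Vector 𝔽.Carrier N
      coords x = proj₁ (b₀.spanning x tt)
      coords-eq : ∀ x → x X.≈ᴹ linearCombination (coords x) b₀
      coords-eq x = proj₂ (b₀.spanning x tt)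
      coords-unique : ∀ {x s} → x X.≈ᴹ linearCombination s b₀ → ∀ i → coords x i 𝔽.≈ s i
      coords-unique {x} {s} eq =
        lc-injective b₀.independent (coords x) s (X.≈ᴹ-trans (X.≈ᴹ-sym (coords-eq x)) eq)

    private
      _≈ᴹ?_ : B.Decidable X._≈ᴹ_
      _≈ᴹ?_ = finite-≈? {S = X.≈ᴹ-setoid} space-size

      scalars : ∀ k → HasSize (vectorSetoid 𝔽.setoid k) (q ^ k)
      scalars = vector-size {S = 𝔽.setoid} 𝔽-size

      independent? : ∀ {k} → Decidable (LinearlyIndependent {k})
      independent? {k} b = finite-all? {S = vectorSetoid 𝔽.setoid k} (scalars k)
        (λ s≋s′ f eq i → 𝔽.trans (𝔽.sym (s≋s′ i))
          (f (X.≈ᴹ-trans (lc-cong s≋s′ (λ _ → X.≈ᴹ-refl)) eq) i))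
        (λ s → (linearCombination s b ≈ᴹ? X.0ᴹ) →-dec
               all? (λ i → finite-≈? {S = 𝔽.setoid} 𝔽-size (s i) 𝔽.0#))

      spanning? : ∀ U {k} (b : Vector X.Carrierᴹ k) →
                  Dec (∀ x → Subspace.Member U x → ∃ λ s → x X.≈ᴹ linearCombination s b)
      spanning? U {k} b = finite-all? {S = X.≈ᴹ-setoid} space-size
        (λ x≈y f y∈ → let s , eq = f (U.resp (X.≈ᴹ-sym x≈y) y∈) in
                      s , X.≈ᴹ-trans (X.≈ᴹ-sym x≈y) eq)
        (λ x → U.member? x →-dec
          finite-any? {S = vectorSetoid 𝔽.setoid k} (scalars k)
            (λ s≋s′ eq → X.≈ᴹ-trans eq (lc-cong s≋s′ (λ _ → X.≈ᴹ-refl)))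
            (λ s → x ≈ᴹ? linearCombination s b))
        where module U = Subspace U

      isBasis? : ∀ U {k} → Decidable (IsBasis U {k})
      isBasis? U b = map′
        (λ (p , r , s) → record { members = p ; independent = r ; spanning = s })
        (λ basis → IsBasis.members basis , IsBasis.independent basis , IsBasis.spanning basis)
        (all? (λ i → Subspace.member? U (b i)) ×-dec independent? b ×-dec spanning? U b)

      isBasis-resp : ∀ U {k} {b b′ : Vector X.Carrierᴹ k} → (∀ i → b i X.≈ᴹ b′ i) →
                     IsBasis U b → IsBasis U b′
      isBasis-resp U b≋b′ basis = record
        { members     = λ i → Subspace.resp U (b≋b′ i) (members i)
        ; independent = λ s eq → independent s
                          (X.≈ᴹ-trans (lc-cong (λ _ → 𝔽.refl) b≋b′) eq)
        ; spanning    = λ x x∈ → let s , eq = spanning x x∈ in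
                          s , X.≈ᴹ-trans eq (lc-cong (λ _ → 𝔽.refl) b≋b′) }
        where open IsBasis basis

    private
      open Inverse space-size
      module 𝔽ₛ = Inverse 𝔽-size
      from-to : ∀ x → from (to x) X.≈ᴹ x
      from-to = strictlyInverseʳ

      bitsSetoid : Setoid 0ℓ 0ℓ
      bitsSetoid = vectorSetoid (≡.setoid Bool) (q ^ N)

      Closed : Pred (Vector Bool (q ^ N)) 0ℓ
      Closed f = T (f (to X.0ᴹ))
               × (∀ i j → T (f i) → T (f j) → T (f (to (from i X.+ᴹ from j))))
               × (∀ s i → T (f i) → T (f (to (𝔽ₛ.from s X.*ₗ from i))))

      Closed? : Decidable Closed
      Closed? f =
        T? _
        ×-dec all? (λ i → all? λ j → T? _ →-dec (T? _ →-dec T? _))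
        ×-dec all? (λ s → all? λ i → T? _ →-dec T? _)

      Closed-resp : ∀ {f g} → (∀ i → f i ≡ g i) → Closed f → Closed g
      Closed-resp f≗g (z , a , m) =
          ≡.subst T (f≗g _) z
        , (λ i j i∈ j∈ → ≡.subst T (f≗g _)
             (a i j (≡.subst T (≡.sym (f≗g i)) i∈) (≡.subst T (≡.sym (f≗g j)) j∈)))
        , (λ s i i∈ → ≡.subst T (f≗g _) (m s i (≡.subst T (≡.sym (f≗g i)) i∈)))

      closed-finite : Finite (Subsetoid bitsSetoid Closed)
      closed-finite = subsetoid-finite bitsSetoid
        (2 ^ (q ^ N) , vector-size (Symmetry.inverse 2↔Bool) (q ^ N)) Closed-resp Closed?

      toSubspace : ∀ f → Closed f → Subspace
      toSubspace f (z , a , m) = record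
        { Member  = λ x → T (f (to x))
        ; member? = λ x → T? (f (to x))
        ; resp    = λ x≈y → ≡.subst (T ∘ f) (to-cong x≈y)
        ; 0ᴹ∈     = z
        ; +ᴹ∈     = λ {x} {y} x∈ y∈ → ≡.subst (T ∘ f)
                      (to-cong (X.+ᴹ-cong (from-to x) (from-to y))) (a (to x) (to y) x∈ y∈)
        ; *ₗ∈     = λ s {x} x∈ → ≡.subst (T ∘ f)
                      (to-cong (X.*ₗ-cong (𝔽ₛ.strictlyInverseʳ s) (from-to x)))
                      (m (𝔽ₛ.to s) (to x) x∈)
        }

      bits : Subspace → Vector Bool (q ^ N)
      bits U i = ⌊ Subspace.member? U (from i) ⌋

      bit⇒∈ : ∀ U {x} → T (bits U (to x)) → Subspace.Member U x
      bit⇒∈ U {x} t = Subspace.resp U (from-to x) (toWitness t)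

      ∈⇒bit : ∀ U {x} → Subspace.Member U x → T (bits U (to x))
      ∈⇒bit U {x} x∈ = fromWitness (Subspace.resp U (X.≈ᴹ-sym (from-to x)) x∈)

      bits-closed : ∀ U → Closed (bits U)
      bits-closed U =
          ∈⇒bit U U.0ᴹ∈
        , (λ i j i∈ j∈ → ∈⇒bit U (U.+ᴹ∈ (toWitness i∈) (toWitness j∈)))
        , (λ s i i∈ → ∈⇒bit U (U.*ₗ∈ (𝔽ₛ.from s) (toWitness i∈)))
        where module U = Subspace U

      bits-cong : ∀ U V → U ≋ V → ∀ i → bits U i ≡ bits V i
      bits-cong U V (U⊆V , V⊆U) i with Subspace.member? U (from i) | Subspace.member? V (from i)
      ... | yes _  | yes _  = ≡.refl
      ... | no _   | no _   = ≡.refl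
      ... | yes i∈ | no i∉  = contradiction (U⊆V i∈) i∉
      ... | no i∉  | yes i∈ = contradiction (V⊆U i∈) i∉

      does-T : ∀ b → ⌊ T? b ⌋ ≡ b
      does-T true  = ≡.refl
      does-T false = ≡.refl

    abstract
      hasDim? : ∀ U k → Dec (HasDim U k)
      hasDim? U k = finite-any? {S = vectorSetoid X.≈ᴹ-setoid k}
        (vector-size {S = X.≈ᴹ-setoid} space-size k) (isBasis-resp U) (isBasis? U)

      isEvasive? : ∀ 𝒜 h → Decidable (IsEvasive 𝒜 h)
      isEvasive? 𝒜 h U = All.all? (λ S → map′
        (λ (d , d<1+h , dim) → d , s≤s⁻¹ d<1+h , dim)
        (λ (d , d≤h , dim) → d , s≤s d≤h , dim)
        (anyUpTo? (hasDim? (U ∩ S)) (suc h))) 𝒜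

      subspaces-finite : Finite subspaceSetoid
      subspaces-finite = proj₁ closed-finite , Compose.inverse (record
        { to        = λ U → bits U , bits-closed U
        ; from      = λ (f , closed) → toSubspace f closed
        ; to-cong   = λ {U} {V} → bits-cong U V
        ; from-cong = λ f≗g → (λ {x} → ≡.subst T (f≗g (to x)))
                            , (λ {x} → ≡.subst T (≡.sym (f≗g (to x))))
        ; inverse   = (λ {(f , closed)} {U} U≋ i →
                        ≡.trans (bits-cong U (toSubspace f closed) U≋ i)
                          (≡.trans (does-T (f (to (from i)))) (≡.cong f (strictlyInverseˡ i))))
                    , (λ {U} {(f , closed)} f≗ →
                          (λ {x} t → bit⇒∈ U (≡.subst T (f≗ (to x)) t))
                        , (λ {x} x∈ → ≡.subst T (≡.sym (f≗ (to x))) (∈⇒bit U x∈)))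
        }) (proj₂ closed-finite)

    subspacesOfDim-finite : ∀ k → Finite (subspacesOfDim k)
    subspacesOfDim-finite k =
      subsetoid-finite subspaceSetoid subspaces-finite
        (λ {U} {V} → HasDim-resp k {U} {V}) (λ U → hasDim? U k)

    evasiveSubspacesOfDim-finite : ∀ 𝒜 h k → Finite (evasiveSubspacesOfDim 𝒜 h k)
    evasiveSubspacesOfDim-finite 𝒜 h k =
      subsetoid-finite subspaceSetoid subspaces-finite
        (λ {U} {V} U≋V (dim , ev) → HasDim-resp k {U} {V} U≋V dim , IsEvasive-resp 𝒜 h {U} {V} U≋V ev)
        (λ U → hasDim? U k ×-dec isEvasive? 𝒜 h U)

module _ {q : ℕ} (𝔽 : FiniteField q c ℓ) where
  private
    module 𝔽 = FiniteField 𝔽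

  coordinateSpace : ℕ → VectorSpace 𝔽 c ℓ
  coordinateSpace N = record
    { Carrierᴹ = Vector 𝔽.Carrier N
    ; _≈ᴹ_     = λ v w → ∀ i → v i 𝔽.≈ w i
    ; _+ᴹ_     = λ v w i → v i 𝔽.+ w i
    ; _*ₗ_     = λ s v i → s 𝔽.* v i
    ; _*ᵣ_     = λ v s i → s 𝔽.* v i
    ; 0ᴹ       = λ _ → 𝔽.0#
    ; -ᴹ_      = λ v i → 𝔽.- v i
    ; isModule = IsModuleFromLeft.isModule {commutativeRing = 𝔽.commutativeRing} record
      { isLeftModule = record
        { isLeftSemimodule = record
          { +ᴹ-isCommutativeMonoid = record
            { isMonoid = record
              { isSemigroup = record
                { isMagma = record
                  { isEquivalence = Setoid.isEquivalence (vectorSetoid 𝔽.setoid N)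
                  ; ∙-cong = λ v≈ w≈ i → 𝔽.+-cong (v≈ i) (w≈ i) }
                ; assoc = λ u v w i → 𝔽.+-assoc (u i) (v i) (w i) }
              ; identity = (λ v i → 𝔽.+-identityˡ (v i)) , (λ v i → 𝔽.+-identityʳ (v i)) }
            ; comm = λ v w i → 𝔽.+-comm (v i) (w i) }
          ; isPreleftSemimodule = record
            { *ₗ-cong      = λ s≈ v≈ i → 𝔽.*-cong s≈ (v≈ i)
            ; *ₗ-zeroˡ     = λ v i → 𝔽.zeroˡ (v i)
            ; *ₗ-distribʳ  = λ v s t i → 𝔽.distribʳ (v i) s t
            ; *ₗ-identityˡ = λ v i → 𝔽.*-identityˡ (v i)
            ; *ₗ-assoc     = λ s t v i → 𝔽.*-assoc s t (v i)
            ; *ₗ-zeroʳ     = λ s i → 𝔽.zeroʳ s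
            ; *ₗ-distribˡ  = λ s v w i → 𝔽.distribˡ s (v i) (w i) } }
        ; -ᴹ‿cong = λ v≈ i → 𝔽.-‿cong (v≈ i)
        ; -ᴹ‿inverse = (λ v i → 𝔽.-‿inverseˡ (v i)) , (λ v i → 𝔽.-‿inverseʳ (v i)) } }
    }

  module _ {N k : ℕ} (k≤N : k ≤ N) where
    private
      X = coordinateSpace N
      module Σ𝔽 = Sum 𝔽.+-commutativeMonoid
      module ΣX = Sum (Module.+ᴹ-commutativeMonoid X)

      ι : Fin k → Fin N
      ι i = inject≤ i k≤N

      δ : Fin N → Fin N → 𝔽.Carrier
      δ i j with i Fin.≟ j
      ... | yes _ = 𝔽.1#
      ... | no  _ = 𝔽.0#

      δ-≡ : ∀ i → δ i i 𝔽.≈ 𝔽.1#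
      δ-≡ i with i Fin.≟ i
      ... | yes _  = 𝔽.refl
      ... | no i≢i = contradiction ≡.refl i≢i

      δ-≢ : ∀ {i j} → i ≢ j → δ i j 𝔽.≈ 𝔽.0#
      δ-≢ {i} {j} i≢j with i Fin.≟ j
      ... | yes i≡j = contradiction i≡j i≢j
      ... | no _    = 𝔽.refl

      sum-at : ∀ {n} (v : Fin n → Vector 𝔽.Carrier N) i → ΣX.sum v i 𝔽.≈ Σ𝔽.sum (λ j → v j i)
      sum-at {zero}  v i = 𝔽.refl
      sum-at {suc n} v i = 𝔽.+-congˡ (sum-at (v ∘ suc) i)

      sum-0 : ∀ {n} (s : Vector 𝔽.Carrier n) → (∀ i → s i 𝔽.≈ 𝔽.0#) → Σ𝔽.sum s 𝔽.≈ 𝔽.0#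
      sum-0 {n} s s≈0 = 𝔽.trans (Σ𝔽.sum-cong-≋ s≈0) (Σ𝔽.sum-replicate-zero n)

      sum-single : ∀ {n} (s : Vector 𝔽.Carrier n) i → (∀ j → j ≢ i → s j 𝔽.≈ 𝔽.0#) →
                   Σ𝔽.sum s 𝔽.≈ s i
      sum-single {suc n} s i s≈0 = 𝔽.trans (Σ𝔽.sum-remove {i = i} s)
        (𝔽.trans (𝔽.+-congˡ (sum-0 _ (λ j → s≈0 (punchIn i j) (punchInᵢ≢i i j))))
                 (𝔽.+-identityʳ (s i)))

      unit : Fin k → Vector 𝔽.Carrier N
      unit i = δ (ι i)

      lc-ι : ∀ s i → linearCombination X s unit (ι i) 𝔽.≈ s i
      lc-ι s i = 𝔽.trans (sum-at (λ j t → s j 𝔽.* unit j t) (ι i)) (𝔽.trans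
        (sum-single _ i (λ j j≢i → 𝔽.trans
          (𝔽.*-congˡ (δ-≢ (j≢i ∘ Fin.inject≤-injective k≤N k≤N j i))) (𝔽.zeroʳ (s j))))
        (𝔽.trans (𝔽.*-congˡ (δ-≡ (ι i))) (𝔽.*-identityʳ (s i))))

      ι≢ : ∀ {t} → k ≤ toℕ t → ∀ j → ι j ≢ t
      ι≢ k≤t j ≡.refl =
        ℕ.<⇒≱ (Fin.toℕ<n j) (≡.subst (k ≤_) (Fin.toℕ-inject≤ j k≤N) k≤t)

      lc-outside : ∀ s {t} → k ≤ toℕ t → linearCombination X s unit t 𝔽.≈ 𝔽.0#
      lc-outside s {t} k≤t = 𝔽.trans (sum-at (λ j t → s j 𝔽.* unit j t) t)
        (sum-0 _ (λ j → 𝔽.trans (𝔽.*-congˡ (δ-≢ (ι≢ k≤t j))) (𝔽.zeroʳ (s j))))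

      Supported : Vector 𝔽.Carrier N → Set ℓ
      Supported v = ∀ t → k ≤ toℕ t → v t 𝔽.≈ 𝔽.0#

      Supported? : Decidable Supported
      Supported? v = all? (λ t → (k ≤? toℕ t) →-dec finite-≈? {S = 𝔽.setoid} 𝔽.size (v t) 𝔽.0#)

      U : Subspace X
      U = record
        { Member  = λ v → True (Supported? v)
        ; member? = λ v → T? _
        ; resp    = λ {v} {w} v≈w v∈ → fromWitness {a? = Supported? w} (λ t k≤t →
                      𝔽.trans (𝔽.sym (v≈w t)) (toWitness v∈ t k≤t))
        ; 0ᴹ∈     = fromWitness {a? = Supported? _} (λ _ _ → 𝔽.refl)
        ; +ᴹ∈     = λ v∈ w∈ → fromWitness {a? = Supported? _} (λ t k≤t → 𝔽.trans
                      (𝔽.+-cong (toWitness v∈ t k≤t) (toWitness w∈ t k≤t)) (𝔽.+-identityˡ 𝔽.0#))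
        ; *ₗ∈     = λ s v∈ → fromWitness {a? = Supported? _} (λ t k≤t → 𝔽.trans
                      (𝔽.*-congˡ (toWitness v∈ t k≤t)) (𝔽.zeroʳ s))
        }

      basis : IsBasis X U unit
      basis = record
        { members     = λ i → fromWitness {a? = Supported? _} (λ t k≤t → δ-≢ (ι≢ k≤t i))
        ; independent = λ s eq i → 𝔽.trans (𝔽.sym (lc-ι s i)) (eq (ι i))
        ; spanning    = λ v v∈ → v ∘ ι , λ t → case k ≤? toℕ t of λ where
            (yes k≤t) → 𝔽.trans (toWitness v∈ t k≤t) (𝔽.sym (lc-outside (v ∘ ι) k≤t))
            (no  k≰t) → ≡.subst (λ t → v t 𝔽.≈ linearCombination X (v ∘ ι) unit t)
              (Fin.toℕ-injective (≡.trans (Fin.toℕ-inject≤ _ k≤N) (Fin.toℕ-fromℕ< (ℕ.≰⇒> k≰t))))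
              (𝔽.sym (lc-ι (v ∘ ι) (fromℕ< (ℕ.≰⇒> k≰t))))
        }

    firstCoordinates : ∃ λ U → HasDim X U k ×
                               (∀ v → (∀ t → k ≤ toℕ t → v t 𝔽.≈ 𝔽.0#) → Subspace.Member U v)
    firstCoordinates = U , (unit , basis) , λ v → fromWitness {a? = Supported? v}

  coordinateSpace-dimension : ∀ N → Dimension (coordinateSpace N) N
  coordinateSpace-dimension N = let U , (b , basis) , all∈U = firstCoordinates (ℕ.≤-refl {N}) in
    b , record
      { members     = λ _ → tt
      ; independent = IsBasis.independent basis
      ; spanning    = λ x _ → IsBasis.spanning basis x
                          (all∈U x (λ t N≤t → contradiction N≤t (ℕ.<⇒≱ (Fin.toℕ<n t))))
      }

  -- The number of k-dimensional subspaces of 𝔽ᴺ, as a count.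
  gaussianBinomial : ℕ → ℕ → ℕ
  gaussianBinomial N k =
    ∣ subspacesOfDim-finite (coordinateSpace N) 𝔽.size (coordinateSpace-dimension N) k ∣

  gaussianBinomial-nonZero : ∀ {N k} → k ≤ N → NonZero (gaussianBinomial N k)
  gaussianBinomial-nonZero {N} {k} k≤N = Fin.nonZeroIndex
    (Inverse.to (proj₂ (subspacesOfDim-finite (coordinateSpace N) 𝔽.size (coordinateSpace-dimension N) k))
      (let U , dim , _ = firstCoordinates k≤N in U , dim))

module _ {q : ℕ} (𝔽 : FiniteField q c ℓ) (X : VectorSpace 𝔽 m ℓm) {N : ℕ} (dimX : Dimension X N)
  where

  evasiveCount : List (Subspace X) → ℕ → ℕ → ℕ
  evasiveCount 𝒜 h k = ∣ evasiveSubspacesOfDim-finite X (FiniteField.size 𝔽) dimX 𝒜 h k ∣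

  evasiveProportion : List (Subspace X) → ℕ → (k : ℕ) → k ≤ N → ℚ
  evasiveProportion 𝒜 h k k≤N =
    ((+ evasiveCount 𝒜 h k) ℚ./ gaussianBinomial 𝔽 N k) {{gaussianBinomial-nonZero 𝔽 k≤N}}

IsPrimePower : ℕ → Set
IsPrimePower q = ∃₂ λ p e → Prime p × 1 ≤ e × q ≡ p ^ e

-- The proof is irrelevant, so a family indexed by PrimePower has exactly one
-- member for each prime power.
record PrimePower : Set where
  field
    value         : ℕ
    .isPrimePower : IsPrimePower value
open PrimePower public using (value)

Eventually : (PrimePower → Set) → Set
Eventually P = ∃ λ q₀ → ∀ q → q₀ ≤ value q → P q

infix 4 _⟶_ _∈o_

-- Rational ε suffice, since the positive rationals are coinitial in the
-- positive reals.
_⟶_ : (PrimePower → ℚ) → ℚ → Set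
f ⟶ L = ∀ ε → 0ℚ ℚ.< ε → Eventually λ q → ℚ.∣ f q ℚ.- L ∣ ℚ.< ε

_∈o_ : (PrimePower → ℕ) → (PrimePower → ℕ) → Set
f ∈o g = ∀ ε → 0ℚ ℚ.< ε → Eventually λ q → (+ f q) ℚ./ 1 ℚ.≤ ε ℚ.* ((+ g q) ℚ./ 1)

{-# OPTIONS --safe #-}
module Submission where

-- Replace a random k-dimensional subspace U by a random k-tuple φ of vectors
-- of X: a tuple is independent with probability 1 - O(1/q), and every U is the
-- span of the same number g of independent tuples. Put t = h + 1. Then U is
-- not evasive iff some independent t-tuple of combinations A φ lies in some
-- member S of 𝒜, and for fixed A and S this has probability q^(t (m - N)).
--
-- If |𝒜| = o(q^γ), Markov's inequality for the number of pairs (S , A)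
-- suffices, since an incident pair comes with its whole GLₜ-orbit of about
-- q^(t²) pairs.
--
-- If q^γ = o(|𝒜|), Chebyshev's inequality is applied to the number of incident
-- pairs (S , A) with A = [ M | I ], a family of q^(t (k - t)) matrices. For two
-- different members of 𝒜, which meet trivially, the rows of the difference of
-- the two M are independent as soon as φ is, so the two incidences are
-- uncorrelated. For a single member, the number of pairs of matrices is
-- controlled by counting the (ψ , Y) with the rows of Y ψ in S. Finally q^γ can
-- be o(|𝒜|) with k < t for no partial spread, as the members are disjoint
-- outside 0.

open import Defs
open import Algebra.Bundles using (CommutativeMonoid)
open import Algebra.Module.Bundles using (Module)
import Algebra.Properties.CommutativeMonoid.Sum as Sum
open import Algebra.Properties.CommutativeSemigroup using (interchange)
import Algebra.Properties.Group as GroupProperties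
import Algebra.Properties.Ring as RingProperties
import Algebra.Properties.Semiring.Sum as SemiringSum
open import Data.Fin.Base using (Fin; zero; suc; _↑ˡ_; _↑ʳ_; splitAt; combine; remQuot; punchIn)
open import Data.Fin.Properties as Fin using (all?; any?; remQuot-combine; combine-remQuot)
import Data.Integer.Base as ℤ
import Data.Integer.Properties as ℤ
open import Data.List.Base as List using (List; length; lookup)
open import Data.List.Membership.Propositional.Properties using (∈-lookup)
import Data.List.Membership.Setoid.Properties as SetoidMembership
open import Data.List.Relation.Unary.All as All using (All)
open import Data.List.Relation.Unary.AllPairs as AllPairs using (AllPairs)
open import Data.Nat.Base
  using (ℕ; zero; suc; _+_; _*_; _∸_; _^_; _≤_; _<_; z≤n; s≤s; NonZero; >-nonZero; >-nonZero⁻¹)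
import Data.Nat.Properties as ℕ
open import Data.Nat.Tactic.RingSolver using (solve-∀)
open import Data.Product using (∃; _×_; _,_; proj₁; proj₂)
open import Data.Product.Relation.Binary.Pointwise.NonDependent using (×-setoid)
open import Data.Rational.Base as ℚ using (mkℚ; 0ℚ; 1ℚ; toℚᵘ)
import Data.Rational.Properties as ℚ
open import Data.Rational.Unnormalised.Base as ℚᵘ using (mkℚᵘ)
import Data.Rational.Unnormalised.Properties as ℚᵘ
open import Data.Sum.Base using (_⊎_; inj₁; inj₂; [_,_]; [_,_]′)
open import Data.Unit.Base using (⊤; tt)
open import Data.Vec.Functional using (Vector; []; _∷_; _++_)
open import Function.Base using (_∘_; id)
open import Function.Bundles using (Inverse)
open import Level using (Level; _⊔_)
open import Relation.Binary.Bundles using (Setoid)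
open import Relation.Binary.Core using (Rel)
open import Relation.Binary.Definitions using (_Respects_; Symmetric)
import Relation.Binary.Definitions as B
open import Relation.Binary.PropositionalEquality as ≡ using (_≡_; _≢_)
import Relation.Binary.Reasoning.Setoid as SetoidReasoning
open import Relation.Nullary using (¬_; Dec; yes; no; contradiction)
open import Relation.Nullary.Decidable
  using (_×-dec_; _→-dec_; ¬?; True; toWitness; fromWitness; T?; decidable-stable)
open import Relation.Unary using (Pred; Decidable)

-- Both halves rest on one expected value. The matrices A fall into GLₜ-orbits of size about q^(t²),
-- so the expected number of incident orbits is about |𝒜| q^(t k - t² + t (m - N)) = |𝒜| / q^γ. In
-- the second half, counting all A would let one incidence bring its whole orbit along and swamp the
-- variance. The matrices [ M | I ] have pairwise different row spaces, so they meet each orbit at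
-- most once. For a single member there remain the pairs M ≠ M′ that are hit together. They exceed
-- the diagonal M = M′ by at most a constant factor (t + 1)^(k - t), thanks to k + m ≤ N, and q^γ =
-- o(|𝒜|) absorbs any constant. No division occurs before the final comparison of ratios: "X is at
-- least the proportion 1 - e / q of Y" is written q Y ≤ q X + e Y. The number g of invertible k × k
-- matrices is never evaluated, since the proportion E / G is compared as (E g) / (G g).

private variable
  a a′ b b′ c ℓ ℓ′ p r ℓr : Level

-- Counting over enumerated setoids

module Σℕ = SemiringSum ℕ.+-*-semiring
open Σℕ using (sum)

sum-mono : ∀ {n} {f g : Vector ℕ n} → (∀ i → f i ≤ g i) → sum f ≤ sum g
sum-mono {zero}  f≤g = z≤n
sum-mono {suc n} f≤g = ℕ.+-mono-≤ (f≤g zero) (sum-mono (f≤g ∘ suc))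

sum-const : ∀ n x → sum {n} (λ _ → x) ≡ n * x
sum-const zero    x = ≡.refl
sum-const (suc n) x = ≡.cong (x +_) (sum-const n x)

sum-++ : ∀ m {n} (f : Vector ℕ (m + n)) → sum f ≡ sum (λ i → f (i ↑ˡ n)) + sum (λ j → f (m ↑ʳ j))
sum-++ zero    f = ≡.refl
sum-++ (suc m) f = ≡.trans (≡.cong (f zero +_) (sum-++ m (f ∘ suc))) (≡.sym (ℕ.+-assoc (f zero) _ _))

sum-combine : ∀ m {n} (f : Vector ℕ (m * n)) → sum f ≡ sum (λ i → sum (λ j → f (combine {m} {n} i j)))
sum-combine zero        f = ≡.refl
sum-combine (suc m) {n} f =
  ≡.trans (sum-++ n f) (≡.cong (sum (λ j → f (j ↑ˡ (m * n))) +_) (sum-combine m (λ j → f (n ↑ʳ j))))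

ind : {P : Set p} → Dec P → ℕ
ind (yes _) = 1
ind (no  _) = 0

ind-mono : {P : Set p} {Q : Set r} (P? : Dec P) (Q? : Dec Q) → (P → Q) → ind P? ≤ ind Q?
ind-mono (no _)  _        _ = z≤n
ind-mono (yes p) (yes _)  _ = ℕ.≤-refl
ind-mono (yes p) (no ¬q)  f = contradiction (f p) ¬q

ind-yes : {P : Set p} (P? : Dec P) → P → ind P? ≡ 1
ind-yes (yes _) _ = ≡.refl
ind-yes (no ¬p) p = contradiction p ¬p

ind-*-≤ : {P : Set p} (P? : Dec P) {x y : ℕ} → (P → x ≤ y) → ind P? * x ≤ y
ind-*-≤ (yes p) {x} x≤y = ℕ.≤-trans (ℕ.≤-reflexive (ℕ.*-identityˡ x)) (x≤y p)
ind-*-≤ (no _)  x≤y = z≤n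

ind-no : {P : Set p} (P? : Dec P) → ¬ P → ind P? ≡ 0
ind-no (yes p) ¬p = contradiction p ¬p
ind-no (no _)  _  = ≡.refl

ind-× : {P : Set p} {Q : Set r} (P? : Dec P) (Q? : Dec Q) → ind (P? ×-dec Q?) ≡ ind P? * ind Q?
ind-× (yes _) (yes _) = ≡.refl
ind-× (yes _) (no _)  = ≡.refl
ind-× (no _)  _       = ≡.refl

private
  -- Induction on the source: the image `j` of a counted first index is struck out of `Q`, which
  -- costs exactly one, and injectivity keeps the remaining images away from `j`.
  fin-count-injection :
    ∀ {n m} {P : Pred (Fin n) p} {Q : Pred (Fin m) r} (P? : Decidable P) (Q? : Decidable Q)
    (h : ∀ i → P i → Fin m) → (∀ i p → Q (h i p)) →
    (∀ i j p p′ → h i p ≡ h j p′ → i ≡ j) → sum (ind ∘ P?) ≤ sum (ind ∘ Q?)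
  fin-count-injection {n = zero} P? Q? h Qh h-inj = z≤n
  fin-count-injection {n = suc n} P? Q? h Qh h-inj with P? zero
  ... | no ¬p = fin-count-injection (P? ∘ suc) Q? (h ∘ suc) (Qh ∘ suc)
                  (λ i j p p′ eq → Fin.suc-injective (h-inj (suc i) (suc j) p p′ eq))
  fin-count-injection {n = suc n} {m = zero}  P? Q? h Qh h-inj | yes p with () ← h zero p
  fin-count-injection {n = suc n} {m = suc m} P? Q? h Qh h-inj | yes p =
    ℕ.≤-trans (s≤s (fin-count-injection (P? ∘ suc) (λ i → Q? i ×-dec ¬? (i Fin.≟ j)) (h ∘ suc)
                (λ i p′ → Qh (suc i) p′ , λ eq → Fin.0≢1+n (≡.sym (h-inj (suc i) zero p′ p eq)))
                (λ i i′ p p′ eq → Fin.suc-injective (h-inj (suc i) (suc i′) p p′ eq))))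
      (ℕ.≤-trans (s≤s (ℕ.≤-reflexive (Σℕ.sum-remove {i = j} Q″))) (ℕ.≤-trans
        (ℕ.+-mono-≤ (ℕ.≤-reflexive (≡.sym (ind-yes (Q? j) (Qh zero p))))
          (ℕ.≤-trans (ℕ.≤-reflexive (≡.cong (_+ sum (Q″ ∘ punchIn j)) (ind-no (Q? j ×-dec ¬? (j Fin.≟ j)) (λ (_ , j≢j) → j≢j ≡.refl))))
            (sum-mono (λ i → ind-mono (Q? (punchIn j i) ×-dec ¬? (punchIn j i Fin.≟ j)) (Q? (punchIn j i)) proj₁))))
        (ℕ.≤-reflexive (≡.sym (Σℕ.sum-remove {i = j} (ind ∘ Q?))))))
    where
    j = h zero p
    Q″ : Vector ℕ (suc m)
    Q″ i = ind (Q? i ×-dec ¬? (i Fin.≟ j))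

fin-size : ∀ n → HasSize (≡.setoid (Fin n)) n
fin-size n = record { to = id ; from = id ; to-cong = id ; from-cong = id ; inverse = id , id }

module _ {S : Setoid a ℓ} {n : ℕ} (size : HasSize S n) where
  private module S = Setoid S

  opaque
    ∑ : (S.Carrier → ℕ) → ℕ
    ∑ f = sum (f ∘ Inverse.from size)

  count : {P : Pred S.Carrier p} → Decidable P → ℕ
  count P? = ∑ (λ x → ind (P? x))

  opaque
    unfolding ∑

    ∑-mono : {f g : S.Carrier → ℕ} → (∀ x → f x ≤ g x) → ∑ f ≤ ∑ g
    ∑-mono f≤g = sum-mono (λ i → f≤g (Inverse.from size i))

    ∑-cong : {f g : S.Carrier → ℕ} → (∀ x → f x ≡ g x) → ∑ f ≡ ∑ g
    ∑-cong f≡g = Σℕ.sum-cong-≗ (λ i → f≡g (Inverse.from size i))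

    ∑-const : ∀ x → ∑ (λ _ → x) ≡ n * x
    ∑-const x = sum-const n x

    ∑-+ : ∀ f g → ∑ (λ x → f x + g x) ≡ ∑ f + ∑ g
    ∑-+ f g = Σℕ.∑-distrib-+ (f ∘ Inverse.from size) (g ∘ Inverse.from size)

    ∑-*ˡ : ∀ c f → ∑ (λ x → c * f x) ≡ c * ∑ f
    ∑-*ˡ c f = ≡.sym (Σℕ.*-distribˡ-sum c (f ∘ Inverse.from size))

    ∑-*ʳ : ∀ c f → ∑ (λ x → f x * c) ≡ ∑ f * c
    ∑-*ʳ c f = ≡.sym (Σℕ.*-distribʳ-sum c (f ∘ Inverse.from size))

  ∑-bound : ∀ {c} {f : S.Carrier → ℕ} → (∀ x → f x ≤ c) → ∑ f ≤ n * c
  ∑-bound {c} f≤c = ℕ.≤-trans (∑-mono f≤c) (ℕ.≤-reflexive (∑-const c))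

  count-mono : {P : Pred S.Carrier p} {Q : Pred S.Carrier r} (P? : Decidable P) (Q? : Decidable Q) →
               (∀ x → P x → Q x) → count P? ≤ count Q?
  count-mono P? Q? P⊆Q = ∑-mono (λ x → ind-mono (P? x) (Q? x) (P⊆Q x))

  count-split : {P : Pred S.Carrier p} {Q : Pred S.Carrier r} {R : Pred S.Carrier b}
                (P? : Decidable P) (Q? : Decidable Q) (R? : Decidable R) →
                (∀ x → P x → ¬ Q x → R x) → count P? ≤ count Q? + count R?
  count-split P? Q? R? split = ℕ.≤-trans (∑-mono pointwise) (ℕ.≤-reflexive (∑-+ _ _))
    where
    pointwise : ∀ x → ind (P? x) ≤ ind (Q? x) + ind (R? x)
    pointwise x with Q? x
    ... | yes _ = ℕ.≤-trans (ind-mono (P? x) (yes tt) (λ _ → tt)) (ℕ.m≤m+n 1 _)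
    ... | no ¬q = ind-mono (P? x) (R? x) (λ p → split x p ¬q)

  count-disjoint : {P : Pred S.Carrier p} {Q : Pred S.Carrier r} (P? : Decidable P) (Q? : Decidable Q) →
                   (∀ x → P x → ¬ Q x) → count P? + count Q? ≤ n
  count-disjoint P? Q? disjoint = ℕ.≤-trans (ℕ.≤-reflexive (≡.sym (∑-+ _ _)))
    (ℕ.≤-trans (∑-bound pointwise) (ℕ.≤-reflexive (ℕ.*-identityʳ n)))
    where
    pointwise : ∀ x → ind (P? x) + ind (Q? x) ≤ 1
    pointwise x with P? x
    ... | yes Px = ℕ.≤-reflexive (≡.cong suc (ind-no (Q? x) (disjoint x Px)))
    ... | no  _  = ind-mono (Q? x) (yes tt) (λ _ → tt)

  count-none : {P : Pred S.Carrier p} (P? : Decidable P) → (∀ x → ¬ P x) → count P? ≡ 0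
  count-none P? none = ≡.trans (∑-cong (λ x → ind-no (P? x) (none x))) (≡.trans (∑-const 0) (ℕ.*-zeroʳ n))

  count≤size : {P : Pred S.Carrier p} (P? : Decidable P) → count P? ≤ n
  count≤size P? = ℕ.≤-trans (∑-bound (λ x → ind-mono (P? x) (yes tt) (λ _ → tt))) (ℕ.≤-reflexive (ℕ.*-identityʳ n))

  opaque
    unfolding ∑

    count≢0⇒∃ : {P : Pred S.Carrier p} (P? : Decidable P) → count P? ≢ 0 → ∃ P
    count≢0⇒∃ P? ≢0 with Fin.any? (P? ∘ Inverse.from size)
    ... | yes (i , Pi) = Inverse.from size i , Pi
    ... | no none      = contradiction (≡.trans
      (Σℕ.sum-cong-≗ (λ i → ind-no (P? (Inverse.from size i)) (λ Pi → none (i , Pi))))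
      (≡.trans (sum-const n 0) (ℕ.*-zeroʳ n))) ≢0

  -- Cauchy–Schwarz against the indicator of the support of f, by summing
  -- 2 f x f y ≤ ind y (f x)² + ind x (f y)² over all pairs.
  ∑²≤support*∑² : {P : Pred S.Carrier p} (P? : Decidable P) (f : S.Carrier → ℕ) →
                  (∀ x → ¬ P x → f x ≡ 0) → ∑ f * ∑ f ≤ count P? * ∑ (λ x → f x * f x)
  ∑²≤support*∑² {P = P} P? f f≡0 = ℕ.*-cancelˡ-≤ 2 (begin
    2 * (∑ f * ∑ f)                            ≡⟨ ≡.cong (2 *_) (≡.sym (∑-*ʳ (∑ f) f)) ⟩
    2 * ∑ (λ x → f x * ∑ f)                    ≡⟨ ≡.cong (2 *_) (∑-cong (λ x → ≡.sym (∑-*ˡ (f x) f))) ⟩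
    2 * ∑ (λ x → ∑ (λ y → f x * f y))          ≡⟨ ≡.sym (∑-*ˡ 2 _) ⟩
    ∑ (λ x → 2 * ∑ (λ y → f x * f y))          ≡⟨ ∑-cong (λ x → ≡.sym (∑-*ˡ 2 _)) ⟩
    ∑ (λ x → ∑ (λ y → 2 * (f x * f y)))        ≤⟨ ∑-mono (λ x → ∑-mono (λ y → pair x y)) ⟩
    ∑ (λ x → ∑ (λ y → ind (P? y) * (f x * f x) + ind (P? x) * (f y * f y)))
      ≡⟨ ∑-cong (λ x → ≡.trans (∑-+ _ _) (≡.cong₂ _+_ (∑-*ʳ (f x * f x) _) (∑-*ˡ (ind (P? x)) _))) ⟩
    ∑ (λ x → count P? * (f x * f x) + ind (P? x) * Q) ≡⟨ ∑-+ _ _ ⟩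
    ∑ (λ x → count P? * (f x * f x)) + ∑ (λ x → ind (P? x) * Q)
      ≡⟨ ≡.cong₂ _+_ (∑-*ˡ (count P?) _) (∑-*ʳ Q _) ⟩
    count P? * Q + count P? * Q                ≡⟨ ≡.cong (count P? * Q +_) (≡.sym (ℕ.+-identityʳ _)) ⟩
    2 * (count P? * Q)                         ∎)
    where
    open ℕ.≤-Reasoning
    Q = ∑ (λ x → f x * f x)
    square : ∀ x y → x ≤ y → 2 * (x * y) ≤ 1 * (x * x) + 1 * (y * y)
    square x y x≤y with k , ≡.refl ← ℕ.m≤n⇒∃[o]m+o≡n x≤y =
      ℕ.≤-trans (ℕ.m≤m+n _ (k * k)) (ℕ.≤-reflexive (identity x k))
      where
      identity : ∀ x k → 2 * (x * (x + k)) + k * k ≡ 1 * (x * x) + 1 * ((x + k) * (x + k))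
      identity = solve-∀
    2xy≤x²+y² : ∀ x y → 2 * (x * y) ≤ 1 * (x * x) + 1 * (y * y)
    2xy≤x²+y² x y with ℕ.≤-total x y
    ... | inj₁ x≤y = square x y x≤y
    ... | inj₂ y≤x = ≡.subst₂ _≤_ (≡.cong (2 *_) (ℕ.*-comm y x)) (ℕ.+-comm (1 * (y * y)) _) (square y x y≤x)
    pair : ∀ x y → 2 * (f x * f y) ≤ ind (P? y) * (f x * f x) + ind (P? x) * (f y * f y)
    pair x y with P? x | P? y
    ... | yes _  | yes _  = 2xy≤x²+y² (f x) (f y)
    ... | no ¬p  | _      rewrite f≡0 x ¬p = z≤n
    ... | yes _  | no ¬p  rewrite f≡0 y ¬p | ℕ.*-zeroʳ (f x) = z≤n

module _ {S : Setoid a ℓ} {T : Setoid b ℓ′} {n m : ℕ} (sizeS : HasSize S n) (sizeT : HasSize T m) where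
  private
    module S = Setoid S
    module T = Setoid T
    module SF = Inverse sizeS
    module TF = Inverse sizeT

  opaque
    unfolding ∑

    ∑-swap : ∀ (f : S.Carrier → T.Carrier → ℕ) →
             ∑ sizeS (λ x → ∑ sizeT (f x)) ≡ ∑ sizeT (λ y → ∑ sizeS (λ x → f x y))
    ∑-swap f = Σℕ.∑-comm (λ i j → f (SF.from i) (TF.from j))

    -- Only representatives are counted, and `h` may land on other elements of their classes, hence
    -- the condition on `Q`. Since `h` takes the proof of `P x`, it can record choices made from a
    -- witness, such as coordinates or a pivot row.
    count-injection :
      {P : Pred S.Carrier p} {Q : Pred T.Carrier r} (P? : Decidable P) (Q? : Decidable Q) → Q Respects T._≈_ →
      (h : ∀ x → P x → T.Carrier) → (∀ x p → Q (h x p)) →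
      (∀ x y p p′ → h x p T.≈ h y p′ → x S.≈ y) → count sizeS P? ≤ count sizeT Q?
    count-injection {P = P} {Q} P? Q? resp h Qh h-inj = fin-count-injection (P? ∘ SF.from) (Q? ∘ TF.from)
      (λ i p → TF.to (h (SF.from i) p))
      (λ i p → resp (T.sym (from∘to sizeT _)) (Qh (SF.from i) p))
      (λ i j p p′ eq → from-injective (h-inj _ _ p p′
        (T.trans (T.sym (from∘to sizeT _)) (T.trans (TF.from-cong eq) (from∘to sizeT _)))))
      where
      from-injective : ∀ {i j} → SF.from i S.≈ SF.from j → i ≡ j
      from-injective {i} {j} eq =
        ≡.trans (≡.sym (SF.strictlyInverseˡ i)) (≡.trans (SF.to-cong eq) (SF.strictlyInverseˡ j))

  count-injection-size :
    {P : Pred S.Carrier p} (P? : Decidable P) (h : ∀ x → P x → T.Carrier) →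
    (∀ x y p p′ → h x p T.≈ h y p′ → x S.≈ y) → count sizeS P? ≤ m
  count-injection-size P? h h-inj = ℕ.≤-trans
    (count-injection {Q = λ _ → ⊤} P? (λ _ → yes tt) _ h _ h-inj)
    (ℕ.≤-reflexive (≡.trans (∑-const sizeT 1) (ℕ.*-identityʳ m)))

  size-injection :
    (h : S.Carrier → T.Carrier) → (∀ x y → h x T.≈ h y → x S.≈ y) → n ≤ m
  size-injection h h-inj = ℕ.≤-trans
    (ℕ.≤-reflexive (≡.sym (≡.trans (∑-const sizeS 1) (ℕ.*-identityʳ n))))
    (count-injection-size {P = λ _ → ⊤} (λ _ → yes tt) (λ x _ → h x) (λ x y _ _ → h-inj x y))

  infixr 4 _×ₛ_

  opaque
    _×ₛ_ : HasSize (×-setoid S T) (n * m)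
    _×ₛ_ = record
      { to        = λ (x , y) → combine (SF.to x) (TF.to y)
      ; from      = λ i → let j , k = remQuot {n} m i in SF.from j , TF.from k
      ; to-cong   = λ (x≈ , y≈) → ≡.cong₂ combine (SF.to-cong x≈) (TF.to-cong y≈)
      ; from-cong = λ { ≡.refl → S.refl , T.refl }
      ; inverse   =
          (λ {i} (x≈ , y≈) → ≡.trans
            (≡.cong₂ combine (SF.inverseˡ x≈) (TF.inverseˡ y≈)) (combine-remQuot {n} m i))
        , (λ {(x , y)} i≡ → ≡.subst (λ jk → SF.from (proj₁ jk) S.≈ x × TF.from (proj₂ jk) T.≈ y)
            (≡.sym (≡.trans (≡.cong (remQuot {n} m) i≡) (remQuot-combine {n} {m} (SF.to x) (TF.to y))))
            (from∘to sizeS x , from∘to sizeT y))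
      }

  opaque
    unfolding ∑ _×ₛ_

    ∑-× : ∀ f → ∑ _×ₛ_ f ≡ ∑ sizeS (λ x → ∑ sizeT (λ y → f (x , y)))
    ∑-× f = ≡.trans (sum-combine n _)
      (Σℕ.sum-cong-≗ (λ i → Σℕ.sum-cong-≗ (λ j →
        ≡.cong (λ jk → f (SF.from (proj₁ jk) , TF.from (proj₂ jk))) (remQuot-combine {n} {m} i j))))

-- Linear algebra over a finite field

module LinearCombinations {q} (𝔽 : FiniteField q c ℓ) (V : VectorSpace 𝔽 r ℓr) where
  private
    module 𝔽 = FiniteField 𝔽
    module V = Module V
    module ΣV = Sum V.+ᴹ-commutativeMonoid
    open GroupProperties V.+ᴹ-group using (∙-cancelʳ; x∙y⁻¹≈ε⇒x≈y)
    open SetoidReasoning V.≈ᴹ-setoid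

  _≋_ : ∀ {k} → Vector V.Carrierᴹ k → Vector V.Carrierᴹ k → Set ℓr
  b ≋ b′ = ∀ i → b i V.≈ᴹ b′ i

  _≋𝔽_ : ∀ {k} → Vector 𝔽.Carrier k → Vector 𝔽.Carrier k → Set ℓ
  s ≋𝔽 s′ = ∀ i → s i 𝔽.≈ s′ i

  lc : ∀ {k} → Vector 𝔽.Carrier k → Vector V.Carrierᴹ k → V.Carrierᴹ
  lc = linearCombination V

  lc-cong : ∀ {k} {s s′ : Vector 𝔽.Carrier k} {b b′ : Vector V.Carrierᴹ k} →
            s ≋𝔽 s′ → b ≋ b′ → lc s b V.≈ᴹ lc s′ b′
  lc-cong s≋ b≋ = ΣV.sum-cong-≋ (λ i → V.*ₗ-cong (s≋ i) (b≋ i))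

  lc-congˡ : ∀ {k} {s s′ : Vector 𝔽.Carrier k} {b} → s ≋𝔽 s′ → lc s b V.≈ᴹ lc s′ b
  lc-congˡ s≋ = lc-cong s≋ (λ _ → V.≈ᴹ-refl)

  lc-congʳ : ∀ {k} {s : Vector 𝔽.Carrier k} {b b′} → b ≋ b′ → lc s b V.≈ᴹ lc s b′
  lc-congʳ b≋ = lc-cong (λ _ → 𝔽.refl) b≋

  lc-+ : ∀ {k} (s s′ : Vector 𝔽.Carrier k) b → lc (λ i → s i 𝔽.+ s′ i) b V.≈ᴹ lc s b V.+ᴹ lc s′ b
  lc-+ s s′ b = V.≈ᴹ-trans (ΣV.sum-cong-≋ (λ i → V.*ₗ-distribʳ (b i) (s i) (s′ i)))
                           (ΣV.∑-distrib-+ (λ i → s i V.*ₗ b i) (λ i → s′ i V.*ₗ b i))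

  lc-0 : ∀ {k} (b : Vector V.Carrierᴹ k) → lc (λ _ → 𝔽.0#) b V.≈ᴹ V.0ᴹ
  lc-0 {k} b = V.≈ᴹ-trans (ΣV.sum-cong-≋ (λ i → V.*ₗ-zeroˡ (b i))) (ΣV.sum-replicate-zero k)

  lc-* : ∀ {k} a (s : Vector 𝔽.Carrier k) b → lc (λ i → a 𝔽.* s i) b V.≈ᴹ a V.*ₗ lc s b
  lc-* {zero}  a s b = V.≈ᴹ-sym (V.*ₗ-zeroʳ a)
  lc-* {suc k} a s b = V.≈ᴹ-trans
    (V.+ᴹ-cong (V.*ₗ-assoc a (s zero) (b zero)) (lc-* a (s ∘ suc) (b ∘ suc)))
    (V.≈ᴹ-sym (V.*ₗ-distribˡ a _ _))

  lc-neg : ∀ {k} (s : Vector 𝔽.Carrier k) b → lc (λ i → 𝔽.- s i) b V.+ᴹ lc s b V.≈ᴹ V.0ᴹ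
  lc-neg s b = V.≈ᴹ-trans (V.≈ᴹ-sym (lc-+ _ s b))
    (V.≈ᴹ-trans (lc-congˡ (λ i → 𝔽.-‿inverseˡ (s i))) (lc-0 b))

  lc-++ : ∀ {j k} (s : Vector 𝔽.Carrier (j + k)) (b : Vector V.Carrierᴹ j) (b′ : Vector V.Carrierᴹ k) →
          lc s (b ++ b′) V.≈ᴹ lc (λ i → s (i ↑ˡ k)) b V.+ᴹ lc (λ i → s (j ↑ʳ i)) b′
  lc-++ {zero}  s b b′ = V.≈ᴹ-sym (V.+ᴹ-identityˡ _)
  lc-++ {suc j} s b b′ = V.≈ᴹ-trans
    (V.+ᴹ-congˡ (V.≈ᴹ-trans (lc-congʳ tail-++) (lc-++ (s ∘ suc) (b ∘ suc) b′)))
    (V.≈ᴹ-sym (V.+ᴹ-assoc _ _ _))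
    where
    tail-++ : ∀ i → (b ++ b′) (suc i) V.≈ᴹ ((b ∘ suc) ++ b′) i
    tail-++ i with splitAt j i
    ... | inj₁ _ = V.≈ᴹ-refl
    ... | inj₂ _ = V.≈ᴹ-refl

  -- Matrices are tuples of rows, and the product of a row with a matrix is a linear combination in
  -- `coordinateSpace`. In these terms this is associativity, `s (M b) = (s M) b`.
  lc-compose : ∀ {j k} (s : Vector 𝔽.Carrier j) (M : Vector (Vector 𝔽.Carrier k) j) b →
               lc s (λ i → lc (M i) b) V.≈ᴹ lc (linearCombination (coordinateSpace 𝔽 k) s M) b
  lc-compose {zero}  s M b = V.≈ᴹ-sym (lc-0 b)
  lc-compose {suc j} s M b = V.≈ᴹ-sym (V.≈ᴹ-trans (lc-+ _ _ b)
    (V.+ᴹ-cong (lc-* (s zero) (M zero) b) (V.≈ᴹ-sym (lc-compose (s ∘ suc) (M ∘ suc) b))))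

  lc-∈ : ∀ (U : Subspace V) {k} (s : Vector 𝔽.Carrier k) {b} → (∀ i → Subspace.Member U (b i)) →
         Subspace.Member U (lc s b)
  lc-∈ U {zero}  s b∈ = Subspace.0ᴹ∈ U
  lc-∈ U {suc k} s b∈ = Subspace.+ᴹ∈ U (Subspace.*ₗ∈ U (s zero) (b∈ zero)) (lc-∈ U (s ∘ suc) (b∈ ∘ suc))

  basisVector : ∀ {k} → Fin k → Vector 𝔽.Carrier k
  basisVector zero    = 𝔽.1# ∷ (λ _ → 𝔽.0#)
  basisVector (suc i) = 𝔽.0# ∷ basisVector i

  lc-basisVector : ∀ {k} (i : Fin k) b → lc (basisVector i) b V.≈ᴹ b i
  lc-basisVector zero    b = V.≈ᴹ-trans (V.+ᴹ-cong (V.*ₗ-identityˡ _) (lc-0 (b ∘ suc))) (V.+ᴹ-identityʳ _)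
  lc-basisVector (suc i) b = V.≈ᴹ-trans (V.+ᴹ-cong (V.*ₗ-zeroˡ _) (lc-basisVector i (b ∘ suc))) (V.+ᴹ-identityˡ _)

  LI : ∀ {k} → Vector V.Carrierᴹ k → Set (c ⊔ ℓ ⊔ ℓr)
  LI = LinearlyIndependent V

  LI-resp : ∀ {k} {b b′ : Vector V.Carrierᴹ k} → b ≋ b′ → LI b → LI b′
  LI-resp b≋ li s eq = li s (V.≈ᴹ-trans (lc-congʳ b≋) eq)

  lc-injective : ∀ {k} {b : Vector V.Carrierᴹ k} → LI b → ∀ s s′ → lc s b V.≈ᴹ lc s′ b → s ≋𝔽 s′
  lc-injective {b = b} li s s′ eq i = x∙y⁻¹≈ε⇒x≈y′ (s i) (s′ i) (li (λ j → s j 𝔽.+ 𝔽.- s′ j)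
    (V.≈ᴹ-trans (lc-+ s _ b) (V.≈ᴹ-trans (V.+ᴹ-congʳ eq) (V.≈ᴹ-trans (V.+ᴹ-comm _ _) (lc-neg s′ b)))) i)
    where open GroupProperties 𝔽.+-group using () renaming (x∙y⁻¹≈ε⇒x≈y to x∙y⁻¹≈ε⇒x≈y′)

  ∈span : ∀ {k} → Vector V.Carrierᴹ k → V.Carrierᴹ → Set (c ⊔ ℓr)
  ∈span b x = ∃ λ s → x V.≈ᴹ lc s b

  LI-∷ : ∀ {k} {b : Vector V.Carrierᴹ k} {v} → LI b → ¬ ∈span b v → LI (v ∷ b)
  LI-∷ {k} {b} {v} li v∉ s eq = λ { zero → s₀≈0 ; (suc i) → li (s ∘ suc) tail≈0 i }
    where
    s₀≈0 : s zero 𝔽.≈ 𝔽.0#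
    s₀≈0 = decidable-stable (finite-≈? {S = 𝔽.setoid} 𝔽.size _ _) λ s₀≉0 →
      let y , s₀y≈1 = 𝔽.invertible (s zero) s₀≉0 in v∉ (_ , (begin
        v                                                ≈⟨ V.*ₗ-identityˡ v ⟨
        𝔽.1# V.*ₗ v                                      ≈⟨ V.*ₗ-cong (𝔽.trans (𝔽.*-comm y _) s₀y≈1) V.≈ᴹ-refl ⟨
        (y 𝔽.* s zero) V.*ₗ v                            ≈⟨ V.*ₗ-assoc y _ v ⟩
        y V.*ₗ s zero V.*ₗ v
          ≈⟨ V.*ₗ-cong 𝔽.refl (∙-cancelʳ _ _ _ (V.≈ᴹ-trans eq (V.≈ᴹ-sym (lc-neg (s ∘ suc) b)))) ⟩
        y V.*ₗ lc (λ i → 𝔽.- s (suc i)) b                ≈⟨ lc-* y _ b ⟨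
        lc (λ i → y 𝔽.* 𝔽.- s (suc i)) b                 ∎))
    tail≈0 : lc (s ∘ suc) b V.≈ᴹ V.0ᴹ
    tail≈0 = begin
      lc (s ∘ suc) b                       ≈⟨ V.+ᴹ-identityˡ _ ⟨
      V.0ᴹ V.+ᴹ lc (s ∘ suc) b             ≈⟨ V.+ᴹ-congʳ (V.*ₗ-zeroˡ v) ⟨
      𝔽.0# V.*ₗ v V.+ᴹ lc (s ∘ suc) b      ≈⟨ V.+ᴹ-congʳ (V.*ₗ-cong s₀≈0 V.≈ᴹ-refl) ⟨
      s zero V.*ₗ v V.+ᴹ lc (s ∘ suc) b    ≈⟨ eq ⟩
      V.0ᴹ                                 ∎

  LI-combination : ∀ {j k} {M : Vector (Vector 𝔽.Carrier k) j} {b} → LI b →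
                   LinearlyIndependent (coordinateSpace 𝔽 k) M → LI (λ i → lc (M i) b)
  LI-combination {M = M} {b} li liM s eq = liM s
    (li _ (V.≈ᴹ-trans (V.≈ᴹ-sym (lc-compose s M b)) eq))

  LI-coefficients : ∀ {j k} {M : Vector (Vector 𝔽.Carrier k) j} {b} →
                    LI (λ i → lc (M i) b) → LinearlyIndependent (coordinateSpace 𝔽 k) M
  LI-coefficients {M = M} {b} li s eq = li s
    (V.≈ᴹ-trans (lc-compose s M b) (V.≈ᴹ-trans (lc-congˡ eq) (lc-0 b)))

module _ {q} (𝔽 : FiniteField q c ℓ) where
  private module 𝔽 = FiniteField 𝔽

  opaque
    scalars-size : ∀ k → HasSize (vectorSetoid 𝔽.setoid k) (q ^ k)
    scalars-size = vector-size {S = 𝔽.setoid} 𝔽.size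

  1<q : 1 < q
  1<q = size-injection (fin-size 2) 𝔽.size f f-inj
    where
    f : Fin 2 → 𝔽.Carrier
    f zero       = 𝔽.0#
    f (suc zero) = 𝔽.1#
    f-inj : ∀ x y → f x 𝔽.≈ f y → x ≡ y
    f-inj zero       zero       _ = ≡.refl
    f-inj zero       (suc zero) e = contradiction e 𝔽.0≉1
    f-inj (suc zero) zero       e = contradiction (𝔽.sym e) 𝔽.0≉1
    f-inj (suc zero) (suc zero) _ = ≡.refl

  q-nonZero : NonZero q
  q-nonZero = >-nonZero (ℕ.<-trans (s≤s z≤n) 1<q)

  q^-mono-≤ : ∀ {j k} → j ≤ k → q ^ j ≤ q ^ k
  q^-mono-≤ = ℕ.^-monoʳ-≤ q {{q-nonZero}}

  q^-cancel-≤ : ∀ {j k} → q ^ j ≤ q ^ k → j ≤ k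
  q^-cancel-≤ {j} {k} q^j≤q^k = ℕ.≮⇒≥ λ k<j →
    ℕ.<⇒≱ (ℕ.^-monoʳ-< q 1<q k<j) q^j≤q^k

  module _ (V : VectorSpace 𝔽 r ℓr) where
    private module V = Module V
    open LinearCombinations 𝔽 V

    -- Finiteness replaces the exchange lemma: rewriting the combinations of `b` over `b′` injects
    -- `q ^ j` coefficient vectors into `q ^ k`.
    independent≤spanning : ∀ {j k} {b : Vector V.Carrierᴹ j} {b′ : Vector V.Carrierᴹ k} → LI b →
                           (∀ i → ∈span b′ (b i)) → j ≤ k
    independent≤spanning {j} {k} {b} {b′} li b∈ = q^-cancel-≤
      (size-injection (scalars-size j) (scalars-size k)
        (λ s → linearCombination (coordinateSpace 𝔽 k) s (proj₁ ∘ b∈))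
        (λ s s′ eq → lc-injective li s s′ (V.≈ᴹ-trans (coordinates s)
          (V.≈ᴹ-trans (lc-congˡ eq) (V.≈ᴹ-sym (coordinates s′))))))
      where
      coordinates : ∀ s → lc s b V.≈ᴹ lc (linearCombination (coordinateSpace 𝔽 k) s (proj₁ ∘ b∈)) b′
      coordinates s = V.≈ᴹ-trans (lc-congʳ (proj₂ ∘ b∈)) (lc-compose s (proj₁ ∘ b∈) b′)

module FiniteDimensional {q N} (𝔽 : FiniteField q c ℓ) (V : VectorSpace 𝔽 r ℓr) (dimV : Dimension V N) where
  private
    module 𝔽 = FiniteField 𝔽
    module V = Module V
  open LinearCombinations 𝔽 V public

  opaque
    sizeV : HasSize V.≈ᴹ-setoid (q ^ N)
    sizeV = space-size V 𝔽.size dimV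

    tuples : ∀ k → HasSize (vectorSetoid V.≈ᴹ-setoid k) ((q ^ N) ^ k)
    tuples = vector-size {S = V.≈ᴹ-setoid} sizeV

  _≈V?_ : B.Decidable V._≈ᴹ_
  _≈V?_ = finite-≈? {S = V.≈ᴹ-setoid} sizeV

  opaque
    ∈span? : ∀ {k} (b : Vector V.Carrierᴹ k) → Decidable (∈span b)
    ∈span? {k} b x = finite-any? {S = vectorSetoid 𝔽.setoid k} (scalars-size 𝔽 k)
      (λ s≋ eq → V.≈ᴹ-trans eq (lc-congˡ s≋)) (λ s → x ≈V? lc s b)

    LI? : ∀ {k} → Decidable (LI {k})
    LI? {k} b = finite-all? {S = vectorSetoid 𝔽.setoid k} (scalars-size 𝔽 k)
      (λ s≋ f eq i → 𝔽.trans (𝔽.sym (s≋ i)) (f (V.≈ᴹ-trans (lc-congˡ s≋) eq) i))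
      (λ s → (lc s b ≈V? V.0ᴹ) →-dec all? (λ i → finite-≈? {S = 𝔽.setoid} 𝔽.size (s i) 𝔽.0#))

  ∈span-resp : ∀ {k} {b b′ : Vector V.Carrierᴹ k} {x y} → b ≋ b′ → x V.≈ᴹ y → ∈span b x → ∈span b′ y
  ∈span-resp b≋ x≈y (s , eq) = s , V.≈ᴹ-trans (V.≈ᴹ-sym x≈y) (V.≈ᴹ-trans eq (lc-congʳ b≋))

  span : ∀ {k} → Vector V.Carrierᴹ k → Subspace V
  span b = record
    { Member  = λ x → True (∈span? b x)
    ; member? = λ x → T? _
    ; resp    = λ {x} {y} x≈y x∈ → fromWitness {a? = ∈span? b y} (∈span-resp (λ _ → V.≈ᴹ-refl) x≈y (toWitness x∈))
    ; 0ᴹ∈     = fromWitness {a? = ∈span? b _} (_ , V.≈ᴹ-sym (lc-0 b))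
    ; +ᴹ∈     = λ x∈ y∈ → let s , x≈ = toWitness x∈ ; s′ , y≈ = toWitness y∈ in
        fromWitness {a? = ∈span? b _} (_ , V.≈ᴹ-trans (V.+ᴹ-cong x≈ y≈) (V.≈ᴹ-sym (lc-+ s s′ b)))
    ; *ₗ∈     = λ a x∈ → let s , x≈ = toWitness x∈ in
        fromWitness {a? = ∈span? b _} (_ , V.≈ᴹ-trans (V.*ₗ-cong 𝔽.refl x≈) (V.≈ᴹ-sym (lc-* a s b)))
    }

  ∈span⇒∈ : ∀ {k} {b : Vector V.Carrierᴹ k} {x} → ∈span b x → Subspace.Member (span b) x
  ∈span⇒∈ {b = b} {x} = fromWitness {a? = ∈span? b x}

  ∈⇒∈span : ∀ {k} {b : Vector V.Carrierᴹ k} {x} → Subspace.Member (span b) x → ∈span b x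
  ∈⇒∈span = toWitness

  ∈span-self : ∀ {k} (b : Vector V.Carrierᴹ k) i → ∈span b (b i)
  ∈span-self b i = basisVector i , V.≈ᴹ-sym (lc-basisVector i b)

  LI⇒basis : ∀ {k} {b : Vector V.Carrierᴹ k} → LI b → IsBasis V (span b) b
  LI⇒basis {b = b} li = record
    { members     = λ i → ∈span⇒∈ (∈span-self b i)
    ; independent = li
    ; spanning    = λ x → ∈⇒∈span
    }

  LI⇒≤dim : ∀ {k} {b : Vector V.Carrierᴹ k} → LI b → k ≤ N
  LI⇒≤dim {b = b} li = independent≤spanning 𝔽 V li (λ i → IsBasis.spanning (proj₂ dimV) (b i) tt)

  -- b is prepended to, so "b′ extends b" reads b′ (j′ ↑ʳ i) ≡ b i.
  extend : ∀ (U : Subspace V) {j} (b : Vector V.Carrierᴹ j) → LI b → (∀ i → Subspace.Member U (b i)) → ∀ f →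
    (∃ λ j′ → ∃ λ (b′ : Vector V.Carrierᴹ (j′ + j)) → j′ < f × IsBasis V U b′ × (∀ i → b′ (j′ ↑ʳ i) ≡ b i))
    ⊎ (∃ λ (b′ : Vector V.Carrierᴹ (f + j)) → LI b′ × (∀ i → Subspace.Member U (b′ i)) × (∀ i → b′ (f ↑ʳ i) ≡ b i))
  extend U b li b∈ zero = inj₂ (b , li , b∈ , λ _ → ≡.refl)
  extend U b li b∈ (suc f) with extend U b li b∈ f
  ... | inj₁ (j′ , b′ , j′<f , rest) = inj₁ (j′ , b′ , ℕ.m<n⇒m<1+n j′<f , rest)
  ... | inj₂ (b′ , li′ , b′∈ , ext) with finite-any? {S = V.≈ᴹ-setoid} sizeV
      {P = λ x → Subspace.Member U x × ¬ ∈span b′ x}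
      (λ x≈y (x∈ , x∉) → Subspace.resp U x≈y x∈ , λ y∈ → x∉ (∈span-resp (λ _ → V.≈ᴹ-refl) (V.≈ᴹ-sym x≈y) y∈))
      (λ x → Subspace.member? U x ×-dec ¬? (∈span? b′ x))
  ... | yes (v , v∈ , v∉) = inj₂ (v ∷ b′ , LI-∷ li′ v∉ , (λ { zero → v∈ ; (suc i) → b′∈ i }) , ext)
  ... | no none = inj₁ (f , b′ , ℕ.≤-refl , record
    { members     = b′∈
    ; independent = li′
    ; spanning    = λ x x∈ → decidable-stable (∈span? b′ x) (λ x∉ → none (x , x∈ , x∉)) } , ext)

  -- With bound 1, `extend` either adds no vector, so that `b` is already a basis, or produces
  -- `suc N` independent vectors, more than the dimension allows.
  LI⇒spanning : {b : Vector V.Carrierᴹ N} → LI b → ∀ x → ∈span b x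
  LI⇒spanning {b} li x with extend (wholeSpace V) b li (λ _ → tt) 1
  ... | inj₁ (zero , b′ , _ , basis , ext) =
    ∈span-resp (λ i → V.≈ᴹ-reflexive (ext i)) V.≈ᴹ-refl (IsBasis.spanning basis x tt)
  ... | inj₁ (suc _ , _ , s≤s () , _)
  ... | inj₂ (b′ , li′ , _) = contradiction (LI⇒≤dim {b = b′} li′) ℕ.1+n≰n

-- Counting tuples of vectors

module Coordinates {q} (𝔽 : FiniteField q c ℓ) (k : ℕ) where
  open FiniteDimensional 𝔽 (coordinateSpace 𝔽 k) (coordinateSpace-dimension 𝔽 k) public

module _ {q} (𝔽 : FiniteField q c ℓ) (V : VectorSpace 𝔽 r ℓr) where
  private
    module 𝔽 = FiniteField 𝔽
    module V = Module V
  open LinearCombinations 𝔽 V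

  -- If the rows of Y are independent then ψ ↦ Y ψ is onto with fibres of
  -- size at most |V| ^ (s ∸ t): some j ≤ s ∸ t further combinations R ψ
  -- pin ψ down.
  complementaryCombinations :
    ∀ {s t} (Y : Vector (Vector 𝔽.Carrier s) t) → LinearlyIndependent (coordinateSpace 𝔽 s) Y →
    ∃ λ j → j + t ≤ s × ∃ λ (R : Vector (Vector 𝔽.Carrier s) j) → ∀ ψ ψ′ →
      (∀ i → lc (R i) ψ V.≈ᴹ lc (R i) ψ′) → (∀ l → lc (Y l) ψ V.≈ᴹ lc (Y l) ψ′) → ψ ≋ ψ′
  complementaryCombinations {s} {t} Y liY
    -- The bound `suc s` exceeds the dimension of the coordinate space, so the alternative without a
    -- basis is impossible.
    with Coordinates.extend 𝔽 s (wholeSpace _) Y liY (λ _ → tt) (suc s)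
  ... | inj₂ (b , li , _) = contradiction (ℕ.≤-trans (ℕ.m≤m+n (suc s) t) (Coordinates.LI⇒≤dim 𝔽 s {b = b} li)) ℕ.1+n≰n
  ... | inj₁ (j , b , _ , basis , ext) =
      j , Coordinates.LI⇒≤dim 𝔽 s {b = b} (IsBasis.independent basis) , (λ i → b (i ↑ˡ t)) , determined
    where
    open SetoidReasoning V.≈ᴹ-setoid
    determined : ∀ ψ ψ′ → (∀ i → lc (b (i ↑ˡ t)) ψ V.≈ᴹ lc (b (i ↑ˡ t)) ψ′) →
                 (∀ l → lc (Y l) ψ V.≈ᴹ lc (Y l) ψ′) → ψ ≋ ψ′
    determined ψ ψ′ agreeR agreeY i = begin
      ψ i                                    ≈⟨ lc-basisVector i ψ ⟨
      lc (basisVector i) ψ                   ≈⟨ lc-congˡ eᵢ≈ ⟩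
      lc (linearCombination (coordinateSpace 𝔽 s) sᵢ b) ψ        ≈⟨ lc-compose sᵢ b ψ ⟨
      lc sᵢ (λ j → lc (b j) ψ)               ≈⟨ lc-congʳ agree ⟩
      lc sᵢ (λ j → lc (b j) ψ′)              ≈⟨ lc-compose sᵢ b ψ′ ⟩
      lc (linearCombination (coordinateSpace 𝔽 s) sᵢ b) ψ′       ≈⟨ lc-congˡ eᵢ≈ ⟨
      lc (basisVector i) ψ′                  ≈⟨ lc-basisVector i ψ′ ⟩
      ψ′ i                                   ∎
      where
      sᵢ = proj₁ (IsBasis.spanning basis (basisVector i) tt)
      eᵢ≈ = proj₂ (IsBasis.spanning basis (basisVector i) tt)
      agree : ∀ j′ → lc (b j′) ψ V.≈ᴹ lc (b j′) ψ′
      agree j′ with splitAt j j′ | Fin.join-splitAt j t j′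
      ... | inj₁ i | ≡.refl = agreeR i
      ... | inj₂ l | ≡.refl rewrite ext l = agreeY l

module _ {q N} (𝔽 : FiniteField q c ℓ) (V : VectorSpace 𝔽 r ℓr) (dimV : Dimension V N) where
  private
    module 𝔽 = FiniteField 𝔽
    module V = Module V
  open FiniteDimensional 𝔽 V dimV

  count-span≤ : ∀ {k} (b : Vector V.Carrierᴹ k) → count sizeV (∈span? b) ≤ q ^ k
  count-span≤ {k} b = count-injection-size sizeV (scalars-size 𝔽 k) (∈span? b) (λ _ → proj₁)
    (λ x y (s , x≈) (s′ , y≈) s≋ → V.≈ᴹ-trans x≈ (V.≈ᴹ-trans (lc-congˡ s≋) (V.≈ᴹ-sym y≈)))

  module _ (U : Subspace V) {m : ℕ} (dimU : HasDim V U m) where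
    private
      module U = Subspace U
      u = proj₁ dimU
      open IsBasis (proj₂ dimU)

    count-subspace≥ : q ^ m ≤ count sizeV U.member?
    count-subspace≥ = ℕ.≤-trans
      (ℕ.≤-reflexive (≡.sym (≡.trans (∑-const (scalars-size 𝔽 m) 1) (ℕ.*-identityʳ _))))
      (count-injection (scalars-size 𝔽 m) sizeV {P = λ _ → ⊤} (λ _ → yes tt) U.member? U.resp
        (λ s _ → lc s u) (λ s _ → lc-∈ U s members)
        (λ s s′ _ _ → lc-injective independent s s′))

    coordinates : ∀ {x} → U.Member x → Vector 𝔽.Carrier m
    coordinates {x} x∈ = proj₁ (spanning x x∈)

    coordinates-injective : ∀ {x y} (x∈ : U.Member x) (y∈ : U.Member y) →
                            coordinates x∈ ≋𝔽 coordinates y∈ → x V.≈ᴹ y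
    coordinates-injective {x} {y} x∈ y∈ eq = V.≈ᴹ-trans (proj₂ (spanning x x∈))
      (V.≈ᴹ-trans (lc-congˡ eq) (V.≈ᴹ-sym (proj₂ (spanning y y∈))))

  private
    -- Relative losses add up: `k / q` from before and `1 / q` for the new vector. The new loss
    -- comes measured against `I` and is wanted against `P`. If `I ≤ P` it only grows; if `P ≤ I`
    -- the earlier loss can be forgotten.
    independent-step-arithmetic : ∀ q′ k D P I I′ → suc q′ * P ≤ suc q′ * I + k * P →
      suc q′ * (D * I) ≤ suc q′ * I′ + D * I →
      suc q′ * (D * P) ≤ suc q′ * I′ + suc k * (D * P)
    independent-step-arithmetic q′ k D P I I′ hyp step with ℕ.≤-total P I
    ... | inj₁ P≤I = begin
      suc q′ * (D * P)                   ≡⟨ ℕ.+-comm (D * P) _ ⟩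
      q′ * (D * P) + D * P               ≤⟨ ℕ.+-mono-≤ (ℕ.*-monoʳ-≤ q′ (ℕ.*-monoʳ-≤ D P≤I)) (ℕ.m≤m+n (D * P) _) ⟩
      q′ * (D * I) + suc k * (D * P)     ≤⟨ ℕ.+-monoˡ-≤ _ (ℕ.+-cancelˡ-≤ (D * I) _ _ (ℕ.≤-trans step (ℕ.≤-reflexive (ℕ.+-comm _ (D * I))))) ⟩
      suc q′ * I′ + suc k * (D * P)      ∎
      where open ℕ.≤-Reasoning
    ... | inj₂ I≤P = begin
      suc q′ * (D * P)                   ≡⟨ e₁ q′ D P ⟩
      D * (suc q′ * P)                   ≤⟨ ℕ.*-monoʳ-≤ D hyp ⟩
      D * (suc q′ * I + k * P)           ≡⟨ e₂ q′ D I k P ⟩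
      suc q′ * (D * I) + k * (D * P)     ≤⟨ ℕ.+-monoˡ-≤ _ step ⟩
      suc q′ * I′ + D * I + k * (D * P)  ≤⟨ ℕ.+-monoˡ-≤ (k * (D * P)) (ℕ.+-monoʳ-≤ (suc q′ * I′) (ℕ.*-monoʳ-≤ D I≤P)) ⟩
      suc q′ * I′ + D * P + k * (D * P)  ≡⟨ ℕ.+-assoc (suc q′ * I′) _ _ ⟩
      suc q′ * I′ + suc k * (D * P)      ∎
      where
      open ℕ.≤-Reasoning
      e₁ : ∀ q′ D P → suc q′ * (D * P) ≡ D * (suc q′ * P)
      e₁ = solve-∀
      e₂ : ∀ q′ D I k P → D * (suc q′ * I + k * P) ≡ suc q′ * (D * I) + k * (D * P)
      e₂ = solve-∀

  -- A new head taken from `U` spoils independence only inside the span of the `k` vectors present.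
  -- That span has at most `q ^ k` elements, a proportion of at most `1 / q` of `U`, so each added
  -- vector raises the error `e` by one.
  count-independent-step :
    ∀ {k p} {R : Pred (Vector V.Carrierᴹ k) p} (R? : Decidable R) → R Respects _≋_ →
    (U : Subspace V) → q ^ suc k ≤ count sizeV (Subspace.member? U) → ∀ {P} e →
    q * P ≤ q * count (tuples k) (λ b → R? b ×-dec LI? b) + e * P →
    q * (count sizeV (Subspace.member? U) * P) ≤
      q * count (tuples (suc k)) (λ b → Subspace.member? U (b zero) ×-dec R? (b ∘ suc) ×-dec LI? b)
      + suc e * (count sizeV (Subspace.member? U) * P)
  count-independent-step {k} {R = R} R? R-resp U q^k<D {P} e hyp = conclude q hyp q^k<D
    where
    module U = Subspace U
    D = count sizeV U.member?
    I = count (tuples k) (λ b → R? b ×-dec LI? b)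
    target? = λ b → U.member? (b zero) ×-dec R? (b ∘ suc) ×-dec LI? b
    I′ = count (tuples (suc k)) target?
    pointwise : ∀ b → ind (R? b ×-dec LI? b) * D ≤
      count sizeV (λ v → (R? b ×-dec LI? b) ×-dec (U.member? v ×-dec ¬? (∈span? b v))) + ind (R? b ×-dec LI? b) * q ^ k
    pointwise b with R? b ×-dec LI? b
    ... | no _    = z≤n
    ... | yes RLI = ℕ.≤-trans (ℕ.≤-reflexive (ℕ.*-identityˡ D)) (ℕ.≤-trans
      (count-split sizeV U.member? (∈span? b) (λ v → yes RLI ×-dec (U.member? v ×-dec ¬? (∈span? b v)))
        (λ v v∈ v∉ → RLI , v∈ , v∉))
      (ℕ.≤-trans (ℕ.≤-reflexive (ℕ.+-comm (count sizeV (∈span? b)) _))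
        (ℕ.+-monoʳ-≤ _ (ℕ.≤-trans (count-span≤ b) (ℕ.≤-reflexive (≡.sym (ℕ.*-identityˡ _)))))))
    ID≤ : I * D ≤ I′ + I * q ^ k
    ID≤ = begin
      I * D ≡⟨ ∑-*ʳ (tuples k) D _ ⟨
      ∑ (tuples k) (λ b → ind (R? b ×-dec LI? b) * D) ≤⟨ ∑-mono (tuples k) pointwise ⟩
      ∑ (tuples k) (λ b → count sizeV (λ v → (R? b ×-dec LI? b) ×-dec (U.member? v ×-dec ¬? (∈span? b v))) + ind (R? b ×-dec LI? b) * q ^ k)
        ≡⟨ ∑-+ (tuples k) _ _ ⟩
      ∑ (tuples k) (λ b → count sizeV (λ v → (R? b ×-dec LI? b) ×-dec (U.member? v ×-dec ¬? (∈span? b v)))) + ∑ (tuples k) (λ b → ind (R? b ×-dec LI? b) * q ^ k)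
        ≡⟨ ≡.cong₂ _+_ (≡.sym (∑-× (tuples k) sizeV _)) (∑-*ʳ (tuples k) (q ^ k) _) ⟩
      count (tuples k ×ₛ sizeV) (λ (b , v) → (R? b ×-dec LI? b) ×-dec (U.member? v ×-dec ¬? (∈span? b v))) + I * q ^ k
        ≤⟨ ℕ.+-monoˡ-≤ _ (count-injection (tuples k ×ₛ sizeV) (tuples (suc k)) _ target?
             (λ b≋ (u , r , li) → U.resp (b≋ zero) u , R-resp (b≋ ∘ suc) r , LI-resp b≋ li)
             (λ (b , v) _ → v ∷ b)
             (λ (b , v) ((r , li) , v∈ , v∉) → v∈ , r , LI-∷ li v∉)
             (λ _ _ _ _ eq → eq ∘ suc , eq zero)) ⟩
      I′ + I * q ^ k ∎
      where open ℕ.≤-Reasoning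
    conclude : ∀ Q → Q * P ≤ Q * I + e * P → Q * q ^ k ≤ D → Q * (D * P) ≤ Q * I′ + suc e * (D * P)
    conclude zero     _   _    = z≤n
    conclude (suc q′) hyp qq≤D = independent-step-arithmetic q′ e D P I I′ hyp (begin
      suc q′ * (D * I)                      ≡⟨ ≡.cong (suc q′ *_) (ℕ.*-comm D I) ⟩
      suc q′ * (I * D)                      ≤⟨ ℕ.*-monoʳ-≤ (suc q′) ID≤ ⟩
      suc q′ * (I′ + I * q ^ k)             ≡⟨ e₁ q′ I′ I (q ^ k) ⟩
      suc q′ * I′ + suc q′ * q ^ k * I      ≤⟨ ℕ.+-monoʳ-≤ (suc q′ * I′) (ℕ.*-monoˡ-≤ I qq≤D) ⟩
      suc q′ * I′ + D * I                   ∎)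
      where
      open ℕ.≤-Reasoning
      e₁ : ∀ q′ I′ I x → suc q′ * (I′ + I * x) ≡ suc q′ * I′ + suc q′ * x * I
      e₁ = solve-∀

  module _ (S : Subspace V) where
    private
      module S = Subspace S
      D = count sizeV S.member?

    TailIn : ∀ s {t} → Vector V.Carrierᴹ (s + t) → Set
    TailIn s b = ∀ l → S.Member (b (s ↑ʳ l))

    TailIn? : ∀ s {t} → Decidable (TailIn s {t})
    TailIn? s b = all? (λ l → S.member? (b (s ↑ʳ l)))

    TailIn-resp : ∀ s {t} → TailIn s {t} Respects _≋_
    TailIn-resp s b≋ b∈ l = S.resp (b≋ (s ↑ʳ l)) (b∈ l)

    -- Tuples grow at the front, so the `t` vectors of `S` are chosen before the `s` arbitrary ones.
    -- The bound `q ^ t ≤ D` leaves room for the former and `s + t ≤ N` for the latter; each of the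
    -- `s + t` choices costs `1 / q`.
    count-independent : ∀ s t → q ^ t ≤ D → s + t ≤ N →
      q * ((q ^ N) ^ s * D ^ t) ≤
      q * count (tuples (s + t)) (λ b → TailIn? s b ×-dec LI? b) + (s + t) * ((q ^ N) ^ s * D ^ t)
    count-independent zero zero q^t≤D s+t≤N =
      ℕ.≤-trans (ℕ.*-monoʳ-≤ q 1≤) (ℕ.m≤m+n _ _)
      where
      1≤ : 1 ≤ count (tuples 0) (λ b → TailIn? 0 b ×-dec LI? b)
      1≤ = ℕ.≤-trans (ℕ.≤-reflexive (≡.sym (∑-const (tuples 0) 1)))
        (∑-mono (tuples 0) (λ b → ℕ.≤-reflexive (≡.sym (ind-yes (TailIn? 0 b ×-dec LI? b) ((λ ()) , λ _ _ ())))))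
    count-independent zero (suc t) q^t≤D s+t≤N = ℕ.≤-trans
      (ℕ.≤-reflexive (e₁ q D (D ^ t)))
      (ℕ.≤-trans (count-independent-step (TailIn? 0) (TailIn-resp 0) S q^t≤D t
        (count-independent zero t (ℕ.≤-trans (q^-mono-≤ 𝔽 (ℕ.n≤1+n t)) q^t≤D) (ℕ.<⇒≤ s+t≤N)))
      (ℕ.+-mono-≤ (ℕ.*-monoʳ-≤ q (count-mono (tuples (suc t)) _ _
          (λ b (b₀∈ , b∈ , li) → (λ { zero → b₀∈ ; (suc l) → b∈ l }) , li)))
        (ℕ.≤-reflexive (e₂ (suc t) D (D ^ t)))))
      where
      e₁ : ∀ q D x → q * (1 * (D * x)) ≡ q * (D * (1 * x))
      e₁ = solve-∀
      e₂ : ∀ t D x → t * (D * (1 * x)) ≡ t * (1 * (D * x))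
      e₂ = solve-∀
    count-independent (suc s) t q^t≤D s+t≤N = ℕ.≤-trans
      (ℕ.≤-reflexive (e₁ q (q ^ N) ((q ^ N) ^ s) (D ^ t)))
      (ℕ.≤-trans (≡.subst (λ x → q * (x * P) ≤ q * J + suc (s + t) * (x * P)) whole
        (count-independent-step (TailIn? s) (TailIn-resp s) (wholeSpace V) q^≤ (s + t)
          (count-independent s t q^t≤D (ℕ.<⇒≤ s+t≤N))))
      (ℕ.+-mono-≤ (ℕ.*-monoʳ-≤ q (count-mono (tuples (suc s + t)) _ _ (λ b (_ , b∈ , li) → b∈ , li)))
        (ℕ.≤-reflexive (e₂ (suc (s + t)) (q ^ N) ((q ^ N) ^ s) (D ^ t)))))
      where
      P = (q ^ N) ^ s * D ^ t
      J = count (tuples (suc s + t)) (λ b → Subspace.member? (wholeSpace V) (b zero) ×-dec TailIn? s (b ∘ suc) ×-dec LI? b)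
      whole : count sizeV (Subspace.member? (wholeSpace V)) ≡ q ^ N
      whole = ≡.trans (∑-const sizeV 1) (ℕ.*-identityʳ _)
      q^≤ : q ^ suc (s + t) ≤ count sizeV (Subspace.member? (wholeSpace V))
      q^≤ = ℕ.≤-trans (q^-mono-≤ 𝔽 s+t≤N) (ℕ.≤-reflexive (≡.sym whole))
      e₁ : ∀ q x y d → q * (x * y * d) ≡ q * (x * (y * d))
      e₁ = solve-∀
      e₂ : ∀ e x y d → e * (x * (y * d)) ≡ e * (x * y * d)
      e₂ = solve-∀

module _ {q N} (𝔽 : FiniteField q c ℓ) (V : VectorSpace 𝔽 r ℓr) (dimV : Dimension V N) where
  private
    module 𝔽 = FiniteField 𝔽
    module V = Module V
  open FiniteDimensional 𝔽 V dimV

  count-subspace : (U : Subspace V) {m : ℕ} → HasDim V U m → count sizeV (Subspace.member? U) ≡ q ^ m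
  count-subspace U {m} dimU = ℕ.≤-antisym
    (count-injection-size sizeV (scalars-size 𝔽 m) (Subspace.member? U)
      (λ _ → coordinates 𝔽 V dimV U dimU) (λ _ _ → coordinates-injective 𝔽 V dimV U dimU))
    (count-subspace≥ 𝔽 V dimV U dimU)

  count-LI : ∀ k → k ≤ N → q * (q ^ N) ^ k ≤ q * count (tuples k) LI? + k * (q ^ N) ^ k
  count-LI k k≤N = ≡.subst (λ x → q * x ≤ q * count (tuples k) LI? + k * x) whole
    (ℕ.≤-trans (count-independent 𝔽 V dimV (wholeSpace V) 0 k q^k≤ k≤N)
      (ℕ.+-monoˡ-≤ _ (ℕ.*-monoʳ-≤ q (count-mono (tuples k) _ _ (λ _ → proj₂)))))
    where
    whole : 1 * count sizeV (Subspace.member? (wholeSpace V)) ^ k ≡ (q ^ N) ^ k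
    whole = ≡.trans (ℕ.*-identityˡ _) (≡.cong (_^ k) (count-subspace (wholeSpace V) dimV))
    q^k≤ : q ^ k ≤ count sizeV (Subspace.member? (wholeSpace V))
    q^k≤ = ℕ.≤-trans (q^-mono-≤ 𝔽 k≤N) (ℕ.≤-reflexive (≡.sym (count-subspace (wholeSpace V) dimV)))

  -- The datum `D z` fixes `Y ψ`, and at most `s ∸ t` further combinations then fix `ψ`, so there
  -- are at most `(q ^ N) ^ (s ∸ t)` objects for each datum. An element `z` may carry more than `ψ`:
  -- the second moment takes pairs `(ψ , φ)` and recovers `φ` from `ψ` and the datum.
  count-determined :
    ∀ {Z : Setoid a b} {nz} (sizeZ : HasSize Z nz) {T : Setoid a′ b′} {nt} (sizeT : HasSize T nt)
    {P : Pred (Setoid.Carrier Z) p} (P? : Decidable P)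
    {s t} (Y : Vector (Vector 𝔽.Carrier s) t) → LinearlyIndependent (coordinateSpace 𝔽 s) Y →
    (ψ : Setoid.Carrier Z → Vector V.Carrierᴹ s) (D : ∀ z → P z → Setoid.Carrier T) →
    (∀ z z′ p p′ → Setoid._≈_ T (D z p) (D z′ p′) → ∀ l → lc (Y l) (ψ z) V.≈ᴹ lc (Y l) (ψ z′)) →
    (∀ z z′ p p′ → Setoid._≈_ T (D z p) (D z′ p′) → ψ z ≋ ψ z′ → Setoid._≈_ Z z z′) →
    count sizeZ P? * (q ^ N) ^ t ≤ (q ^ N) ^ s * nt
  count-determined sizeZ {nt = nt} sizeT P? {s} {t} Y liY ψ D D⇒Yψ D⇒z
    with j , j+t≤s , R , determined ← complementaryCombinations 𝔽 V Y liY = begin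
    count sizeZ P? * (q ^ N) ^ t          ≤⟨ ℕ.*-monoˡ-≤ _ (count-injection-size sizeZ (tuples j ×ₛ sizeT) P?
                                               (λ z p → (λ i → lc (R i) (ψ z)) , D z p)
                                               (λ z z′ p p′ (R≈ , D≈) → D⇒z z z′ p p′ D≈
                                                 (determined _ _ R≈ (D⇒Yψ z z′ p p′ D≈)))) ⟩
    (q ^ N) ^ j * nt * (q ^ N) ^ t        ≡⟨ e₁ ((q ^ N) ^ j) nt ((q ^ N) ^ t) ⟩
    (q ^ N) ^ j * (q ^ N) ^ t * nt        ≡⟨ ≡.cong (_* nt) (ℕ.^-distribˡ-+-* (q ^ N) j t) ⟨
    (q ^ N) ^ (j + t) * nt                ≤⟨ ℕ.*-monoˡ-≤ nt (ℕ.^-monoʳ-≤ (q ^ N) {{ℕ.m^n≢0 q N {{q-nonZero 𝔽}}}} j+t≤s) ⟩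
    (q ^ N) ^ s * nt                      ∎
    where
    open ℕ.≤-Reasoning
    e₁ : ∀ x y z → x * y * z ≡ x * z * y
    e₁ = solve-∀

  opaque
    scalarTuples : ∀ m t → HasSize (vectorSetoid (vectorSetoid 𝔽.setoid m) t) ((q ^ m) ^ t)
    scalarTuples m t = vector-size {S = vectorSetoid 𝔽.setoid m} (scalars-size 𝔽 m) t

  -- For `f = suc h` this makes the failure of `dim ≤ h` constructive: it yields `suc h` independent
  -- vectors.
  smallBasis⊎independent : ∀ (U : Subspace V) f →
    (∃ λ d → d < f × HasDim V U d) ⊎ (∃ λ (w : Vector V.Carrierᴹ f) → LI w × (∀ l → Subspace.Member U (w l)))
  smallBasis⊎independent U f with extend U [] (λ _ _ ()) (λ ()) f
  ... | inj₁ (d , b , d<f , basis , _) = inj₁ (d , d<f , ≡.subst (HasDim V U) (ℕ.+-identityʳ d) (b , basis))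
  ... | inj₂ (w , li , w∈ , _) = inj₂ (≡.subst
    (λ n → ∃ λ (w : Vector V.Carrierᴹ n) → LI w × (∀ l → Subspace.Member U (w l))) (ℕ.+-identityʳ f) (w , li , w∈))

  evasive⊎independent : ∀ 𝒜 h (U : Subspace V) → IsEvasive V 𝒜 h U ⊎
    (∃ λ (i : Fin (length 𝒜)) → ∃ λ (w : Vector V.Carrierᴹ (suc h)) → LI w ×
      (∀ l → Subspace.Member U (w l)) × (∀ l → Subspace.Member (lookup 𝒜 i) (w l)))
  evasive⊎independent List.[] h U = inj₁ All.[]
  evasive⊎independent (S List.∷ 𝒜) h U with smallBasis⊎independent (_∩_ V U S) (suc h)
  ... | inj₂ (w , li , w∈) = inj₂ (zero , w , li , proj₁ ∘ w∈ , proj₂ ∘ w∈)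
  ... | inj₁ (d , s≤s d≤h , dim) with evasive⊎independent 𝒜 h U
  ...   | inj₁ evasive      = inj₁ ((d , d≤h , dim) All.∷ evasive)
  ...   | inj₂ (i , witness) = inj₂ (suc i , witness)

  independent⇒¬evasive : ∀ 𝒜 h (U : Subspace V) (i : Fin (length 𝒜)) (w : Vector V.Carrierᴹ (suc h)) → LI w →
    (∀ l → Subspace.Member U (w l)) → (∀ l → Subspace.Member (lookup 𝒜 i) (w l)) → ¬ IsEvasive V 𝒜 h U
  independent⇒¬evasive 𝒜 h U i w li w∈U w∈S evasive with All.lookup evasive (∈-lookup i)
  ... | d , d≤h , (b , basis) = ℕ.<⇒≱
    (independent≤spanning 𝔽 V li (λ l → IsBasis.spanning basis (w l) (w∈U l , w∈S l))) d≤h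

  -- Each k-dimensional subspace is the span of exactly as many independent
  -- k-tuples as there are invertible k × k matrices.
  module _ {k} {Q : Pred (Subspace V) p} (Q⇒dim : ∀ U → Q U → HasDim V U k) (Q-resp : Q Respects Setoid._≈_ (subspaceSetoid V))
           {n} (size : HasSize (Subsetoid (subspaceSetoid V) Q) n) where
    private
      module C = Coordinates 𝔽 k
      g = count (C.tuples k) C.LI?
      module Q = Inverse size

      U : Fin n → Subspace V
      U i = proj₁ (Q.from i)
      bases : ∀ i → HasDim V (U i) k
      bases i = Q⇒dim (U i) (proj₂ (Q.from i))

      product-count : count (fin-size n ×ₛ C.tuples k) (λ (_ , M) → C.LI? M) ≡ n * g
      product-count = ≡.trans (∑-× (fin-size n) (C.tuples k) _) (∑-const (fin-size n) g)

    -- A subspace `U i` and an invertible `M` go to the tuple `M u`, where `u` is the chosen basis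
    -- of `U i`. Its span returns `i`, and then the independence of `u` returns `M`.
    subspaces*bases≤tuples : {R : Pred (Vector V.Carrierᴹ k) a} (R? : Decidable R) → R Respects _≋_ →
                             (∀ b → LI b → Q (span b) → R b) → n * g ≤ count (tuples k) R?
    subspaces*bases≤tuples R? R-resp R = ℕ.≤-trans (ℕ.≤-reflexive (≡.sym product-count))
      (count-injection (fin-size n ×ₛ C.tuples k) (tuples k) _ R? R-resp
        (λ (i , M) _ → basis i M)
        (λ (i , M) liM → R _ (LI-basis i M liM)
          (Q-resp {U i} {span (basis i M)} ((λ {x} → U⊆span i M liM x) , λ {x} → span⊆U i M x) (proj₂ (Q.from i))))
        injective)
      where
      basis : ∀ i → Vector (Vector 𝔽.Carrier k) k → Vector V.Carrierᴹ k
      basis i M l = lc (M l) (proj₁ (bases i))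
      LI-basis : ∀ i M → C.LI M → LI (basis i M)
      LI-basis i M = LI-combination {b = proj₁ (bases i)} (IsBasis.independent (proj₂ (bases i)))
      span⊆U : ∀ i M x → Subspace.Member (span (basis i M)) x → Subspace.Member (U i) x
      span⊆U i M x x∈ with s , x≈ ← ∈⇒∈span {b = basis i M} x∈ = Subspace.resp (U i) (V.≈ᴹ-sym x≈)
        (lc-∈ (U i) s (λ l → lc-∈ (U i) (M l) (IsBasis.members (proj₂ (bases i)))))
      U⊆span : ∀ i M → C.LI M → ∀ x → Subspace.Member (U i) x → Subspace.Member (span (basis i M)) x
      U⊆span i M liM x x∈ with s , x≈ ← IsBasis.spanning (proj₂ (bases i)) x x∈
                          with s′ , s≈ ← C.LI⇒spanning {b = M} liM s = ∈span⇒∈ {b = basis i M}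
        (s′ , V.≈ᴹ-trans x≈ (V.≈ᴹ-trans (lc-congˡ s≈) (V.≈ᴹ-sym (lc-compose s′ M (proj₁ (bases i))))))
      same-span : ∀ {b b′ : Vector V.Carrierᴹ k} → b ≋ b′ → ∀ x → Subspace.Member (span b) x → Subspace.Member (span b′) x
      same-span {b} {b′} b≋ x x∈ = ∈span⇒∈ {b = b′} (∈span-resp b≋ V.≈ᴹ-refl (∈⇒∈span {b = b} x∈))
      injective : ∀ iM jM′ → C.LI (proj₂ iM) → C.LI (proj₂ jM′) →
                  basis (proj₁ iM) (proj₂ iM) ≋ basis (proj₁ jM′) (proj₂ jM′) →
                  proj₁ iM ≡ proj₁ jM′ × (∀ l → proj₂ iM l ≋𝔽 proj₂ jM′ l)
      injective (i , M) (j , M′) liM liM′ eq = i≡j ,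
        λ l → lc-injective (IsBasis.independent (proj₂ (bases i))) (M l) (M′ l)
          (≡.subst (λ j → lc (M l) (proj₁ (bases i)) V.≈ᴹ lc (M′ l) (proj₁ (bases j))) (≡.sym i≡j) (eq l))
        where
        i≡j : i ≡ j
        i≡j = ≡.trans (≡.sym (Q.strictlyInverseˡ i)) (≡.trans (Q.to-cong
          ( (λ {x} x∈ → span⊆U j M′ x (same-span eq x (U⊆span i M liM x x∈)))
          , (λ {x} x∈ → span⊆U i M x (same-span (λ l → V.≈ᴹ-sym (eq l)) x (U⊆span j M′ liM′ x x∈)))))
          (Q.strictlyInverseˡ j))

    tuples≤subspaces*bases : {R : Pred (Vector V.Carrierᴹ k) a} (R? : Decidable R) →
                             (∀ b → R b → LI b × Q (span b)) → count (tuples k) R? ≤ n * g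
    tuples≤subspaces*bases {R = R} R? R⇒ = ℕ.≤-trans
      (count-injection (tuples k) (fin-size n ×ₛ C.tuples k) R? (λ (_ , M) → C.LI? M)
        (λ (_ , M≋) → C.LI-resp M≋)
        (λ b Rb → index b Rb , λ l → proj₁ (coefficients b Rb l))
        (λ b Rb → LI-coefficients {M = λ l → proj₁ (coefficients b Rb l)} {b = proj₁ (bases (index b Rb))}
          (LI-resp (λ l → proj₂ (coefficients b Rb l)) (proj₁ (R⇒ b Rb))))
        (λ b b′ Rb Rb′ (i≡ , M≋) l → V.≈ᴹ-trans (proj₂ (coefficients b Rb l)) (V.≈ᴹ-trans
          (lc-cong (M≋ l) (λ j → V.≈ᴹ-reflexive (≡.cong (λ i → proj₁ (bases i) j) i≡)))
          (V.≈ᴹ-sym (proj₂ (coefficients b′ Rb′ l))))))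
      (ℕ.≤-reflexive product-count)
      where
      index : ∀ b → R b → Fin n
      index b Rb = Q.to (span b , proj₂ (R⇒ b Rb))
      coefficients : ∀ b (Rb : R b) l → ∈span (proj₁ (bases (index b Rb))) (b l)
      coefficients b Rb l = IsBasis.spanning (proj₂ (bases (index b Rb))) (b l)
        (proj₂ (Q.strictlyInverseʳ (span b , proj₂ (R⇒ b Rb))) (∈span⇒∈ {b = b} (∈span-self b l)))

  private
    span-cong : ∀ {k} {b b′ : Vector V.Carrierᴹ k} → b ≋ b′ → Setoid._≈_ (subspaceSetoid V) (span b) (span b′)
    span-cong {b = b} {b′} b≋ =
      (λ x∈ → ∈span⇒∈ {b = b′} (∈span-resp b≋ V.≈ᴹ-refl (∈⇒∈span {b = b} x∈))) ,
      (λ x∈ → ∈span⇒∈ {b = b} (∈span-resp (λ i → V.≈ᴹ-sym (b≋ i)) V.≈ᴹ-refl (∈⇒∈span {b = b′} x∈)))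

  module _ (𝒜 : List (Subspace V)) (h : ℕ) {k : ℕ} where

    EvasiveLI NonevasiveLI : Vector V.Carrierᴹ k → Set _
    EvasiveLI    b = LI b × IsEvasive V 𝒜 h (span b)
    NonevasiveLI b = LI b × ¬ IsEvasive V 𝒜 h (span b)

    EvasiveLI? : Decidable EvasiveLI
    EvasiveLI? b = LI? b ×-dec isEvasive? V 𝔽.size dimV 𝒜 h (span b)

    NonevasiveLI? : Decidable NonevasiveLI
    NonevasiveLI? b = LI? b ×-dec ¬? (isEvasive? V 𝔽.size dimV 𝒜 h (span b))

    EvasiveLI-resp : EvasiveLI Respects _≋_
    EvasiveLI-resp {b} {b′} b≋ (li , evasive) =
      LI-resp b≋ li , IsEvasive-resp V 𝒜 h {span b} {span b′} (span-cong b≋) evasive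

    NonevasiveLI-resp : NonevasiveLI Respects _≋_
    NonevasiveLI-resp {b} {b′} b≋ (li , ¬evasive) = LI-resp b≋ li , λ evasive →
      ¬evasive (IsEvasive-resp V 𝒜 h {span b′} {span b} (span-cong (λ i → V.≈ᴹ-sym (b≋ i))) evasive)

-- The first moment

module _ {q N} (𝔽 : FiniteField q c ℓ) (V : VectorSpace 𝔽 r ℓr) (dimV : Dimension V N)
         (𝒜 : List (Subspace V)) {m : ℕ} (dimS : ∀ i → HasDim V (lookup 𝒜 i) m) (h k : ℕ) where
  private
    module 𝔽 = FiniteField 𝔽
    module V = Module V
    module Fᵏ = Coordinates 𝔽 k
    module Fᵗ = Coordinates 𝔽 (suc h)
    t = suc h
    S : Fin (length 𝒜) → Subspace V
    S = lookup 𝒜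
  open FiniteDimensional 𝔽 V dimV

  private
    bad? = NonevasiveLI? 𝔽 V dimV 𝒜 h {k}

    Witness : Fin (length 𝒜) × Vector (Vector 𝔽.Carrier k) t → Vector V.Carrierᴹ k → Set _
    Witness (i , A) φ = Fᵏ.LI A × (∀ l → Subspace.Member (S i) (lc (A l) φ))

    Witness? : ∀ iA φ → Dec (Witness iA φ)
    Witness? (i , A) φ = Fᵏ.LI? A ×-dec all? (λ l → Subspace.member? (S i) (lc (A l) φ))

    witnesses = fin-size (length 𝒜) ×ₛ Fᵏ.tuples t

    -- The vectors `w` are `A φ` for some `A`, whose rows inherit independence from `w`. Each
    -- invertible `G` gives the witness `G A`: its values are combinations of the `w l`, hence stay
    -- in `S i`, and `G` can be read off because `A` has independent rows.
    orbit : ∀ φ → (∃ λ i → ∃ λ (w : Vector V.Carrierᴹ t) → LI w ×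
      (∀ l → Subspace.Member (span φ) (w l)) × (∀ l → Subspace.Member (S i) (w l))) →
      count (Fᵗ.tuples t) Fᵗ.LI? ≤ count witnesses (λ iA → Witness? iA φ)
    orbit φ (i , w , liw , w∈span , w∈S) =
      count-injection (Fᵗ.tuples t) witnesses Fᵗ.LI? (λ iA → Witness? iA φ)
        (λ { {i , _} (≡.refl , A≋) (liA , A∈) → Fᵏ.LI-resp A≋ liA ,
             λ l → Subspace.resp (S i) (lc-congˡ (A≋ l)) (A∈ l) })
        (λ G _ → i , λ l → Fᵏ.lc (G l) A)
        (λ G liG → Fᵏ.LI-combination {M = G} {b = A} liA liG ,
          λ l → Subspace.resp (S i) (lc-compose (G l) A φ)
                  (lc-∈ (S i) (G l) (λ l′ → Subspace.resp (S i) (proj₂ (∈⇒∈span {b = φ} (w∈span l′))) (w∈S l′))))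
        (λ G G′ _ _ (_ , eq) l → Fᵏ.lc-injective {b = A} liA (G l) (G′ l) (eq l))
      where
      A : Vector (Vector 𝔽.Carrier k) t
      A l = proj₁ (∈⇒∈span {b = φ} (w∈span l))
      liA : Fᵏ.LI A
      liA = LI-coefficients {M = A} {b = φ} (LI-resp (λ l → proj₂ (∈⇒∈span {b = φ} (w∈span l))) liw)

    bad≤witnesses : ∀ φ → ind (bad? φ) * count (Fᵗ.tuples t) Fᵗ.LI? ≤ count witnesses (λ iA → Witness? iA φ)
    bad≤witnesses φ = ind-*-≤ (bad? φ) λ (li , ¬evasive) →
      orbit φ ([ (λ evasive → contradiction evasive ¬evasive) , id ]′ (evasive⊎independent 𝔽 V dimV 𝒜 h (span φ)))
    -- A dependent `A` is never a witness. For an independent one, the coordinates of the rows of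
    -- `A φ` in `S i` serve as the datum of `count-determined`.
    tuples-per-witness : ∀ iA → count (tuples k) (Witness? iA) * (q ^ N) ^ t ≤ (q ^ N) ^ k * (q ^ m) ^ t
    tuples-per-witness (i , A) = go (Fᵏ.LI? A)
      where
      go : Dec (Fᵏ.LI A) → count (tuples k) (Witness? (i , A)) * (q ^ N) ^ t ≤ (q ^ N) ^ k * (q ^ m) ^ t
      go (no ¬liA) = ℕ.≤-trans (ℕ.≤-reflexive (≡.cong (_* (q ^ N) ^ t)
        (count-none (tuples k) (Witness? (i , A)) (λ _ (liA , _) → ¬liA liA)))) z≤n
      go (yes liA) = count-determined 𝔽 V dimV (tuples k) (scalarTuples 𝔽 V dimV m t) (Witness? (i , A))
        A liA id (λ φ (_ , A∈) l → coordinates 𝔽 V dimV (S i) (dimS i) (A∈ l))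
        (λ φ φ′ (_ , A∈) (_ , A∈′) eq l → coordinates-injective 𝔽 V dimV (S i) (dimS i) (A∈ l) (A∈′ l) (eq l))
        (λ _ _ _ _ _ eq → eq)

  count-nonevasive≤ :
    count (tuples k) (NonevasiveLI? 𝔽 V dimV 𝒜 h) * count (Fᵗ.tuples t) Fᵗ.LI? * (q ^ N) ^ t ≤
    length 𝒜 * (q ^ k) ^ t * ((q ^ N) ^ k * (q ^ m) ^ t)
  count-nonevasive≤ = begin
    count (tuples k) bad? * g * (q ^ N) ^ t                              ≡⟨ ≡.cong (_* (q ^ N) ^ t) (∑-*ʳ (tuples k) g _) ⟨
    ∑ (tuples k) (λ φ → ind (bad? φ) * g) * (q ^ N) ^ t                  ≤⟨ ℕ.*-monoˡ-≤ _ (∑-mono (tuples k) bad≤witnesses) ⟩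
    ∑ (tuples k) (λ φ → count witnesses (λ iA → Witness? iA φ)) * (q ^ N) ^ t ≡⟨ ≡.cong (_* (q ^ N) ^ t) (∑-swap (tuples k) witnesses _) ⟩
    ∑ witnesses (λ iA → count (tuples k) (Witness? iA)) * (q ^ N) ^ t    ≡⟨ ∑-*ʳ witnesses _ _ ⟨
    ∑ witnesses (λ iA → count (tuples k) (Witness? iA) * (q ^ N) ^ t)    ≤⟨ ∑-bound witnesses tuples-per-witness ⟩
    length 𝒜 * (q ^ k) ^ t * ((q ^ N) ^ k * (q ^ m) ^ t)                 ∎
    where
    open ℕ.≤-Reasoning
    g = count (Fᵗ.tuples t) Fᵗ.LI?

-- The second moment

module Moment {q N} (𝔽 : FiniteField q c ℓ) (V : VectorSpace 𝔽 r ℓr) (dimV : Dimension V N)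
         (S : Subspace V) {m : ℕ} (dimS : HasDim V S m) (t : ℕ) where
  private
    module 𝔽 = FiniteField 𝔽
    module V = Module V
    module S = Subspace S
    open GroupProperties V.+ᴹ-group using (∙-cancelʳ)
    open GroupProperties 𝔽.+-group using () renaming (∙-cancelʳ to +-cancelʳ)
  open FiniteDimensional 𝔽 V dimV

  matrices : ∀ s → HasSize _ ((q ^ s) ^ t)
  matrices s = Coordinates.tuples 𝔽 s t

  RowsIn : ∀ s → Vector V.Carrierᴹ s × Vector (Vector 𝔽.Carrier s) t → Set
  RowsIn s (ψ , Y) = ∀ l → S.Member (lc (Y l) ψ)

  RowsIn? : ∀ s → Decidable (RowsIn s)
  RowsIn? s (ψ , Y) = all? (λ l → S.member? (lc (Y l) ψ))

  RowsIn-resp : ∀ s {x y} → Setoid._≈_ (×-setoid (vectorSetoid V.≈ᴹ-setoid s) (vectorSetoid (vectorSetoid 𝔽.setoid s) t)) x y →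
                RowsIn s x → RowsIn s y
  RowsIn-resp s (ψ≋ , Y≋) ∈S l = S.resp (lc-cong (Y≋ l) ψ≋) (∈S l)

  countRowsIn : ℕ → ℕ
  countRowsIn s = count (tuples s ×ₛ matrices s) (RowsIn? s)

  private
    ≈0? : ∀ (x : 𝔽.Carrier) → Dec (x 𝔽.≈ 𝔽.0#)
    ≈0? x = finite-≈? {S = 𝔽.setoid} 𝔽.size x 𝔽.0#

    inverse-unique : ∀ {x x′ y y′} → x 𝔽.* y 𝔽.≈ 𝔽.1# → x′ 𝔽.* y′ 𝔽.≈ 𝔽.1# → x 𝔽.≈ x′ → y 𝔽.≈ y′
    inverse-unique {x} {x′} {y} {y′} xy≈1 x′y′≈1 x≈x′ = begin
      y                  ≈⟨ 𝔽.*-identityʳ y ⟨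
      y 𝔽.* 𝔽.1#         ≈⟨ 𝔽.*-congˡ x′y′≈1 ⟨
      y 𝔽.* (x′ 𝔽.* y′)  ≈⟨ 𝔽.*-assoc y x′ y′ ⟨
      y 𝔽.* x′ 𝔽.* y′    ≈⟨ 𝔽.*-congʳ (𝔽.trans (𝔽.*-comm y x′) (𝔽.*-congʳ (𝔽.sym x≈x′))) ⟩
      x 𝔽.* y 𝔽.* y′     ≈⟨ 𝔽.*-congʳ xy≈1 ⟩
      𝔽.1# 𝔽.* y′        ≈⟨ 𝔽.*-identityˡ y′ ⟩
      y′                 ∎
      where open SetoidReasoning 𝔽.setoid

    unit-cancel : ∀ {x y v v′} → x 𝔽.* y 𝔽.≈ 𝔽.1# → x V.*ₗ v V.≈ᴹ x V.*ₗ v′ → v V.≈ᴹ v′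
    unit-cancel {x} {y} xy≈1 eq = V.≈ᴹ-trans (V.≈ᴹ-sym (back _)) (V.≈ᴹ-trans (V.*ₗ-cong 𝔽.refl eq) (back _))
      where
      back : ∀ v → y V.*ₗ x V.*ₗ v V.≈ᴹ v
      back v = V.≈ᴹ-trans (V.≈ᴹ-sym (V.*ₗ-assoc y x v))
        (V.≈ᴹ-trans (V.*ₗ-cong (𝔽.trans (𝔽.*-comm y x) xy≈1) V.≈ᴹ-refl) (V.*ₗ-identityˡ v))

    lc-headless : ∀ {s} {w : Vector 𝔽.Carrier (suc s)} {ψ} → w zero 𝔽.≈ 𝔽.0# → lc w ψ V.≈ᴹ lc (w ∘ suc) (ψ ∘ suc)
    lc-headless w₀≈0 = V.≈ᴹ-trans (V.+ᴹ-congʳ (V.≈ᴹ-trans (V.*ₗ-cong w₀≈0 V.≈ᴹ-refl) (V.*ₗ-zeroˡ _))) (V.+ᴹ-identityˡ _)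

  module _ (s : ℕ) where
    private
      Source = Vector V.Carrierᴹ (suc s) × Vector (Vector 𝔽.Carrier (suc s)) t

      HeadsZero HeadNonzero : Source → Set _
      HeadsZero   (_ , Y) = ∀ l → Y l zero 𝔽.≈ 𝔽.0#
      HeadNonzero (_ , Y) = ∃ λ l → ¬ Y l zero 𝔽.≈ 𝔽.0#

      HeadsZero? : Decidable HeadsZero
      HeadsZero? (_ , Y) = all? (λ l → ≈0? (Y l zero))
      HeadNonzero? : Decidable HeadNonzero
      HeadNonzero? (_ , Y) = any? (λ l → ¬? (≈0? (Y l zero)))

      count-HeadsZero : count (tuples (suc s) ×ₛ matrices (suc s)) (λ z → RowsIn? (suc s) z ×-dec HeadsZero? z)
                        ≤ q ^ N * countRowsIn s
      count-HeadsZero = ℕ.≤-trans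
        (count-injection (tuples (suc s) ×ₛ matrices (suc s)) (sizeV ×ₛ tuples s ×ₛ matrices s) _
          (λ (_ , z) → RowsIn? s z) (λ {(_ , x)} {(_ , y)} (_ , eq) → RowsIn-resp s {x} {y} eq)
          (λ (ψ , Y) _ → ψ zero , ψ ∘ suc , λ l → Y l ∘ suc)
          (λ (ψ , Y) (∈S , heads) l → S.resp (lc-headless {w = Y l} {ψ} (heads l)) (∈S l))
          (λ (ψ , Y) (ψ′ , Y′) (_ , heads) (_ , heads′) (ψ₀≈ , ψ≋ , Y≋) →
            (λ { zero → ψ₀≈ ; (suc j) → ψ≋ j }) ,
            (λ l → λ { zero → 𝔽.trans (heads l) (𝔽.sym (heads′ l)) ; (suc j) → Y≋ l j })))
        (ℕ.≤-reflexive (≡.trans (∑-× sizeV (tuples s ×ₛ matrices s) _) (∑-const sizeV _)))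

      module Elimination (ψ : Vector V.Carrierᴹ (suc s)) (Y : Vector (Vector 𝔽.Carrier (suc s)) t)
                         (i : Fin t) (y≉0 : ¬ Y i zero 𝔽.≈ 𝔽.0#) where
        z = proj₁ (𝔽.invertible (Y i zero) y≉0)
        yz≈1 = proj₂ (𝔽.invertible (Y i zero) y≉0)
        factor : Fin t → 𝔽.Carrier
        factor l = 𝔽.- (Y l zero 𝔽.* z)
        eliminated : Vector (Vector 𝔽.Carrier (suc s)) t
        eliminated l j = Y l j 𝔽.+ factor l 𝔽.* Y i j
        eliminated₀ : ∀ l → eliminated l zero 𝔽.≈ 𝔽.0#
        eliminated₀ l = begin
          Y l zero 𝔽.+ 𝔽.- (Y l zero 𝔽.* z) 𝔽.* Y i zero       ≈⟨ 𝔽.+-congˡ (-‿distribˡ-* _ _) ⟨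
          Y l zero 𝔽.+ 𝔽.- (Y l zero 𝔽.* z 𝔽.* Y i zero)       ≈⟨ 𝔽.+-congˡ (𝔽.-‿cong (𝔽.trans (𝔽.*-assoc _ _ _)
                                                                 (𝔽.trans (𝔽.*-congˡ (𝔽.trans (𝔽.*-comm z _) yz≈1)) (𝔽.*-identityʳ _)))) ⟩
          Y l zero 𝔽.+ 𝔽.- Y l zero                            ≈⟨ 𝔽.-‿inverseʳ _ ⟩
          𝔽.0#                                                 ∎
          where
          open SetoidReasoning 𝔽.setoid
          open RingProperties 𝔽.ring using (-‿distribˡ-*)
        eliminated∈ : RowsIn (suc s) (ψ , Y) → RowsIn s (ψ ∘ suc , λ l → eliminated l ∘ suc)
        eliminated∈ ∈S l = S.resp (lc-headless {w = eliminated l} {ψ} (eliminated₀ l))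
          (S.resp (V.≈ᴹ-sym (V.≈ᴹ-trans (lc-+ (Y l) (λ j → factor l 𝔽.* Y i j) ψ) (V.+ᴹ-congˡ (lc-* (factor l) (Y i) ψ))))
            (S.+ᴹ∈ (∈S l) (S.*ₗ∈ (factor l) (∈S i))))

      -- Given a row i with nonzero head, eliminating the heads of all rows
      -- leaves a matrix sending the tail of ψ into S, while the head of ψ is
      -- determined by the value of row i, a vector of S.
      count-HeadNonzero : count (tuples (suc s) ×ₛ matrices (suc s)) (λ z → RowsIn? (suc s) z ×-dec HeadNonzero? z)
                          ≤ t * q ^ t * (q ^ m * q ^ s) * countRowsIn s
      count-HeadNonzero = ℕ.≤-trans
        (count-injection (tuples (suc s) ×ₛ matrices (suc s))
          (((fin-size t ×ₛ scalars-size 𝔽 t) ×ₛ (scalars-size 𝔽 m ×ₛ scalars-size 𝔽 s)) ×ₛ (tuples s ×ₛ matrices s)) _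
          (λ (_ , z) → RowsIn? s z) (λ {(_ , x)} {(_ , y)} (_ , eq) → RowsIn-resp s {x} {y} eq)
          (λ (ψ , Y) (∈S , i , y≉0) → ((i , λ l → Y l zero) , coordinates 𝔽 V dimV S dimS (∈S i) , Y i ∘ suc) ,
            ψ ∘ suc , λ l → Elimination.eliminated ψ Y i y≉0 l ∘ suc)
          (λ (ψ , Y) (∈S , i , y≉0) → Elimination.eliminated∈ ψ Y i y≉0 ∈S)
          injective)
        (ℕ.≤-reflexive (≡.trans (∑-× ((fin-size t ×ₛ scalars-size 𝔽 t) ×ₛ (scalars-size 𝔽 m ×ₛ scalars-size 𝔽 s)) (tuples s ×ₛ matrices s) _)
          (∑-const ((fin-size t ×ₛ scalars-size 𝔽 t) ×ₛ (scalars-size 𝔽 m ×ₛ scalars-size 𝔽 s)) _)))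
        where
        injective : ∀ z z′ (pz : RowsIn (suc s) z × HeadNonzero z) (pz′ : RowsIn (suc s) z′ × HeadNonzero z′) → _ →
                    (proj₁ z ≋ proj₁ z′) × (∀ l → proj₂ z l ≋𝔽 proj₂ z′ l)
        injective (ψ , Y) (ψ′ , Y′) (∈S , i , y≉0) (∈S′ , _ , y≉0′)
          (((≡.refl , y≋) , coord≈ , Yᵢ≋) , ψ≋ , E≋) =
          (λ { zero → ψ₀≈ ; (suc j) → ψ≋ j }) , Y≋
          where
          module E  = Elimination ψ Y i y≉0
          module E′ = Elimination ψ′ Y′ i y≉0′
          -- The multipliers depend only on the pivot index and the first column of `Y`, both of
          -- which are recorded, so the elimination can be undone.
          factor≈ : ∀ l → E.factor l 𝔽.≈ E′.factor l
          factor≈ l = 𝔽.-‿cong (𝔽.*-cong (y≋ l) (inverse-unique E.yz≈1 E′.yz≈1 (y≋ i)))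
          Y≋ : ∀ l j → Y l j 𝔽.≈ Y′ l j
          Y≋ l zero    = y≋ l
          Y≋ l (suc j) = +-cancelʳ (E.factor l 𝔽.* Y i (suc j)) _ _
            (𝔽.trans (E≋ l j) (𝔽.+-congˡ (𝔽.sym (𝔽.*-cong (factor≈ l) (Yᵢ≋ j)))))
          ψ₀≈ : ψ zero V.≈ᴹ ψ′ zero
          ψ₀≈ = unit-cancel E.yz≈1 (∙-cancelʳ (lc (Y i ∘ suc) (ψ ∘ suc)) _ _
            (V.≈ᴹ-trans (coordinates-injective 𝔽 V dimV S dimS (∈S i) (∈S′ i) coord≈)
              (V.+ᴹ-cong (V.*ₗ-cong (𝔽.sym (y≋ i)) V.≈ᴹ-refl)
                (V.≈ᴹ-sym (lc-cong Yᵢ≋ ψ≋)))))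

    -- If the first column of `Y` is zero, the head of `ψ` is free: a factor `q ^ N`. Otherwise the
    -- recorded data are a pivot row, the first column, a vector of `S` and the tail of the pivot
    -- row, at most `t * q ^ (t + m + s)` choices, hence at most `t * q ^ N`. Together these give
    -- the factor `suc t`.
    countRowsIn-suc : t + m + s ≤ N → countRowsIn (suc s) ≤ suc t * q ^ N * countRowsIn s
    countRowsIn-suc t+m+s≤N = begin
      countRowsIn (suc s)   ≤⟨ count-split (tuples (suc s) ×ₛ matrices (suc s)) (RowsIn? (suc s))
                                 (λ z → RowsIn? (suc s) z ×-dec HeadsZero? z) (λ z → RowsIn? (suc s) z ×-dec HeadNonzero? z)
                                 (λ (ψ , Y) ∈S ¬zero → ∈S , Fin.¬∀⟶∃¬ t _ (λ l → ≈0? (Y l zero)) (λ heads → ¬zero (∈S , heads))) ⟩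
      _                     ≤⟨ ℕ.+-mono-≤ count-HeadsZero count-HeadNonzero ⟩
      q ^ N * K + t * q ^ t * (q ^ m * q ^ s) * K ≡⟨ e₁ (q ^ N) K t (q ^ t) (q ^ m) (q ^ s) ⟩
      (q ^ N + t * (q ^ t * q ^ m * q ^ s)) * K   ≤⟨ ℕ.*-monoˡ-≤ K (ℕ.+-monoʳ-≤ (q ^ N) (ℕ.*-monoʳ-≤ t power)) ⟩
      suc t * q ^ N * K     ∎
      where
      open ℕ.≤-Reasoning
      K = countRowsIn s
      power : q ^ t * q ^ m * q ^ s ≤ q ^ N
      power = ℕ.≤-trans (ℕ.≤-reflexive (≡.trans (≡.cong (_* q ^ s) (≡.sym (ℕ.^-distribˡ-+-* q t m)))
        (≡.sym (ℕ.^-distribˡ-+-* q (t + m) s)))) (q^-mono-≤ 𝔽 t+m+s≤N)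
      e₁ : ∀ x K t a b c → x * K + t * a * (b * c) * K ≡ (x + t * (a * b * c)) * K
      e₁ = solve-∀

  -- The matrix `Y = 0` alone contributes `(q ^ N) ^ s`, so the bound is sharp up to the constant
  -- `suc t ^ s`: on average over `ψ`, boundedly many `Y` send it into `S`.
  countRowsIn≤ : ∀ s → t + m + s ≤ N → countRowsIn s ≤ suc t ^ s * (q ^ N) ^ s
  countRowsIn≤ zero    _ = ℕ.≤-trans (count≤size (tuples 0 ×ₛ matrices 0) (RowsIn? 0))
    (ℕ.≤-reflexive (≡.trans (ℕ.+-identityʳ _) (ℕ.^-zeroˡ t)))
  countRowsIn≤ (suc s) t+m+s<N = begin
    countRowsIn (suc s)                        ≤⟨ countRowsIn-suc s t+m+s≤N ⟩
    suc t * q ^ N * countRowsIn s              ≤⟨ ℕ.*-monoʳ-≤ (suc t * q ^ N) (countRowsIn≤ s t+m+s≤N) ⟩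
    suc t * q ^ N * (suc t ^ s * (q ^ N) ^ s)  ≡⟨ e₁ (suc t) (q ^ N) (suc t ^ s) ((q ^ N) ^ s) ⟩
    suc t ^ suc s * (q ^ N) ^ suc s            ∎
    where
    open ℕ.≤-Reasoning
    t+m+s≤N : t + m + s ≤ N
    t+m+s≤N = ℕ.≤-trans (ℕ.+-monoʳ-≤ (t + m) (ℕ.n≤1+n s)) t+m+s<N
    e₁ : ∀ a b c d → a * b * (c * d) ≡ a * c * (b * d)
    e₁ = solve-∀

-- Shears of tuples

module _ {q} (𝔽 : FiniteField q c ℓ) (V : VectorSpace 𝔽 r ℓr) where
  private
    module 𝔽 = FiniteField 𝔽
    module V = Module V
    open SetoidReasoning V.≈ᴹ-setoid
  open LinearCombinations 𝔽 V

  medial : ∀ w x y z → (w V.+ᴹ x) V.+ᴹ (y V.+ᴹ z) V.≈ᴹ (w V.+ᴹ y) V.+ᴹ (x V.+ᴹ z)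
  medial = interchange (CommutativeMonoid.commutativeSemigroup V.+ᴹ-commutativeMonoid)

  lc-+ʳ : ∀ {k} (s : Vector 𝔽.Carrier k) b b′ → lc s (λ i → b i V.+ᴹ b′ i) V.≈ᴹ lc s b V.+ᴹ lc s b′
  lc-+ʳ {zero}  s b b′ = V.≈ᴹ-sym (V.+ᴹ-identityˡ _)
  lc-+ʳ {suc k} s b b′ = V.≈ᴹ-trans
    (V.+ᴹ-cong (V.*ₗ-distribˡ _ _ _) (lc-+ʳ (s ∘ suc) (b ∘ suc) (b′ ∘ suc))) (medial _ _ _ _)

  ++-cong : ∀ {j k} {b b′ : Vector V.Carrierᴹ j} {d d′ : Vector V.Carrierᴹ k} → b ≋ b′ → d ≋ d′ → (b ++ d) ≋ (b′ ++ d′)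
  ++-cong {j} b≋ d≋ i with splitAt j i
  ... | inj₁ i = b≋ i
  ... | inj₂ i = d≋ i

  ++-injective : ∀ {j k} {b b′ : Vector V.Carrierᴹ j} {d d′ : Vector V.Carrierᴹ k} → (b ++ d) ≋ (b′ ++ d′) → b ≋ b′ × d ≋ d′
  ++-injective {j} {k} {b} {b′} {d} {d′} eq =
    (λ i → ≡.subst (λ x → [ b , d ] x V.≈ᴹ [ b′ , d′ ] x) (Fin.splitAt-↑ˡ j i k) (eq (i ↑ˡ k))) ,
    (λ i → ≡.subst (λ x → [ b , d ] x V.≈ᴹ [ b′ , d′ ] x) (Fin.splitAt-↑ʳ j k i) (eq (j ↑ʳ i)))

  take-++-drop : ∀ j {k} (b : Vector V.Carrierᴹ (j + k)) → ((λ i → b (i ↑ˡ k)) ++ (λ i → b (j ↑ʳ i))) ≋ b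
  take-++-drop j {k} b i with splitAt j i | Fin.join-splitAt j k i
  ... | inj₁ _ | ≡.refl = V.≈ᴹ-refl
  ... | inj₂ _ | ≡.refl = V.≈ᴹ-refl

  LI-++⁻ : ∀ {j k} {b : Vector V.Carrierᴹ j} {d : Vector V.Carrierᴹ k} → LI (b ++ d) →
           ∀ v w → lc v b V.+ᴹ lc w d V.≈ᴹ V.0ᴹ → (∀ i → v i 𝔽.≈ 𝔽.0#) × (∀ i → w i 𝔽.≈ 𝔽.0#)
  LI-++⁻ {j} {k} {b} {d} li v w eq =
    (λ i → ≡.subst (λ x → [ v , w ] x 𝔽.≈ 𝔽.0#) (Fin.splitAt-↑ˡ j i k) (zeros (i ↑ˡ k))) ,
    (λ i → ≡.subst (λ x → [ v , w ] x 𝔽.≈ 𝔽.0#) (Fin.splitAt-↑ʳ j k i) (zeros (j ↑ʳ i)))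
    where
    zeros : ∀ i → (v ++ w) i 𝔽.≈ 𝔽.0#
    zeros = li (v ++ w) (V.≈ᴹ-trans (lc-++ (v ++ w) b d) (V.≈ᴹ-trans
      (V.+ᴹ-cong (lc-congˡ (λ i → 𝔽.reflexive (≡.cong [ v , w ] (Fin.splitAt-↑ˡ j i k))))
                 (lc-congˡ (λ i → 𝔽.reflexive (≡.cong [ v , w ] (Fin.splitAt-↑ʳ j k i))))) eq))

  LI-++⁺ : ∀ {j k} {b : Vector V.Carrierᴹ j} {d : Vector V.Carrierᴹ k} →
           (∀ v w → lc v b V.+ᴹ lc w d V.≈ᴹ V.0ᴹ → (∀ i → v i 𝔽.≈ 𝔽.0#) × (∀ i → w i 𝔽.≈ 𝔽.0#)) → LI (b ++ d)
  LI-++⁺ {j} {k} {b} {d} hyp s eq i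
    with v≈0 , w≈0 ← hyp _ _ (V.≈ᴹ-trans (V.≈ᴹ-sym (lc-++ s b d)) eq)
    with splitAt j i | Fin.join-splitAt j k i
  ... | inj₁ i | ≡.refl = v≈0 i
  ... | inj₂ i | ≡.refl = w≈0 i

  -- The rows of `[ M | I ]` applied to `ψ ++ φ`.
  sheared : ∀ {s t} → Vector (Vector 𝔽.Carrier s) t → Vector V.Carrierᴹ s → Vector V.Carrierᴹ t → Vector V.Carrierᴹ t
  sheared M ψ φ l = φ l V.+ᴹ lc (M l) ψ

  lc-sheared : ∀ {s t} (w : Vector 𝔽.Carrier t) (M : Vector (Vector 𝔽.Carrier s) t) ψ φ →
               lc w (sheared M ψ φ) V.≈ᴹ lc w φ V.+ᴹ lc (linearCombination (coordinateSpace 𝔽 s) w M) ψ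
  lc-sheared w M ψ φ = V.≈ᴹ-trans (lc-+ʳ w φ _) (V.+ᴹ-congˡ (lc-compose w M ψ))

  -- A relation `(v , w)` of the sheared tuple is the relation `(v + w M , w)` of the original one.
  -- Hence `w` vanishes, then `w M`, then `v`.
  LI-sheared : ∀ {s t} (M : Vector (Vector 𝔽.Carrier s) t) {ψ φ} → LI (ψ ++ φ) → LI (ψ ++ sheared M ψ φ)
  LI-sheared {s} M {ψ} {φ} li = LI-++⁺ λ v w eq →
    let wM = linearCombination (coordinateSpace 𝔽 s) w M
        v+wM≈0 , w≈0 = LI-++⁻ li (λ i → v i 𝔽.+ wM i) w (begin
          lc (λ i → v i 𝔽.+ wM i) ψ V.+ᴹ lc w φ    ≈⟨ V.+ᴹ-congʳ (lc-+ v wM ψ) ⟩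
          (lc v ψ V.+ᴹ lc wM ψ) V.+ᴹ lc w φ        ≈⟨ V.+ᴹ-assoc _ _ _ ⟩
          lc v ψ V.+ᴹ (lc wM ψ V.+ᴹ lc w φ)        ≈⟨ V.+ᴹ-congˡ (V.≈ᴹ-trans (V.+ᴹ-comm _ _) (V.≈ᴹ-sym (lc-sheared w M ψ φ))) ⟩
          lc v ψ V.+ᴹ lc w (sheared M ψ φ)         ≈⟨ eq ⟩
          V.0ᴹ                                     ∎)
        wM≈0 = λ i → 𝔽.trans (Coordinates.lc-congˡ 𝔽 s {b = M} w≈0 i) (Coordinates.lc-0 𝔽 s M i)
    in (λ i → 𝔽.trans (𝔽.sym (𝔽.+-identityʳ (v i))) (𝔽.trans (𝔽.+-congˡ (𝔽.sym (wM≈0 i))) (v+wM≈0 i))) , w≈0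

  LI-drop : ∀ {j k} {b : Vector V.Carrierᴹ j} {d : Vector V.Carrierᴹ k} → LI (b ++ d) → LI d
  LI-drop {b = b} li w eq = proj₂ (LI-++⁻ li (λ _ → 𝔽.0#) w
    (V.≈ᴹ-trans (V.+ᴹ-cong (lc-0 b) eq) (V.+ᴹ-identityˡ _)))

  _⊖_ : ∀ {s t} → Vector (Vector 𝔽.Carrier s) t → Vector (Vector 𝔽.Carrier s) t → Vector (Vector 𝔽.Carrier s) t
  (M′ ⊖ M) l j = M′ l j 𝔽.+ 𝔽.- M l j

  -- Between two matrices `φ` cancels, so two simultaneous incidences constrain `ψ` alone, through
  -- `M′ ⊖ M`.
  sheared-difference : ∀ {s t} (M M′ : Vector (Vector 𝔽.Carrier s) t) ψ φ l →
                       sheared M′ ψ φ l V.≈ᴹ lc ((M′ ⊖ M) l) ψ V.+ᴹ sheared M ψ φ l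
  sheared-difference M M′ ψ φ l = begin
    φ l V.+ᴹ lc (M′ l) ψ                             ≈⟨ V.+ᴹ-congˡ (lc-congˡ (λ j → difference (M′ l j) (M l j))) ⟨
    φ l V.+ᴹ lc (λ j → (M′ ⊖ M) l j 𝔽.+ M l j) ψ     ≈⟨ V.+ᴹ-congˡ (lc-+ _ (M l) ψ) ⟩
    φ l V.+ᴹ (lc ((M′ ⊖ M) l) ψ V.+ᴹ lc (M l) ψ)     ≈⟨ V.+ᴹ-assoc _ _ _ ⟨
    φ l V.+ᴹ lc ((M′ ⊖ M) l) ψ V.+ᴹ lc (M l) ψ       ≈⟨ V.+ᴹ-congʳ (V.+ᴹ-comm _ _) ⟩
    lc ((M′ ⊖ M) l) ψ V.+ᴹ φ l V.+ᴹ lc (M l) ψ       ≈⟨ V.+ᴹ-assoc _ _ _ ⟩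
    lc ((M′ ⊖ M) l) ψ V.+ᴹ (φ l V.+ᴹ lc (M l) ψ)     ∎
    where
    difference : ∀ x y → x 𝔽.+ 𝔽.- y 𝔽.+ y 𝔽.≈ x
    difference x y = 𝔽.trans (𝔽.+-assoc x _ y) (𝔽.trans (𝔽.+-congˡ (𝔽.-‿inverseˡ y)) (𝔽.+-identityʳ x))

  ∈-difference : ∀ (S : Subspace V) {x y d} → Subspace.Member S x → Subspace.Member S y → x V.≈ᴹ d V.+ᴹ y → Subspace.Member S d
  ∈-difference S {x} {y} {d} x∈ y∈ eq = Subspace.resp S (begin
      x V.+ᴹ (𝔽.- 𝔽.1#) V.*ₗ y                              ≈⟨ V.+ᴹ-congʳ eq ⟩
      d V.+ᴹ y V.+ᴹ (𝔽.- 𝔽.1#) V.*ₗ y                       ≈⟨ V.+ᴹ-assoc d y _ ⟩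
      d V.+ᴹ (y V.+ᴹ (𝔽.- 𝔽.1#) V.*ₗ y)                     ≈⟨ V.+ᴹ-congˡ (V.+ᴹ-congʳ (V.*ₗ-identityˡ y)) ⟨
      d V.+ᴹ (𝔽.1# V.*ₗ y V.+ᴹ (𝔽.- 𝔽.1#) V.*ₗ y)           ≈⟨ V.+ᴹ-congˡ (V.*ₗ-distribʳ y _ _) ⟨
      d V.+ᴹ (𝔽.1# 𝔽.+ 𝔽.- 𝔽.1#) V.*ₗ y                     ≈⟨ V.+ᴹ-congˡ (V.*ₗ-cong (𝔽.-‿inverseʳ 𝔽.1#) V.≈ᴹ-refl) ⟩
      d V.+ᴹ 𝔽.0# V.*ₗ y                                    ≈⟨ V.+ᴹ-congˡ (V.*ₗ-zeroˡ y) ⟩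
      d V.+ᴹ V.0ᴹ                                           ≈⟨ V.+ᴹ-identityʳ d ⟩
      d                                                     ∎)
    (Subspace.+ᴹ∈ S x∈ (Subspace.*ₗ∈ S _ y∈))

-- Moments of the number of incidences

module SecondMoment {q N} (𝔽 : FiniteField q c ℓ) (V : VectorSpace 𝔽 r ℓr) (dimV : Dimension V N)
         (𝒜 : List (Subspace V)) {m : ℕ} (dimS : ∀ i → HasDim V (lookup 𝒜 i) m)
         (disjoint : ∀ {i j} → i ≢ j → IsTrivial V (_∩_ V (lookup 𝒜 i) (lookup 𝒜 j)))
         (s h : ℕ) (t≤m : suc h ≤ m) (m+k≤N : m + (s + suc h) ≤ N) where
  private
    module 𝔽 = FiniteField 𝔽
    module V = Module V
    module Fˢ = Coordinates 𝔽 s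
    open GroupProperties V.+ᴹ-group using (∙-cancelˡ; ∙-cancelʳ)
    open GroupProperties 𝔽.+-group using () renaming (∙-cancelʳ to +-cancelʳ)
    t = suc h
    n𝒜 = length 𝒜
    S : Fin n𝒜 → Subspace V
    S = lookup 𝒜
    Matrix = Vector (Vector 𝔽.Carrier s) t
    Pair = Vector V.Carrierᴹ s × Vector V.Carrierᴹ t
  open FiniteDimensional 𝔽 V dimV

  private
    x = q ^ N
    F = (q ^ s) ^ t
    μ = q ^ m

    pairs = tuples s ×ₛ tuples t
    matrices = Fˢ.tuples t

    Hits : Fin n𝒜 → Matrix → Pair → Set _
    Hits i M (ψ , φ) = LI (ψ ++ φ) × (∀ l → Subspace.Member (S i) (sheared 𝔽 V M ψ φ l))

    Hits? : ∀ i M z → Dec (Hits i M z)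
    Hits? i M (ψ , φ) = LI? (ψ ++ φ) ×-dec all? (λ l → Subspace.member? (S i) (sheared 𝔽 V M ψ φ l))

    Hits²? : ∀ i M i′ M′ z → Dec (Hits i M z × Hits i′ M′ z)
    Hits²? i M i′ M′ z = Hits? i M z ×-dec Hits? i′ M′ z

    hits-values : ∀ i M z → Hits i M z → Vector (Vector 𝔽.Carrier m) t
    hits-values i M z (_ , ∈S) l = coordinates 𝔽 V dimV (S i) (dimS i) (∈S l)

    -- Shearing by the negative of `M` carries the independent tuples whose last `t` vectors lie in
    -- `S i` injectively to hits of `M`. The lower bound of `count-independent` is therefore valid
    -- for every `M`.
    first-moment : ∀ i M → q * (x ^ s * μ ^ t) ≤ q * count pairs (Hits? i M) + (s + t) * (x ^ s * μ ^ t)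
    first-moment i M = ≡.subst (λ D → q * (x ^ s * D ^ t) ≤ q * count pairs (Hits? i M) + (s + t) * (x ^ s * D ^ t))
      (count-subspace 𝔽 V dimV (S i) (dimS i))
      (ℕ.≤-trans (count-independent 𝔽 V dimV (S i) s t
          (ℕ.≤-trans (q^-mono-≤ 𝔽 t≤m) (count-subspace≥ 𝔽 V dimV (S i) (dimS i)))
          (ℕ.≤-trans (ℕ.m≤n+m (s + t) m) m+k≤N))
        (ℕ.+-monoˡ-≤ _ (ℕ.*-monoʳ-≤ q (count-injection (tuples (s + t)) pairs _ (Hits? i M)
          (λ {(ψ , φ)} {(ψ′ , φ′)} (ψ≋ , φ≋) (li , ∈S) → LI-resp (++-cong 𝔽 V {b = ψ} {ψ′} {φ} {φ′} ψ≋ φ≋) li ,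
            λ l → Subspace.resp (S i) (V.+ᴹ-cong (φ≋ l) (lc-congʳ ψ≋)) (∈S l))
          (λ b _ → head b , tail b)
          (λ b (b∈ , li) → LI-sheared 𝔽 V -M (LI-resp (λ l → V.≈ᴹ-sym (take-++-drop 𝔽 V s b l)) li) ,
            λ l → Subspace.resp (S i) (V.≈ᴹ-sym (unshear b l)) (b∈ l))
          (λ b b′ _ _ (ψ≋ , φ≋) l → V.≈ᴹ-trans (V.≈ᴹ-sym (take-++-drop 𝔽 V s b l)) (V.≈ᴹ-trans
            (++-cong 𝔽 V {b = head b} {head b′} {λ l → b (s ↑ʳ l)} {λ l → b′ (s ↑ʳ l)} ψ≋
              (λ l → ∙-cancelʳ _ _ _ (V.≈ᴹ-trans (φ≋ l) (V.+ᴹ-congˡ (lc-congʳ (λ j → V.≈ᴹ-sym (ψ≋ j)))))) l)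
            (take-++-drop 𝔽 V s b′ l)))))))
      where
      -M : Matrix
      -M l j = 𝔽.- M l j
      head : Vector V.Carrierᴹ (s + t) → Vector V.Carrierᴹ s
      head b j = b (j ↑ˡ t)
      tail : Vector V.Carrierᴹ (s + t) → Vector V.Carrierᴹ t
      tail b = sheared 𝔽 V -M (head b) (λ l → b (s ↑ʳ l))
      unshear : ∀ b l → sheared 𝔽 V M (head b) (tail b) l V.≈ᴹ b (s ↑ʳ l)
      unshear b l = V.≈ᴹ-trans (V.+ᴹ-assoc _ _ _)
        (V.≈ᴹ-trans (V.+ᴹ-congˡ (lc-neg (M l) (head b))) (V.+ᴹ-identityʳ _))

    -- The change of variables `Y = M′ ⊖ M` leaves `M`, the value of `φ + M ψ` in `S i`, and
    -- `(ψ , Y)`; from these `φ` and `M′` are recovered. As a difference of two vectors of `S i`,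
    -- each row of `Y ψ` lies in `S i`, so the pairs `(ψ , Y)` are those of `countRowsIn`.
    same-moment : ∀ i → ∑ matrices (λ M → ∑ matrices (λ M′ → count pairs (Hits²? i M i M′))) ≤
                  μ ^ t * F * (suc t ^ s * x ^ s)
    same-moment i = begin
      ∑ matrices (λ M → ∑ matrices (λ M′ → count pairs (Hits²? i M i M′))) ≡⟨ ∑-× matrices matrices _ ⟨
      ∑ (matrices ×ₛ matrices) (λ (M , M′) → count pairs (Hits²? i M i M′)) ≡⟨ ∑-× (matrices ×ₛ matrices) pairs _ ⟨
      count ((matrices ×ₛ matrices) ×ₛ pairs) (λ ((M , M′) , z) → Hits²? i M i M′ z) ≤⟨
        count-injection ((matrices ×ₛ matrices) ×ₛ pairs) ((scalarTuples 𝔽 V dimV m t ×ₛ matrices) ×ₛ (tuples s ×ₛ K.matrices s))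
          (λ ((M , M′) , z) → Hits²? i M i M′ z) (λ (_ , ψY) → K.RowsIn? s ψY)
          (λ {(_ , y)} {(_ , y′)} (_ , eq) → K.RowsIn-resp s {y} {y′} eq)
          (λ ((M , M′) , z@(ψ , φ)) (hit , _) → (hits-values i M z hit , M) , ψ , _⊖_ 𝔽 V M′ M)
          (λ ((M , M′) , (ψ , φ)) ((_ , ∈S) , (_ , ∈S′)) l →
            ∈-difference 𝔽 V (S i) (∈S′ l) (∈S l) (sheared-difference 𝔽 V M M′ ψ φ l))
          (λ ((M , M′) , (ψ , φ)) ((M₁ , M₁′) , (ψ₁ , φ₁)) ((_ , ∈S) , _) ((_ , ∈S₁) , _) ((u≈ , M≋) , ψ≋ , Y≋) →
            (M≋ , λ l j → +-cancelʳ (𝔽.- M l j) _ _ (𝔽.trans (Y≋ l j) (𝔽.+-congˡ (𝔽.-‿cong (𝔽.sym (M≋ l j)))))) , ψ≋ ,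
            λ l → ∙-cancelʳ (lc (M l) ψ) _ _ (V.≈ᴹ-trans
              (coordinates-injective 𝔽 V dimV (S i) (dimS i) (∈S l) (∈S₁ l) (u≈ l))
              (V.+ᴹ-congˡ (V.≈ᴹ-sym (lc-cong (M≋ l) ψ≋))))) ⟩
      count ((scalarTuples 𝔽 V dimV m t ×ₛ matrices) ×ₛ (tuples s ×ₛ K.matrices s)) (λ (_ , ψY) → K.RowsIn? s ψY)
        ≡⟨ ∑-× (scalarTuples 𝔽 V dimV m t ×ₛ matrices) (tuples s ×ₛ K.matrices s) _ ⟩
      ∑ (scalarTuples 𝔽 V dimV m t ×ₛ matrices) (λ _ → K.countRowsIn s)
        ≡⟨ ∑-const (scalarTuples 𝔽 V dimV m t ×ₛ matrices) _ ⟩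
      μ ^ t * F * K.countRowsIn s ≤⟨ ℕ.*-monoʳ-≤ (μ ^ t * F) (K.countRowsIn≤ s (ℕ.≤-trans (ℕ.≤-reflexive (e₁ h m s)) m+k≤N)) ⟩
      μ ^ t * F * (suc t ^ s * x ^ s) ∎
      where
      open ℕ.≤-Reasoning
      module K = Moment 𝔽 V dimV (S i) (dimS i) t
      e₁ : ∀ h m s → suc h + m + s ≡ m + (s + suc h)
      e₁ = solve-∀

    -- A dependency among the rows of M′ ⊖ M would be carried by φ into
    -- S i ∩ S i′ = 0, contradicting the independence of ψ ++ φ.
    difference-independent : ∀ {i i′} → i ≢ i′ → ∀ M M′ z → Hits i M z → Hits i′ M′ z → Fˢ.LI (_⊖_ 𝔽 V M′ M)
    difference-independent {i} {i′} i≢i′ M M′ (ψ , φ) (li , ∈S) (_ , ∈S′) w wY≈0 =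
      proj₂ (LI-++⁻ 𝔽 V li (Fˢ.lc w M) w (begin
        lc (Fˢ.lc w M) ψ V.+ᴹ lc w φ   ≈⟨ V.+ᴹ-comm _ _ ⟩
        lc w φ V.+ᴹ lc (Fˢ.lc w M) ψ   ≈⟨ lc-sheared 𝔽 V w M ψ φ ⟨
        lc w u                         ≈⟨ disjoint i≢i′ _ (lc-∈ (S i) w ∈S , Subspace.resp (S i′) same (lc-∈ (S i′) w ∈S′)) ⟩
        V.0ᴹ                           ∎))
      where
      open SetoidReasoning V.≈ᴹ-setoid
      u  = sheared 𝔽 V M ψ φ
      u′ = sheared 𝔽 V M′ ψ φ
      Y  = _⊖_ 𝔽 V M′ M
      same : lc w u′ V.≈ᴹ lc w u
      same = begin
        lc w u′                                      ≈⟨ lc-congʳ {s = w} (sheared-difference 𝔽 V M M′ ψ φ) ⟩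
        lc w (λ l → lc (Y l) ψ V.+ᴹ u l)             ≈⟨ lc-+ʳ 𝔽 V w (λ l → lc (Y l) ψ) u ⟩
        lc w (λ l → lc (Y l) ψ) V.+ᴹ lc w u          ≈⟨ V.+ᴹ-congʳ (lc-compose w Y ψ) ⟩
        lc (Fˢ.lc w Y) ψ V.+ᴹ lc w u                 ≈⟨ V.+ᴹ-congʳ (V.≈ᴹ-trans (lc-congˡ wY≈0) (lc-0 ψ)) ⟩
        V.0ᴹ V.+ᴹ lc w u                             ≈⟨ V.+ᴹ-identityˡ _ ⟩
        lc w u                                       ∎

    -- The bound is the product of the two separate probabilities `(μ / x) ^ t`, scaled by the
    -- number `x ^ (s + t)` of pairs. For independent `Y` the two values in `S i` and `S i′` fix
    -- `Y ψ` as their difference, and `φ` follows from `ψ` and the first value. For dependent `Y` no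
    -- pair is hit twice.
    cross-moment : ∀ {i i′} → i ≢ i′ → ∀ M M′ → count pairs (Hits²? i M i′ M′) * x ^ t ≤ x ^ s * (μ ^ t * μ ^ t)
    cross-moment {i} {i′} i≢i′ M M′ = go (Fˢ.LI? Y)
      where
      Y = _⊖_ 𝔽 V M′ M
      go : Dec (Fˢ.LI Y) → count pairs (Hits²? i M i′ M′) * x ^ t ≤ x ^ s * (μ ^ t * μ ^ t)
      go (no ¬liY) = ℕ.≤-trans (ℕ.≤-reflexive (≡.cong (_* x ^ t) (count-none pairs (Hits²? i M i′ M′)
        (λ z (hit , hit′) → ¬liY (difference-independent i≢i′ M M′ z hit hit′))))) z≤n
      go (yes liY) = count-determined 𝔽 V dimV pairs (scalarTuples 𝔽 V dimV m t ×ₛ scalarTuples 𝔽 V dimV m t)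
        (Hits²? i M i′ M′) Y liY proj₁
        (λ z (hit , hit′) → hits-values i M z hit , hits-values i′ M′ z hit′)
        (λ (ψ , φ) (ψ₁ , φ₁) ((_ , ∈S) , (_ , ∈S′)) ((_ , ∈S₁) , (_ , ∈S₁′)) (u≈ , u′≈) l →
          ∙-cancelʳ (sheared 𝔽 V M ψ φ l) _ _ (begin
            lc (Y l) ψ V.+ᴹ sheared 𝔽 V M ψ φ l      ≈⟨ sheared-difference 𝔽 V M M′ ψ φ l ⟨
            sheared 𝔽 V M′ ψ φ l                     ≈⟨ coordinates-injective 𝔽 V dimV (S i′) (dimS i′) (∈S′ l) (∈S₁′ l) (u′≈ l) ⟩
            sheared 𝔽 V M′ ψ₁ φ₁ l                   ≈⟨ sheared-difference 𝔽 V M M′ ψ₁ φ₁ l ⟩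
            lc (Y l) ψ₁ V.+ᴹ sheared 𝔽 V M ψ₁ φ₁ l   ≈⟨ V.+ᴹ-congˡ (coordinates-injective 𝔽 V dimV (S i) (dimS i) (∈S l) (∈S₁ l) (u≈ l)) ⟨
            lc (Y l) ψ₁ V.+ᴹ sheared 𝔽 V M ψ φ l     ∎))
        (λ (ψ , φ) (ψ₁ , φ₁) ((_ , ∈S) , _) ((_ , ∈S₁) , _) (u≈ , _) ψ≋ → ψ≋ ,
          λ l → ∙-cancelʳ (lc (M l) ψ) _ _ (V.≈ᴹ-trans
            (coordinates-injective 𝔽 V dimV (S i) (dimS i) (∈S l) (∈S₁ l) (u≈ l))
            (V.+ᴹ-congˡ (lc-congʳ (λ j → V.≈ᴹ-sym (ψ≋ j))))))
        where open SetoidReasoning V.≈ᴹ-setoid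

    index = fin-size n𝒜 ×ₛ matrices

    hits : Pair → ℕ
    hits z = count index (λ (i , M) → Hits? i M z)

    overlaps : Fin n𝒜 → Fin n𝒜 → ℕ
    overlaps i i′ = ∑ matrices (λ M → ∑ matrices (λ M′ → count pairs (Hits²? i M i′ M′)))

    ∑hits² : ∑ pairs (λ z → hits z * hits z) ≡ ∑ (fin-size n𝒜) (λ i → ∑ (fin-size n𝒜) (overlaps i))
    ∑hits² = begin
      ∑ pairs (λ z → hits z * hits z)
        ≡⟨ ∑-cong pairs (λ z → ≡.trans (≡.sym (∑-*ʳ index (hits z) _)) (∑-cong index (λ (i , M) →
             ≡.trans (≡.sym (∑-*ˡ index (ind (Hits? i M z)) _))
               (∑-cong index (λ (i′ , M′) → ≡.sym (ind-× (Hits? i M z) (Hits? i′ M′ z))))))) ⟩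
      ∑ pairs (λ z → ∑ index (λ (i , M) → ∑ index (λ (i′ , M′) → ind (Hits²? i M i′ M′ z))))
        ≡⟨ ∑-swap pairs index _ ⟩
      ∑ index (λ (i , M) → ∑ pairs (λ z → ∑ index (λ (i′ , M′) → ind (Hits²? i M i′ M′ z))))
        ≡⟨ ∑-cong index (λ _ → ∑-swap pairs index _) ⟩
      ∑ index (λ (i , M) → ∑ index (λ (i′ , M′) → count pairs (Hits²? i M i′ M′)))
        ≡⟨ ∑-× (fin-size n𝒜) matrices _ ⟩
      ∑ (fin-size n𝒜) (λ i → ∑ matrices (λ M → ∑ index (λ (i′ , M′) → count pairs (Hits²? i M i′ M′))))
        ≡⟨ ∑-cong (fin-size n𝒜) (λ i → ∑-cong matrices (λ M → ∑-× (fin-size n𝒜) matrices _)) ⟩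
      ∑ (fin-size n𝒜) (λ i → ∑ matrices (λ M → ∑ (fin-size n𝒜) (λ i′ → ∑ matrices (λ M′ → count pairs (Hits²? i M i′ M′)))))
        ≡⟨ ∑-cong (fin-size n𝒜) (λ i → ∑-swap matrices (fin-size n𝒜) _) ⟩
      ∑ (fin-size n𝒜) (λ i → ∑ (fin-size n𝒜) (overlaps i)) ∎
      where open ≡.≡-Reasoning

    C₁ = μ ^ t * F * (suc t ^ s * x ^ s) * x ^ t
    C₂ = F * (F * (x ^ s * (μ ^ t * μ ^ t)))

    -- `C₁` covers a member paired with itself and `C₂` two different members. Granting `C₂` on the
    -- diagonal as well makes its total `n𝒜 * n𝒜 * C₂`, which times `x ^ s` is exactly the square of
    -- `e`, so this part adds nothing to the variance.
    overlaps≤ : ∀ i i′ (i≟i′ : Dec (i ≡ i′)) → overlaps i i′ * x ^ t ≤ ind i≟i′ * C₁ + C₂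
    overlaps≤ i _ (yes ≡.refl) = ℕ.≤-trans (ℕ.*-monoˡ-≤ (x ^ t) (same-moment i))
      (ℕ.≤-trans (ℕ.≤-reflexive (≡.sym (ℕ.*-identityˡ C₁))) (ℕ.m≤m+n (1 * C₁) C₂))
    overlaps≤ i i′ (no i≢i′) = begin
      overlaps i i′ * x ^ t                                                             ≡⟨ ∑-*ʳ matrices (x ^ t) _ ⟨
      ∑ matrices (λ M → ∑ matrices (λ M′ → count pairs (Hits²? i M i′ M′)) * x ^ t)    ≤⟨ ∑-bound matrices (λ M →
        ℕ.≤-trans (ℕ.≤-reflexive (≡.sym (∑-*ʳ matrices (x ^ t) _))) (∑-bound matrices (λ M′ → cross-moment i≢i′ M M′))) ⟩
      C₂                                                                               ∎
      where open ℕ.≤-Reasoning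

    ∑hits²≤ : ∑ pairs (λ z → hits z * hits z) * x ^ t ≤ n𝒜 * (C₁ + n𝒜 * C₂)
    ∑hits²≤ = begin
      ∑ pairs (λ z → hits z * hits z) * x ^ t                                          ≡⟨ ≡.cong (_* x ^ t) ∑hits² ⟩
      ∑ (fin-size n𝒜) (λ i → ∑ (fin-size n𝒜) (overlaps i)) * x ^ t                      ≡⟨ ∑-*ʳ (fin-size n𝒜) (x ^ t) _ ⟨
      ∑ (fin-size n𝒜) (λ i → ∑ (fin-size n𝒜) (overlaps i) * x ^ t)                      ≤⟨ ∑-bound (fin-size n𝒜) row ⟩
      n𝒜 * (C₁ + n𝒜 * C₂)                                                              ∎
      where
      open ℕ.≤-Reasoning
      row : ∀ i → ∑ (fin-size n𝒜) (overlaps i) * x ^ t ≤ C₁ + n𝒜 * C₂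
      row i = begin
        ∑ (fin-size n𝒜) (overlaps i) * x ^ t                                ≡⟨ ∑-*ʳ (fin-size n𝒜) (x ^ t) _ ⟨
        ∑ (fin-size n𝒜) (λ i′ → overlaps i i′ * x ^ t)                      ≤⟨ ∑-mono (fin-size n𝒜) (λ i′ → overlaps≤ i i′ (i Fin.≟ i′)) ⟩
        ∑ (fin-size n𝒜) (λ i′ → ind (i Fin.≟ i′) * C₁ + C₂)                ≡⟨ ∑-+ (fin-size n𝒜) _ _ ⟩
        ∑ (fin-size n𝒜) (λ i′ → ind (i Fin.≟ i′) * C₁) + ∑ (fin-size n𝒜) (λ _ → C₂) ≡⟨ ≡.cong₂ _+_ (∑-*ʳ (fin-size n𝒜) C₁ _) (∑-const (fin-size n𝒜) C₂) ⟩
        count (fin-size n𝒜) (i Fin.≟_) * C₁ + n𝒜 * C₂                      ≤⟨ ℕ.+-monoˡ-≤ (n𝒜 * C₂) (ℕ.*-monoˡ-≤ C₁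
          (count-injection-size (fin-size n𝒜) (fin-size 1) (i Fin.≟_) (λ _ _ → zero) (λ _ _ i≡ i≡′ _ → ≡.trans (≡.sym i≡) i≡′))) ⟩
        1 * C₁ + n𝒜 * C₂                                                   ≡⟨ ≡.cong (_+ n𝒜 * C₂) (ℕ.*-identityˡ C₁) ⟩
        C₁ + n𝒜 * C₂                                                       ∎

    -- The total number of hits if the independence of `ψ ++ φ` were not demanded.
    e = n𝒜 * F * (x ^ s * μ ^ t)

    ∑hits≥ : q * e ≤ q * ∑ pairs hits + (s + t) * e
    ∑hits≥ = begin
      q * e                                                                ≡⟨ ℕ.*-comm q e ⟩
      n𝒜 * F * (x ^ s * μ ^ t) * q                                         ≡⟨ e₁ (n𝒜 * F) (x ^ s * μ ^ t) q ⟩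
      n𝒜 * F * (q * (x ^ s * μ ^ t))                                       ≡⟨ ∑-const index _ ⟨
      ∑ index (λ _ → q * (x ^ s * μ ^ t))                                  ≤⟨ ∑-mono index (λ (i , M) → first-moment i M) ⟩
      ∑ index (λ (i , M) → q * count pairs (Hits? i M) + (s + t) * (x ^ s * μ ^ t)) ≡⟨ ∑-+ index _ _ ⟩
      ∑ index (λ (i , M) → q * count pairs (Hits? i M)) + ∑ index (λ _ → (s + t) * (x ^ s * μ ^ t)) ≡⟨ ≡.cong₂ _+_
        (≡.trans (∑-*ˡ index q _) (≡.cong (q *_) (≡.sym (∑-swap pairs index _)))) (∑-const index _) ⟩
      q * ∑ pairs hits + n𝒜 * F * ((s + t) * (x ^ s * μ ^ t))              ≡⟨ ≡.cong (q * ∑ pairs hits +_) (e₂ (n𝒜 * F) (s + t) (x ^ s * μ ^ t)) ⟩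
      q * ∑ pairs hits + (s + t) * e                                       ∎
      where
      open ℕ.≤-Reasoning
      e₁ : ∀ a b c → a * b * c ≡ a * (c * b)
      e₁ = solve-∀
      e₂ : ∀ a b c → a * (b * c) ≡ b * (a * c)
      e₂ = solve-∀

    support? : Decidable (λ z → hits z ≢ 0)
    support? z = ¬? (hits z ℕ.≟ 0)

    hit⇒nonevasive : ∀ i M ψ φ → Hits i M (ψ , φ) → ¬ IsEvasive V 𝒜 h (span (ψ ++ φ))
    hit⇒nonevasive i M ψ φ (li , ∈S) = independent⇒¬evasive 𝔽 V dimV 𝒜 h (span (ψ ++ φ)) i u
      (LI-drop 𝔽 V {b = ψ} (LI-sheared 𝔽 V M li)) u∈span ∈S
      where
      u = sheared 𝔽 V M ψ φ
      ψ∈ : ∀ j → Subspace.Member (span (ψ ++ φ)) (ψ j)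
      ψ∈ j = Subspace.resp (span (ψ ++ φ)) (V.≈ᴹ-reflexive (≡.cong [ ψ , φ ] (Fin.splitAt-↑ˡ s j t)))
        (∈span⇒∈ {b = ψ ++ φ} (∈span-self (ψ ++ φ) (j ↑ˡ t)))
      φ∈ : ∀ l → Subspace.Member (span (ψ ++ φ)) (φ l)
      φ∈ l = Subspace.resp (span (ψ ++ φ)) (V.≈ᴹ-reflexive (≡.cong [ ψ , φ ] (Fin.splitAt-↑ʳ s t l)))
        (∈span⇒∈ {b = ψ ++ φ} (∈span-self (ψ ++ φ) (s ↑ʳ l)))
      u∈span : ∀ l → Subspace.Member (span (ψ ++ φ)) (u l)
      u∈span l = Subspace.+ᴹ∈ (span (ψ ++ φ)) (φ∈ l) (lc-∈ (span (ψ ++ φ)) (M l) ψ∈)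

    support≤nonevasive : count pairs support? ≤ count (tuples (s + t)) (NonevasiveLI? 𝔽 V dimV 𝒜 h)
    support≤nonevasive = count-injection pairs (tuples (s + t)) support? (NonevasiveLI? 𝔽 V dimV 𝒜 h)
      (NonevasiveLI-resp 𝔽 V dimV 𝒜 h)
      (λ (ψ , φ) _ → ψ ++ φ)
      (λ (ψ , φ) ≢0 → let (i , M) , hit = count≢0⇒∃ index (λ (i , M) → Hits? i M (ψ , φ)) ≢0
                      in proj₁ hit , hit⇒nonevasive i M ψ φ hit)
      (λ (ψ , φ) (ψ′ , φ′) _ _ → ++-injective 𝔽 V {b = ψ} {ψ′} {φ} {φ′})

  secondMoment : ∃ λ T₁ → ∃ λ T₂ →
    let k = s + suc h ; e = length 𝒜 * (q ^ s) ^ suc h * ((q ^ N) ^ s * (q ^ m) ^ suc h) in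
    q * e ≤ q * T₁ + k * e
    × T₁ * T₁ ≤ count (tuples k) (NonevasiveLI? 𝔽 V dimV 𝒜 h) * T₂
    × T₂ * (q ^ N) ^ suc h ≤ length 𝒜 * ((q ^ m) ^ suc h * (q ^ s) ^ suc h * (suc (suc h) ^ s * (q ^ N) ^ s) * (q ^ N) ^ suc h
        + length 𝒜 * ((q ^ s) ^ suc h * ((q ^ s) ^ suc h * ((q ^ N) ^ s * ((q ^ m) ^ suc h * (q ^ m) ^ suc h)))))
  secondMoment = ∑ pairs hits , ∑ pairs (λ z → hits z * hits z) , ∑hits≥ ,
    ℕ.≤-trans (∑²≤support*∑² pairs support? hits (λ z ¬≢ → decidable-stable (hits z ℕ.≟ 0) ¬≢))
      (ℕ.*-monoˡ-≤ _ support≤nonevasive) ,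
    ∑hits²≤

-- Limits of ratios

∈o⇒eventually-*-≤ : ∀ {f g} → f ∈o g → ∀ c → Eventually λ q → suc c * f q ≤ g q
∈o⇒eventually-*-≤ {f} {g} f∈og c with f∈og (ℤ.+ 1 ℚ./ suc c)
  (ℚ.toℚᵘ-cancel-< (ℚᵘ.<-respʳ-≃ (ℚᵘ.≃-sym (ℚ.toℚᵘ-fromℚᵘ (mkℚᵘ (ℤ.+ 1) c))) (ℚᵘ.*<* (ℤ.+<+ (s≤s z≤n)))))
... | q₀ , bound = q₀ , λ q q₀≤q → convert (f q) (g q) (bound q q₀≤q)
  where
  convert : ∀ a b → (ℤ.+ a) ℚ./ 1 ℚ.≤ (ℤ.+ 1 ℚ./ suc c) ℚ.* ((ℤ.+ b) ℚ./ 1) → suc c * a ≤ b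
  convert a b a≤ with ℚᵘ.≤-respˡ-≃ (ℚ.toℚᵘ-fromℚᵘ (mkℚᵘ (ℤ.+ a) 0))
    (ℚᵘ.≤-respʳ-≃ (ℚᵘ.≃-trans (ℚ.toℚᵘ-homo-* (ℤ.+ 1 ℚ./ suc c) ((ℤ.+ b) ℚ./ 1))
        (ℚᵘ.*-cong (ℚ.toℚᵘ-fromℚᵘ (mkℚᵘ (ℤ.+ 1) c)) (ℚ.toℚᵘ-fromℚᵘ (mkℚᵘ (ℤ.+ b) 0))))
      (ℚ.toℚᵘ-mono-≤ a≤))
  ... | ℚᵘ.*≤* le = ≡.subst₂ _≤_
    (≡.trans (≡.cong (a *_) (ℕ.*-identityʳ (suc c))) (ℕ.*-comm a (suc c)))
    (≡.trans (ℕ.*-identityʳ (b + 0)) (ℕ.+-identityʳ b))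
    (ℤ.drop‿+≤+ (≡.subst₂ ℤ._≤_ (≡.sym (ℤ.pos-* a _))
      (≡.trans (≡.cong (ℤ._* ℤ.+ 1) (≡.sym (ℤ.pos-* 1 b))) (≡.sym (ℤ.pos-* (1 * b) 1))) le))

-- The scale n = 2 ↧ε + 1 makes 2 / n smaller than 1 / ↧ε ≤ ε.
ratio-near : ∀ ε → 0ℚ ℚ.< ε → ∃ λ n → ∀ a b .{{_ : NonZero b}} l →
             suc n * a ≤ suc n * (l * b) + 2 * b → suc n * (l * b) ≤ suc n * a + 2 * b →
             ℚ.∣ (ℤ.+ a) ℚ./ b ℚ.- (ℤ.+ l) ℚ./ 1 ∣ ℚ.< ε
ratio-near (mkℚ (ℤ.+ zero)     _ _) (ℚ.*<* (ℤ.+<+ ()))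
ratio-near (mkℚ ℤ.-[1+ _ ]   _ _) (ℚ.*<* ())
ratio-near ε@(mkℚ (ℤ.+ suc p) d _) _ = 2 * suc d , bound
  where
  bound : ∀ a b .{{_ : NonZero b}} l →
          suc (2 * suc d) * a ≤ suc (2 * suc d) * (l * b) + 2 * b →
          suc (2 * suc d) * (l * b) ≤ suc (2 * suc d) * a + 2 * b →
          ℚ.∣ (ℤ.+ a) ℚ./ b ℚ.- (ℤ.+ l) ℚ./ 1 ∣ ℚ.< ε
  bound a (suc b) l upper lower = ℚ.toℚᵘ-cancel-< (ℚᵘ.<-respˡ-≃ (ℚᵘ.≃-sym unnormalised) (ℚᵘ.*<* main))
    where
    n = suc (2 * suc d)
    B = suc b
    unnormalised : toℚᵘ (ℚ.∣ (ℤ.+ a) ℚ./ B ℚ.- (ℤ.+ l) ℚ./ 1 ∣) ℚᵘ.≃ ℚᵘ.∣ mkℚᵘ (ℤ.+ a) b ℚᵘ.+ ℚᵘ.- mkℚᵘ (ℤ.+ l) 0 ∣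
    unnormalised = ℚᵘ.≃-trans (ℚ.toℚᵘ-homo-∣-∣ ((ℤ.+ a) ℚ./ B ℚ.- (ℤ.+ l) ℚ./ 1)) (ℚᵘ.∣-∣-cong
      (ℚᵘ.≃-trans (ℚ.toℚᵘ-homo-+ ((ℤ.+ a) ℚ./ B) (ℚ.- ((ℤ.+ l) ℚ./ 1)))
        (ℚᵘ.+-cong (ℚ.toℚᵘ-fromℚᵘ (mkℚᵘ (ℤ.+ a) b))
          (ℚᵘ.≃-trans (ℚ.toℚᵘ-homo‿- ((ℤ.+ l) ℚ./ 1)) (ℚᵘ.-‿cong (ℚ.toℚᵘ-fromℚᵘ (mkℚᵘ (ℤ.+ l) 0)))))))
    num : (ℤ.+ a) ℤ.* (ℤ.+ 1) ℤ.+ (ℤ.- (ℤ.+ l)) ℤ.* (ℤ.+ B) ≡ a ℤ.⊖ l * B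
    num = ≡.trans (≡.cong₂ ℤ._+_ (ℤ.*-identityʳ (ℤ.+ a))
      (≡.trans (≡.sym (ℤ.neg-distribˡ-* (ℤ.+ l) (ℤ.+ B))) (≡.cong ℤ.-_ (≡.sym (ℤ.pos-* l B))))) (ℤ.m-n≡m⊖n a (l * B))
    distance = ℤ.∣ a ℤ.⊖ l * B ∣
    ∸-bound : ∀ x y → n * x ≤ n * y + 2 * B → n * (x ∸ y) ≤ 2 * B
    ∸-bound x y le = ℕ.≤-trans (ℕ.≤-reflexive (ℕ.*-distribˡ-∸ n x y)) (ℕ.m≤n+o⇒m∸n≤o (n * x) (n * y) le)
    n*distance≤ : n * distance ≤ 2 * B
    n*distance≤ with ℕ.≤-total a (l * B)
    ... | inj₁ a≤ = ≡.subst (λ x → n * x ≤ 2 * B) (≡.sym (ℤ.∣⊖∣-≤ a≤)) (∸-bound (l * B) a lower)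
    ... | inj₂ ≤a = ≡.subst (λ x → n * x ≤ 2 * B) (≡.trans (≡.sym (ℤ.∣⊖∣-≤ ≤a)) (ℤ.∣m⊖n∣≡∣n⊖m∣ (l * B) a)) (∸-bound a (l * B) upper)
    small : ∀ x → n * x ≤ 2 * B → x * suc d < B
    small zero    _  = s≤s z≤n
    small (suc x) le = ℕ.*-cancelˡ-< 2 _ _ (ℕ.<-≤-trans
      (ℕ.≤-<-trans (ℕ.≤-reflexive (≡.trans (≡.cong (2 *_) (ℕ.*-comm (suc x) (suc d))) (≡.sym (ℕ.*-assoc 2 (suc d) (suc x)))))
        (ℕ.m<n+m (2 * suc d * suc x) (s≤s z≤n))) le)
    main : (ℤ.+ ℤ.∣ (ℤ.+ a) ℤ.* (ℤ.+ 1) ℤ.+ (ℤ.- (ℤ.+ l)) ℤ.* (ℤ.+ B) ∣) ℤ.* (ℤ.+ suc d) ℤ.< (ℤ.+ suc p) ℤ.* (ℤ.+ (B * 1))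
    main = ≡.subst₂ ℤ._<_ (≡.trans (ℤ.pos-* distance (suc d)) (≡.cong (λ z → (ℤ.+ ℤ.∣ z ∣) ℤ.* (ℤ.+ suc d)) (≡.sym num)))
      (ℤ.pos-* (suc p) (B * 1))
      (ℤ.+<+ (ℕ.<-≤-trans (small distance n*distance≤) (ℕ.≤-trans (ℕ.≤-reflexive (≡.sym (ℕ.*-identityʳ B))) (ℕ.m≤m+n (B * 1) _))))

allPairs-lookup : ∀ {A : Set a} {R : Rel A p} {xs : List A} → Symmetric R → AllPairs R xs →
                  ∀ {i j} → i ≢ j → R (lookup xs i) (lookup xs j)
allPairs-lookup sym (_ AllPairs.∷ _)   {zero}  {zero}  i≢j = contradiction ≡.refl i≢j
allPairs-lookup sym (px AllPairs.∷ _)  {zero}  {suc j} i≢j = All.lookup px (∈-lookup j)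
allPairs-lookup sym (px AllPairs.∷ _)  {suc i} {zero}  i≢j = sym (All.lookup px (∈-lookup i))
allPairs-lookup sym (_ AllPairs.∷ pxs) {suc i} {suc j} i≢j = allPairs-lookup sym pxs (i≢j ∘ ≡.cong suc)

-- Arithmetic of the two estimates

powers-+ : ∀ q a b t → (q ^ (a + b)) ^ t ≡ (q ^ a) ^ t * (q ^ b) ^ t
powers-+ q a b t = begin
  (q ^ (a + b)) ^ t           ≡⟨ ℕ.^-*-assoc q (a + b) t ⟩
  q ^ ((a + b) * t)           ≡⟨ ≡.cong (q ^_) (ℕ.*-distribʳ-+ t a b) ⟩
  q ^ (a * t + b * t)         ≡⟨ ℕ.^-distribˡ-+-* q (a * t) (b * t) ⟩
  q ^ (a * t) * q ^ (b * t)   ≡⟨ ≡.cong₂ _*_ (ℕ.^-*-assoc q a t) (ℕ.^-*-assoc q b t) ⟨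
  (q ^ a) ^ t * (q ^ b) ^ t   ∎
  where open ≡.≡-Reasoning

powers-split : ∀ q d a b t → (q ^ (d + (a + b))) ^ t ≡ q ^ (t * d) * ((q ^ a) ^ t * (q ^ b) ^ t)
powers-split q d a b t = ≡.trans (powers-+ q d (a + b) t) (≡.cong₂ _*_
  (≡.trans (ℕ.^-*-assoc q d t) (≡.cong (q ^_) (ℕ.*-comm d t))) (powers-+ q a b t))

-- The proportion 1 - t / q, read as 1 - 1 / c.
absorb : ∀ q t Y g → NonZero q → q * Y ≤ q * g + t * Y → ∀ c → c * t ≤ q → c * Y ≤ c * g + Y
absorb q t Y g q≢0 hyp c ct≤q = ℕ.*-cancelˡ-≤ q {{q≢0}} (begin
  q * (c * Y)                ≡⟨ e₁ q c Y ⟩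
  c * (q * Y)                ≤⟨ ℕ.*-monoʳ-≤ c hyp ⟩
  c * (q * g + t * Y)        ≡⟨ e₂ q c g t Y ⟩
  q * (c * g) + c * t * Y    ≤⟨ ℕ.+-monoʳ-≤ (q * (c * g)) (ℕ.*-monoˡ-≤ Y ct≤q) ⟩
  q * (c * g) + q * Y        ≡⟨ ℕ.*-distribˡ-+ q (c * g) Y ⟨
  q * (c * g + Y)            ∎)
  where
  open ℕ.≤-Reasoning
  e₁ : ∀ q c Y → q * (c * Y) ≡ c * (q * Y)
  e₁ = solve-∀
  e₂ : ∀ q c g t Y → c * (q * g + t * Y) ≡ q * (c * g) + c * t * Y
  e₂ = solve-∀

halve : ∀ Y g → 2 * Y ≤ 2 * g + Y → Y ≤ 2 * g
halve Y g le = ℕ.+-cancelʳ-≤ Y _ _ (≡.subst (_≤ 2 * g + Y) (≡.cong (Y +_) (ℕ.+-identityʳ Y)) le)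

nonZero-of-half : ∀ {Y g} → NonZero Y → Y ≤ 2 * g → NonZero g
nonZero-of-half {zero}          record { nonZero = () } _
nonZero-of-half {suc _} {zero}  _ ()
nonZero-of-half {suc _} {suc _} _ _ = _

-- `Φ` stands for the number of all k-tuples, `L` for the independent ones, and `E * g`, `G * g` for
-- the independent tuples spanning counted subspaces. In the lower bound the dependent and the bad
-- tuples each cost `Φ / (2 n)`. With `Φ ≤ 2 * (G * g)` their sum is at most `2 * (G * g) / n`,
-- which is where the tolerance `2 * G` comes from.
ratio-near-one : ∀ n {E G g Φ L Ev Bad} → NonZero g →
  E * g ≤ Φ → G * g ≤ Φ → suc n * Φ ≤ suc n * (G * g) + Φ → Φ ≤ 2 * (G * g) →
  2 * n * Φ ≤ 2 * n * L + Φ → L ≤ Ev + Bad → Ev ≤ E * g → 2 * n * Bad ≤ Φ →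
  n * E ≤ n * (1 * G) + 2 * G × n * (1 * G) ≤ n * E + 2 * G
ratio-near-one n {E} {G} {g} {Φ} {L} {Ev} {Bad} g≢0 Eg≤Φ Gg≤Φ Φ≤Gg Φ≤2Gg Φ≤L L≤ Ev≤ Bad≤ = upper , lower
  where
  open ℕ.≤-Reasoning
  upper : n * E ≤ n * (1 * G) + 2 * G
  upper = ℕ.*-cancelʳ-≤ _ _ g {{g≢0}} (begin
    n * E * g                        ≡⟨ ℕ.*-assoc n E g ⟩
    n * (E * g)                      ≤⟨ ℕ.*-monoʳ-≤ n Eg≤Φ ⟩
    n * Φ                            ≤⟨ ℕ.+-cancelˡ-≤ Φ _ _ (ℕ.≤-trans Φ≤Gg (ℕ.≤-reflexive (ℕ.+-comm _ Φ))) ⟩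
    suc n * (G * g)                  ≤⟨ ℕ.m≤n+m _ (G * g) ⟩
    G * g + suc n * (G * g)          ≡⟨ e₁ n G g ⟩
    (n * (1 * G) + 2 * G) * g        ∎)
    where
    e₁ : ∀ n G g → G * g + suc n * (G * g) ≡ (n * (1 * G) + 2 * G) * g
    e₁ = solve-∀
  lower : n * (1 * G) ≤ n * E + 2 * G
  lower = ℕ.*-cancelʳ-≤ _ _ g {{g≢0}} (ℕ.*-cancelˡ-≤ 2 (begin
    2 * (n * (1 * G) * g)                        ≡⟨ e₁ n G g ⟩
    2 * n * (G * g)                              ≤⟨ ℕ.*-monoʳ-≤ (2 * n) Gg≤Φ ⟩
    2 * n * Φ                                    ≤⟨ Φ≤L ⟩
    2 * n * L + Φ                                ≤⟨ ℕ.+-monoˡ-≤ Φ (ℕ.*-monoʳ-≤ (2 * n) (ℕ.≤-trans L≤ (ℕ.+-monoˡ-≤ Bad Ev≤))) ⟩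
    2 * n * (E * g + Bad) + Φ                    ≡⟨ ≡.cong (_+ Φ) (ℕ.*-distribˡ-+ (2 * n) (E * g) Bad) ⟩
    2 * n * (E * g) + 2 * n * Bad + Φ            ≤⟨ ℕ.+-mono-≤ (ℕ.+-monoʳ-≤ (2 * n * (E * g)) (ℕ.≤-trans Bad≤ Φ≤2Gg)) Φ≤2Gg ⟩
    2 * n * (E * g) + 2 * (G * g) + 2 * (G * g)  ≡⟨ e₂ n E G g ⟩
    2 * ((n * E + 2 * G) * g)                    ∎))
    where
    e₁ : ∀ n G g → 2 * (n * (1 * G) * g) ≡ 2 * n * (G * g)
    e₁ = solve-∀
    e₂ : ∀ n E G g → 2 * n * (E * g) + 2 * (G * g) + 2 * (G * g) ≡ 2 * ((n * E + 2 * G) * g)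
    e₂ = solve-∀

-- With mean e ≥ c κ Φ and second moment at most e (κ Φ + e), the proportion
-- of Bad is at least (c - 1)² / (c (c + 1)), where c = 3 n + 2.
chebyshev : ∀ n {Φ e T₁ T₂ Bad Ev κ} → NonZero e →
  let C = 2 + 3 * n in
  C * e ≤ C * T₁ + e → T₁ * T₁ ≤ Bad * T₂ → T₂ * Φ ≤ e * (κ * Φ + e) → C * (κ * Φ) ≤ e →
  Ev + Bad ≤ Φ → suc n * Ev ≤ Φ
chebyshev n {Φ} {e} {T₁} {T₂} {Bad} {Ev} {κ} e≢0 mean support second big disjoint =
  -- The constant is chosen so that `suc C = 3 (n + 1)`. Since `C (C + 1) + 1 = 3 C + (C - 1)²`, the
  -- extra `Φ` leaves at most the proportion `3 / (C + 1) = 1 / (n + 1)` for `Ev`.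
  ℕ.*-cancelˡ-≤ 3 (ℕ.*-cancelˡ-≤ C {{_}} (ℕ.+-cancelʳ-≤ (C′ * C′ * Φ) _ _ (begin
    C * (3 * (suc n * Ev)) + C′ * C′ * Φ           ≤⟨ ℕ.+-monoʳ-≤ (C * (3 * (suc n * Ev))) C′²Φ≤ ⟩
    C * (3 * (suc n * Ev)) + C * suc C * Bad       ≡⟨ e₁ n Ev Bad ⟩
    C * suc C * (Ev + Bad)                         ≤⟨ ℕ.*-monoʳ-≤ (C * suc C) disjoint ⟩
    C * suc C * Φ                                  ≤⟨ ℕ.m≤m+n _ Φ ⟩
    C * suc C * Φ + Φ                              ≡⟨ e₂ n Φ ⟩
    C * (3 * Φ) + C′ * C′ * Φ                      ∎)))
  where
  open ℕ.≤-Reasoning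
  C′ = suc (3 * n)
  C = suc C′
  e₁ : ∀ n Ev Bad → (2 + 3 * n) * (3 * (suc n * Ev)) + (2 + 3 * n) * suc (2 + 3 * n) * Bad ≡ (2 + 3 * n) * suc (2 + 3 * n) * (Ev + Bad)
  e₁ = solve-∀
  e₂ : ∀ n Φ → (2 + 3 * n) * suc (2 + 3 * n) * Φ + Φ ≡ (2 + 3 * n) * (3 * Φ) + suc (3 * n) * suc (3 * n) * Φ
  e₂ = solve-∀
  C′e≤CT₁ : C′ * e ≤ C * T₁
  C′e≤CT₁ = ℕ.+-cancelʳ-≤ e _ _ (ℕ.≤-trans (ℕ.≤-reflexive (ℕ.+-comm (C′ * e) e)) mean)
  C′²Φ≤ : C′ * C′ * Φ ≤ C * suc C * Bad
  C′²Φ≤ = ℕ.*-cancelʳ-≤ _ _ (e * e) {{ℕ.m*n≢0 e e {{e≢0}} {{e≢0}}}} (begin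
    C′ * C′ * Φ * (e * e)                ≡⟨ e₃ C′ Φ e ⟩
    C′ * e * (C′ * e) * Φ                ≤⟨ ℕ.*-monoˡ-≤ Φ (ℕ.*-mono-≤ C′e≤CT₁ C′e≤CT₁) ⟩
    C * T₁ * (C * T₁) * Φ                ≡⟨ e₄ C T₁ Φ ⟩
    C * C * (T₁ * T₁) * Φ                ≤⟨ ℕ.*-monoˡ-≤ Φ (ℕ.*-monoʳ-≤ (C * C) support) ⟩
    C * C * (Bad * T₂) * Φ               ≡⟨ e₅ C Bad T₂ Φ ⟩
    C * Bad * (C * (T₂ * Φ))             ≤⟨ ℕ.*-monoʳ-≤ (C * Bad) (ℕ.*-monoʳ-≤ C second) ⟩
    C * Bad * (C * (e * (κ * Φ + e)))    ≡⟨ e₆ C Bad e (κ * Φ) ⟩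
    C * Bad * (e * (C * (κ * Φ) + C * e)) ≤⟨ ℕ.*-monoʳ-≤ (C * Bad) (ℕ.*-monoʳ-≤ e (ℕ.+-monoˡ-≤ (C * e) big)) ⟩
    C * Bad * (e * (e + C * e))          ≡⟨ e₇ C Bad e ⟩
    C * suc C * Bad * (e * e)            ∎)
    where
    e₃ : ∀ c Φ e → c * c * Φ * (e * e) ≡ c * e * (c * e) * Φ
    e₃ = solve-∀
    e₄ : ∀ c T Φ → c * T * (c * T) * Φ ≡ c * c * (T * T) * Φ
    e₄ = solve-∀
    e₅ : ∀ c B T Φ → c * c * (B * T) * Φ ≡ c * B * (c * (T * Φ))
    e₅ = solve-∀
    e₆ : ∀ c B e x → c * B * (c * (e * (x + e))) ≡ c * B * (e * (c * x + c * e))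
    e₆ = solve-∀
    e₇ : ∀ c B e → c * B * (e * (e + c * e)) ≡ c * suc c * B * (e * e)
    e₇ = solve-∀

-- Estimates for one prime power

module Bounds {q N} (𝔽 : FiniteField q c ℓ) (V : VectorSpace 𝔽 r ℓr) (dimV : Dimension V N)
              (𝒜 : List (Subspace V)) (k m h : ℕ) (k+m≤N : k + m ≤ N) (spread : IsPartialSpread V m 𝒜) where
  private
    module 𝔽 = FiniteField 𝔽
    module V = Module V
    module Fᵏ = Coordinates 𝔽 k
    module Fᴺ = Coordinates 𝔽 N
    module Fᵗ = Coordinates 𝔽 (suc h)
    open IsPartialSpread spread
    t = suc h
    n𝒜 = length 𝒜
    E = evasiveCount 𝔽 V dimV 𝒜 h k
    G = gaussianBinomial 𝔽 N k
    g = count (Fᵏ.tuples k) Fᵏ.LI?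
    Φ = (q ^ N) ^ k
    d = N + h + 1 ∸ k ∸ m
    Γ = q ^ ((h + 1) * d)
  open FiniteDimensional 𝔽 V dimV

  private
    k≤N : k ≤ N
    k≤N = ℕ.≤-trans (ℕ.m≤m+n k m) k+m≤N

    d+k+m : d + (k + m) ≡ N + t
    d+k+m = begin
      N + h + 1 ∸ k ∸ m + (k + m)       ≡⟨ ≡.cong (_+ (k + m)) (ℕ.∸-+-assoc (N + h + 1) k m) ⟩
      N + h + 1 ∸ (k + m) + (k + m)     ≡⟨ ℕ.m∸n+n≡m (ℕ.≤-trans k+m≤N (ℕ.≤-trans (ℕ.m≤m+n N h) (ℕ.m≤m+n (N + h) 1))) ⟩
      N + h + 1                         ≡⟨ ℕ.+-assoc N h 1 ⟩
      N + (h + 1)                       ≡⟨ ≡.cong (N +_) (ℕ.+-comm h 1) ⟩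
      N + t                             ∎
      where open ≡.≡-Reasoning

    Γ≡ : Γ ≡ q ^ (t * d)
    Γ≡ = ≡.cong (λ t → q ^ (t * d)) (ℕ.+-comm h 1)

    q^≢0 : ∀ n → NonZero (q ^ n)
    q^≢0 n = ℕ.m^n≢0 q n {{q-nonZero 𝔽}}
    q^^≢0 : ∀ n j → NonZero ((q ^ n) ^ j)
    q^^≢0 n j = ℕ.m^n≢0 (q ^ n) j {{q^≢0 n}}

    dimS : ∀ i → HasDim V (lookup 𝒜 i) m
    dimS i = dimension (SetoidMembership.∈-lookup (subspaceSetoid V) 𝒜 i)

    disjoint : ∀ {i j} → i ≢ j → IsTrivial V (_∩_ V (lookup 𝒜 i) (lookup 𝒜 j))
    disjoint {i} {j} i≢j = intersection {lookup 𝒜 i} {lookup 𝒜 j} (SetoidMembership.∈-lookup (subspaceSetoid V) 𝒜 i) (SetoidMembership.∈-lookup (subspaceSetoid V) 𝒜 j)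
      (allPairs-lookup (λ {U} {W} ≉ ≈ → ≉ (Setoid.sym (subspaceSetoid V) {W} {U} ≈)) distinct i≢j)

    evasive-size = proj₂ (evasiveSubspacesOfDim-finite V 𝔽.size dimV 𝒜 h k)
    evasive-resp : (λ U → HasDim V U k × IsEvasive V 𝒜 h U) Respects Setoid._≈_ (subspaceSetoid V)
    evasive-resp {U} {W} U≈W (dim , evasive) = HasDim-resp V k {U} {W} U≈W dim , IsEvasive-resp V 𝒜 h {U} {W} U≈W evasive

    Ev = count (tuples k) (EvasiveLI? 𝔽 V dimV 𝒜 h)
    Bad = count (tuples k) (NonevasiveLI? 𝔽 V dimV 𝒜 h)

    Eg≤Ev : E * g ≤ Ev
    Eg≤Ev = subspaces*bases≤tuples 𝔽 V dimV (λ _ → proj₁) (λ {U} {W} → evasive-resp {U} {W}) evasive-size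
      (EvasiveLI? 𝔽 V dimV 𝒜 h) (EvasiveLI-resp 𝔽 V dimV 𝒜 h) (λ b li (_ , evasive) → li , evasive)

    Ev≤Eg : Ev ≤ E * g
    Ev≤Eg = tuples≤subspaces*bases 𝔽 V dimV (λ _ → proj₁) (λ {U} {W} → evasive-resp {U} {W}) evasive-size
      (EvasiveLI? 𝔽 V dimV 𝒜 h) (λ b (li , evasive) → li , (b , LI⇒basis li) , evasive)

    subspaces-size = proj₂ (subspacesOfDim-finite (coordinateSpace 𝔽 N) 𝔽.size (coordinateSpace-dimension 𝔽 N) k)

    Gg≤Φ : G * g ≤ Φ
    Gg≤Φ = ℕ.≤-trans (subspaces*bases≤tuples 𝔽 (coordinateSpace 𝔽 N) (coordinateSpace-dimension 𝔽 N) (λ _ dim → dim)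
        (λ {U} {W} → HasDim-resp (coordinateSpace 𝔽 N) k {U} {W}) subspaces-size {R = λ _ → ⊤} (λ _ → yes tt) (λ _ _ → tt) (λ _ _ _ → tt))
      (count≤size (Fᴺ.tuples k) {P = λ _ → ⊤} (λ _ → yes tt))

    LI≤Gg : count (Fᴺ.tuples k) Fᴺ.LI? ≤ G * g
    LI≤Gg = tuples≤subspaces*bases 𝔽 (coordinateSpace 𝔽 N) (coordinateSpace-dimension 𝔽 N) (λ _ dim → dim)
      (λ {U} {W} → HasDim-resp (coordinateSpace 𝔽 N) k {U} {W}) subspaces-size Fᴺ.LI? (λ b li → li , b , Fᴺ.LI⇒basis li)

    Φ≤Gg : ∀ c → c * k ≤ q → c * Φ ≤ c * (G * g) + Φ
    Φ≤Gg c ck≤q = ℕ.≤-trans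
      (absorb q k Φ _ (q-nonZero 𝔽) (count-LI 𝔽 (coordinateSpace 𝔽 N) (coordinateSpace-dimension 𝔽 N) k k≤N) c ck≤q)
      (ℕ.+-monoˡ-≤ Φ (ℕ.*-monoʳ-≤ c LI≤Gg))

    g≢0 : 2 * k ≤ q → NonZero g
    g≢0 2k≤q = nonZero-of-half (q^^≢0 k k) (halve _ g (absorb q k _ g (q-nonZero 𝔽)
      (count-LI 𝔽 (coordinateSpace 𝔽 k) (coordinateSpace-dimension 𝔽 k) k ℕ.≤-refl) 2 2k≤q))

    Ev+Bad≤Φ : Ev + Bad ≤ Φ
    Ev+Bad≤Φ = count-disjoint (tuples k) (EvasiveLI? 𝔽 V dimV 𝒜 h) (NonevasiveLI? 𝔽 V dimV 𝒜 h)
      (λ b (_ , evasive) (_ , ¬evasive) → ¬evasive evasive)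

    LI≤Ev+Bad : count (tuples k) LI? ≤ Ev + Bad
    LI≤Ev+Bad = count-split (tuples k) LI? (EvasiveLI? 𝔽 V dimV 𝒜 h) (NonevasiveLI? 𝔽 V dimV 𝒜 h)
      (λ b li ¬evasive → li , λ evasive → ¬evasive (li , evasive))

    -- The exponent γ is the one with γ + t k + t m = t N + t², by `d+k+m`. This turns the first
    -- moment bound into `n𝒜 / Γ`; the factor 2 comes from bounding the number of invertible t × t
    -- matrices below by half of all matrices.
    BadΓ≤ : 2 * t ≤ q → Bad * Γ ≤ 2 * n𝒜 * Φ
    BadΓ≤ 2t≤q = ℕ.*-cancelʳ-≤ _ _ (K * M) {{ℕ.m*n≢0 K M {{q^^≢0 k t}} {{q^^≢0 m t}}}} (begin
      Bad * Γ * (K * M)                ≡⟨ ℕ.*-assoc Bad Γ (K * M) ⟩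
      Bad * (Γ * (K * M))              ≡⟨ ≡.cong (Bad *_) (≡.trans (≡.cong (_* (K * M)) Γ≡) (≡.trans (≡.sym (powers-split q d k m t))
                                            (≡.trans (≡.cong (λ n → (q ^ n) ^ t) d+k+m) (powers-+ q N t t)))) ⟩
      Bad * ((q ^ N) ^ t * Y)          ≤⟨ ℕ.*-monoʳ-≤ Bad (ℕ.*-monoʳ-≤ ((q ^ N) ^ t) Y≤2gₜ) ⟩
      Bad * ((q ^ N) ^ t * (2 * gₜ))   ≡⟨ e₁ Bad ((q ^ N) ^ t) gₜ ⟩
      2 * (Bad * gₜ * (q ^ N) ^ t)     ≤⟨ ℕ.*-monoʳ-≤ 2 (count-nonevasive≤ 𝔽 V dimV 𝒜 dimS h k) ⟩
      2 * (n𝒜 * K * (Φ * M))           ≡⟨ e₂ n𝒜 K Φ M ⟩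
      2 * n𝒜 * Φ * (K * M)             ∎)
      where
      open ℕ.≤-Reasoning
      K = (q ^ k) ^ t
      M = (q ^ m) ^ t
      Y = (q ^ t) ^ t
      gₜ = count (Fᵗ.tuples t) Fᵗ.LI?
      Y≤2gₜ : Y ≤ 2 * gₜ
      Y≤2gₜ = halve Y gₜ (absorb q t Y gₜ (q-nonZero 𝔽) (count-LI 𝔽 (coordinateSpace 𝔽 t) (coordinateSpace-dimension 𝔽 t) t ℕ.≤-refl) 2 2t≤q)
      e₁ : ∀ b x g → b * (x * (2 * g)) ≡ 2 * (b * g * x)
      e₁ = solve-∀
      e₂ : ∀ a K Φ M → 2 * (a * K * (Φ * M)) ≡ 2 * a * Φ * (K * M)
      e₂ = solve-∀

  -- The factor `2 * n + 2` dominates the scales 2, `suc n` and `2 * n` at which losses of the form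
  -- `k / q` or `t / q` are absorbed. The factor `4 * n` is the `2 * n` of `ratio-near-one` times
  -- the 2 of `BadΓ≤`.
  near-one : ∀ n → (2 * n + 2) * (t + k) ≤ q → 4 * n * n𝒜 ≤ Γ →
             n * E ≤ n * (1 * G) + 2 * G × n * (1 * G) ≤ n * E + 2 * G
  near-one n large few = ratio-near-one n (g≢0 (k-large 2 2≤)) (ℕ.≤-trans Eg≤Ev (ℕ.m+n≤o⇒m≤o Ev Ev+Bad≤Φ)) Gg≤Φ
    (Φ≤Gg (suc n) (k-large (suc n) sn≤)) (halve Φ (G * g) (Φ≤Gg 2 (k-large 2 2≤)))
    (absorb q k Φ _ (q-nonZero 𝔽) (count-LI 𝔽 V dimV k k≤N) (2 * n) (k-large (2 * n) (ℕ.m≤m+n (2 * n) 2)))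
    LI≤Ev+Bad Ev≤Eg
    (ℕ.*-cancelʳ-≤ _ _ Γ {{q^≢0 ((h + 1) * d)}} (begin
      2 * n * Bad * Γ             ≡⟨ ℕ.*-assoc (2 * n) Bad Γ ⟩
      2 * n * (Bad * Γ)           ≤⟨ ℕ.*-monoʳ-≤ (2 * n) (BadΓ≤ (t-large 2 2≤)) ⟩
      2 * n * (2 * n𝒜 * Φ)        ≡⟨ e₁ n n𝒜 Φ ⟩
      Φ * (4 * n * n𝒜)            ≤⟨ ℕ.*-monoʳ-≤ Φ few ⟩
      Φ * Γ                       ∎))
    where
    open ℕ.≤-Reasoning
    k-large : ∀ c → c ≤ 2 * n + 2 → c * k ≤ q
    k-large c c≤ = ℕ.≤-trans (ℕ.*-mono-≤ c≤ (ℕ.m≤n+m k t)) large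
    t-large : ∀ c → c ≤ 2 * n + 2 → c * t ≤ q
    t-large c c≤ = ℕ.≤-trans (ℕ.*-mono-≤ c≤ (ℕ.m≤m+n t k)) large
    2≤ : 2 ≤ 2 * n + 2
    2≤ = ℕ.m≤n+m 2 (2 * n)
    sn≤ : suc n ≤ 2 * n + 2
    sn≤ = ℕ.≤-trans (ℕ.≤-reflexive (ℕ.+-comm 1 n)) (ℕ.+-mono-≤ (ℕ.m≤m+n n (n + 0)) (s≤s z≤n))
    e₁ : ∀ n a Φ → 2 * n * (2 * a * Φ) ≡ Φ * (4 * n * a)
    e₁ = solve-∀

  -- The nonzero vectors of the members of the spread are distinct.
  spread-packing : n𝒜 * q ^ m ≤ q ^ N + n𝒜
  spread-packing = begin
    n𝒜 * q ^ m                                                  ≡⟨ ∑-const (fin-size n𝒜) (q ^ m) ⟨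
    ∑ (fin-size n𝒜) (λ _ → q ^ m)                               ≤⟨ ∑-mono (fin-size n𝒜) nonzero≥ ⟩
    ∑ (fin-size n𝒜) (λ i → count sizeV (nonzero? i) + 1)        ≡⟨ ∑-+ (fin-size n𝒜) _ _ ⟩
    ∑ (fin-size n𝒜) (λ i → count sizeV (nonzero? i)) + ∑ (fin-size n𝒜) (λ _ → 1)
      ≡⟨ ≡.cong₂ _+_ (≡.sym (∑-× (fin-size n𝒜) sizeV _)) (≡.trans (∑-const (fin-size n𝒜) 1) (ℕ.*-identityʳ n𝒜)) ⟩
    count (fin-size n𝒜 ×ₛ sizeV) (λ (i , v) → nonzero? i v) + n𝒜 ≤⟨ ℕ.+-monoˡ-≤ n𝒜
      (count-injection-size (fin-size n𝒜 ×ₛ sizeV) sizeV (λ (i , v) → nonzero? i v) (λ (_ , v) _ → v) injective) ⟩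
    q ^ N + n𝒜                                                  ∎
    where
    open ℕ.≤-Reasoning
    Nonzero : Fin n𝒜 → V.Carrierᴹ → Set _
    Nonzero i v = Subspace.Member (lookup 𝒜 i) v × ¬ v V.≈ᴹ V.0ᴹ
    nonzero? : ∀ i v → Dec (Nonzero i v)
    nonzero? i v = Subspace.member? (lookup 𝒜 i) v ×-dec ¬? (v ≈V? V.0ᴹ)
    nonzero≥ : ∀ i → q ^ m ≤ count sizeV (nonzero? i) + 1
    nonzero≥ i = ℕ.≤-trans (count-subspace≥ 𝔽 V dimV (lookup 𝒜 i) (dimS i)) (ℕ.≤-trans
      (count-split sizeV (Subspace.member? (lookup 𝒜 i)) (_≈V? V.0ᴹ) (nonzero? i) (λ v v∈ v≉0 → v∈ , v≉0))
      (ℕ.≤-trans (ℕ.≤-reflexive (ℕ.+-comm (count sizeV (_≈V? V.0ᴹ)) _)) (ℕ.+-monoʳ-≤ (count sizeV (nonzero? i))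
        (count-injection-size sizeV (fin-size 1) (_≈V? V.0ᴹ) (λ _ _ → zero) (λ v w v≈0 w≈0 _ → V.≈ᴹ-trans v≈0 (V.≈ᴹ-sym w≈0))))))
    injective : ∀ iv jw → Nonzero (proj₁ iv) (proj₂ iv) → Nonzero (proj₁ jw) (proj₂ jw) →
                proj₂ iv V.≈ᴹ proj₂ jw → proj₁ iv ≡ proj₁ jw × proj₂ iv V.≈ᴹ proj₂ jw
    injective (i , v) (j , w) (v∈ , v≉0) (w∈ , _) v≈w =
      decidable-stable (i Fin.≟ j) (λ i≢j → v≉0 (disjoint i≢j v (v∈ , Subspace.resp (lookup 𝒜 j) (V.≈ᴹ-sym v≈w) w∈))) , v≈w

  -- For `k ≤ h` every k-dimensional subspace is evasive, so the limit 0 has to be ruled out by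
  -- size. Here `d ≥ N - m`, so `Γ` is at least about the packing bound `q ^ (N - m)`; the 2 pays
  -- for the zero vector shared by all members, through `q ^ m - 1 ≥ q ^ m / 2`.
  spread≤ : 1 ≤ m → k ≤ h → n𝒜 ≤ 2 * Γ
  spread≤ 1≤m k≤h = ℕ.*-cancelʳ-≤ _ _ (q ^ m) {{q^≢0 m}} (ℕ.+-cancelʳ-≤ (n𝒜 * q ^ m) _ _ (begin
    n𝒜 * q ^ m + n𝒜 * q ^ m           ≤⟨ ℕ.+-mono-≤ spread-packing spread-packing ⟩
    q ^ N + n𝒜 + (q ^ N + n𝒜)         ≡⟨ e₁ (q ^ N) n𝒜 ⟩
    2 * q ^ N + n𝒜 * 2                ≤⟨ ℕ.+-mono-≤ (ℕ.*-monoʳ-≤ 2 q^N≤) (ℕ.*-monoʳ-≤ n𝒜 2≤q^m) ⟩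
    2 * (Γ * q ^ m) + n𝒜 * q ^ m      ≡⟨ ≡.cong (_+ n𝒜 * q ^ m) (≡.sym (ℕ.*-assoc 2 Γ (q ^ m))) ⟩
    2 * Γ * q ^ m + n𝒜 * q ^ m        ∎))
    where
    open ℕ.≤-Reasoning
    e₁ : ∀ x a → x + a + (x + a) ≡ 2 * x + a * 2
    e₁ = solve-∀
    2≤q^m : 2 ≤ q ^ m
    2≤q^m = ℕ.≤-trans (1<q 𝔽) (ℕ.≤-trans (ℕ.≤-reflexive (≡.sym (ℕ.^-identityʳ q))) (q^-mono-≤ 𝔽 1≤m))
    N≤d+m : N ≤ d + m
    N≤d+m = ℕ.+-cancelʳ-≤ k _ _ (begin
      N + k           ≤⟨ ℕ.+-monoʳ-≤ N (ℕ.m≤n⇒m≤1+n k≤h) ⟩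
      N + t           ≡⟨ d+k+m ⟨
      d + (k + m)     ≡⟨ e₂ d k m ⟩
      d + m + k       ∎)
      where
      e₂ : ∀ d k m → d + (k + m) ≡ d + m + k
      e₂ = solve-∀
    q^N≤ : q ^ N ≤ Γ * q ^ m
    q^N≤ = begin
      q ^ N                       ≤⟨ q^-mono-≤ 𝔽 (ℕ.≤-trans N≤d+m (ℕ.+-monoˡ-≤ m (ℕ.≤-trans (ℕ.m≤m+n d (h * d)) (ℕ.≤-reflexive (≡.cong (_* d) (ℕ.+-comm 1 h)))))) ⟩
      q ^ ((h + 1) * d + m)       ≡⟨ ℕ.^-distribˡ-+-* q ((h + 1) * d) m ⟩
      Γ * q ^ m                   ∎

  private
    secondMomentAt : ∀ s → s + t ≡ k → t ≤ m → ∃ λ T₁ → ∃ λ T₂ →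
      let e = n𝒜 * (q ^ s) ^ t * ((q ^ N) ^ s * (q ^ m) ^ t) in
      q * e ≤ q * T₁ + k * e
      × T₁ * T₁ ≤ Bad * T₂
      × T₂ * (q ^ N) ^ t ≤ n𝒜 * ((q ^ m) ^ t * (q ^ s) ^ t * (suc t ^ s * (q ^ N) ^ s) * (q ^ N) ^ t
          + n𝒜 * ((q ^ s) ^ t * ((q ^ s) ^ t * ((q ^ N) ^ s * ((q ^ m) ^ t * (q ^ m) ^ t)))))
    secondMomentAt s s+t≡k t≤m = ≡.subst (λ k → ∃ λ T₁ → ∃ λ T₂ →
      let e = n𝒜 * (q ^ s) ^ t * ((q ^ N) ^ s * (q ^ m) ^ t) in
      q * e ≤ q * T₁ + k * e
      × T₁ * T₁ ≤ count (tuples k) (NonevasiveLI? 𝔽 V dimV 𝒜 h) * T₂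
      × T₂ * (q ^ N) ^ t ≤ n𝒜 * ((q ^ m) ^ t * (q ^ s) ^ t * (suc t ^ s * (q ^ N) ^ s) * (q ^ N) ^ t
          + n𝒜 * ((q ^ s) ^ t * ((q ^ s) ^ t * ((q ^ N) ^ s * ((q ^ m) ^ t * (q ^ m) ^ t)))))) s+t≡k
      (SecondMoment.secondMoment 𝔽 V dimV 𝒜 dimS (λ {i} {j} → disjoint {i} {j}) s h t≤m
        (≡.subst (λ k → m + k ≤ N) (≡.sym s+t≡k) (ℕ.≤-trans (ℕ.≤-reflexive (ℕ.+-comm m k)) k+m≤N)))

    -- By `y≡` the mean number of hits `e / Φ` equals `n𝒜 / Γ`, up to the dependent tuples. The
    -- constant `κ = suc t ^ s` of `countRowsIn≤` bounds the diagonal part of the second moment by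
    -- `κ` times the mean, so Chebyshev asks for a mean of at least `(2 + 3 * n) * κ`.
    few-evasive : ∀ s → s + t ≡ k → t ≤ m → NonZero n𝒜 → ∀ n → (2 + 3 * n) * k ≤ q →
                  (2 + 3 * n) * suc t ^ s * Γ ≤ n𝒜 → suc n * Ev ≤ Φ
    few-evasive s s+t≡k t≤m n𝒜≢0 n large many =
      chebyshev n {T₁ = T₁} {T₂ = T₂} {κ = κ} e≢0 (absorb q k e T₁ (q-nonZero 𝔽) mean (2 + 3 * n) large) support second′ big Ev+Bad≤Φ
      where
      open ℕ.≤-Reasoning
      moments = secondMomentAt s s+t≡k t≤m
      T₁ = proj₁ moments
      T₂ = proj₁ (proj₂ moments)
      mean = proj₁ (proj₂ (proj₂ moments))
      support = proj₁ (proj₂ (proj₂ (proj₂ moments)))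
      second = proj₂ (proj₂ (proj₂ (proj₂ moments)))
      κ = suc t ^ s
      F = (q ^ s) ^ t
      M = (q ^ m) ^ t
      x = (q ^ N) ^ s
      y = (q ^ N) ^ t
      e = n𝒜 * F * (x * M)
      e≢0 : NonZero e
      e≢0 = ℕ.m*n≢0 (n𝒜 * F) (x * M) {{ℕ.m*n≢0 n𝒜 F {{n𝒜≢0}} {{q^^≢0 s t}}}} {{ℕ.m*n≢0 x M {{q^^≢0 N s}} {{q^^≢0 m t}}}}
      Φ≡ : Φ ≡ x * y
      Φ≡ = ≡.trans (≡.cong ((q ^ N) ^_) (≡.sym s+t≡k)) (ℕ.^-distribˡ-+-* (q ^ N) s t)
      N≡ : N ≡ d + (s + m)
      N≡ = ℕ.+-cancelʳ-≡ t _ _ (≡.trans (≡.sym d+k+m) (≡.trans (≡.cong (λ k → d + (k + m)) (≡.sym s+t≡k)) (e₀ d s t m)))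
        where
        e₀ : ∀ d s t m → d + (s + t + m) ≡ d + (s + m) + t
        e₀ = solve-∀
      y≡ : y ≡ Γ * (F * M)
      y≡ = ≡.trans (≡.cong (λ n → (q ^ n) ^ t) N≡) (≡.trans (powers-split q d s m t) (≡.cong (_* (F * M)) (≡.sym Γ≡)))
      second′ : T₂ * Φ ≤ e * (κ * Φ + e)
      second′ = begin
        T₂ * Φ           ≡⟨ ≡.cong (T₂ *_) Φ≡ ⟩
        T₂ * (x * y)     ≡⟨ e₁ T₂ x y ⟩
        T₂ * y * x       ≤⟨ ℕ.*-monoˡ-≤ x second ⟩
        n𝒜 * (M * F * (κ * x) * y + n𝒜 * (F * (F * (x * (M * M))))) * x ≡⟨ e₂ n𝒜 M F κ x y ⟩
        e * (κ * (x * y) + e) ≡⟨ ≡.cong (λ z → e * (κ * z + e)) Φ≡ ⟨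
        e * (κ * Φ + e)  ∎
        where
        e₁ : ∀ T x y → T * (x * y) ≡ T * y * x
        e₁ = solve-∀
        e₂ : ∀ a M F κ x y → a * (M * F * (κ * x) * y + a * (F * (F * (x * (M * M))))) * x ≡
             a * F * (x * M) * (κ * (x * y) + a * F * (x * M))
        e₂ = solve-∀
      big : (2 + 3 * n) * (κ * Φ) ≤ e
      big = begin
        (2 + 3 * n) * (κ * Φ)                 ≡⟨ ≡.cong (λ z → (2 + 3 * n) * (κ * z)) (≡.trans Φ≡ (≡.cong (x *_) y≡)) ⟩
        (2 + 3 * n) * (κ * (x * (Γ * (F * M)))) ≡⟨ e₁ (2 + 3 * n) κ x Γ F M ⟩
        (2 + 3 * n) * κ * Γ * (F * (x * M))   ≤⟨ ℕ.*-monoˡ-≤ (F * (x * M)) many ⟩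
        n𝒜 * (F * (x * M))                    ≡⟨ ℕ.*-assoc n𝒜 F (x * M) ⟨
        e                                     ∎
        where
        e₁ : ∀ c κ x Γ F M → c * (κ * (x * (Γ * (F * M)))) ≡ c * κ * Γ * (F * (x * M))
        e₁ = solve-∀

  -- The summand 3 beats the bound `2 * Γ` of `spread≤` and so excludes `k < t`. The other summand
  -- serves `few-evasive`, with `k` in place of the exponent `k ∸ t`. The final 2 comes from
  -- `Φ ≤ 2 * (G * g)`.
  near-zero : ∀ n → 1 ≤ m → t ≤ m → (2 + 3 * n) * k ≤ q → (3 + (2 + 3 * n) * suc t ^ k) * Γ ≤ n𝒜 → suc n * E ≤ 2 * G
  near-zero n 1≤m t≤m large many = [ at , (λ k<t → contradiction
      (ℕ.≤-trans (ℕ.≤-trans (ℕ.*-monoˡ-≤ Γ (ℕ.m≤m+n 3 ((2 + 3 * n) * suc t ^ k))) many) (spread≤ 1≤m (ℕ.≤-pred k<t)))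
      (ℕ.<⇒≱ (ℕ.*-monoˡ-< Γ {{q^≢0 ((h + 1) * d)}} (ℕ.n<1+n 2)))) ]′ (ℕ.≤-<-connex t k)
    where
    open ℕ.≤-Reasoning
    2k≤q : 2 * k ≤ q
    2k≤q = ℕ.≤-trans (ℕ.*-monoˡ-≤ k (ℕ.m≤m+n 2 (3 * n))) large
    n𝒜≢0 : NonZero n𝒜
    n𝒜≢0 = >-nonZero (ℕ.<-≤-trans (>-nonZero⁻¹ (3 * Γ) {{ℕ.m*n≢0 3 Γ {{_}} {{q^≢0 ((h + 1) * d)}}}}) (ℕ.≤-trans (ℕ.*-monoˡ-≤ Γ (ℕ.m≤m+n 3 ((2 + 3 * n) * suc t ^ k))) many))
    at : t ≤ k → suc n * E ≤ 2 * G
    at t≤k = ℕ.*-cancelʳ-≤ _ _ g {{g≢0 2k≤q}} (begin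
      suc n * E * g       ≡⟨ ℕ.*-assoc (suc n) E g ⟩
      suc n * (E * g)     ≤⟨ ℕ.*-monoʳ-≤ (suc n) Eg≤Ev ⟩
      suc n * Ev          ≤⟨ few-evasive (k ∸ t) (ℕ.m∸n+n≡m t≤k) t≤m n𝒜≢0 n large (ℕ.≤-trans (ℕ.*-monoˡ-≤ Γ
                               (ℕ.≤-trans (ℕ.*-monoʳ-≤ (2 + 3 * n) (ℕ.^-monoʳ-≤ (suc t) (ℕ.m∸n≤m k t))) (ℕ.m≤n+m _ 3))) many) ⟩
      Φ                   ≤⟨ halve Φ (G * g) (Φ≤Gg 2 2k≤q) ⟩
      2 * (G * g)         ≡⟨ ℕ.*-assoc 2 G g ⟨
      2 * G * g           ∎)

-- Passage to the limit

theorem5p4 :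
  {c ℓ r ℓr : Level}
  (N k m h : ℕ) → 2 ≤ N → 1 ≤ k → (k≤N : k ≤ N) → 1 ≤ m → m ≤ N ∸ k → 1 ≤ h → h ≤ m ∸ 1 →
  (𝔽 : (q : PrimePower) → FiniteField (value q) c ℓ)
  (X : (q : PrimePower) → VectorSpace (𝔽 q) r ℓr)
  (dimX : (q : PrimePower) → Dimension (X q) N)
  (𝒜 : (q : PrimePower) → List (Subspace (X q))) →
  ((q : PrimePower) → IsPartialSpread (X q) m (𝒜 q)) →
  ((q : PrimePower) → 2 ≤ length (𝒜 q)) →
  let γ = (h + 1) * (N + h + 1 ∸ k ∸ m)
      proportion = λ q → evasiveProportion (𝔽 q) (X q) (dimX q) (𝒜 q) h k k≤N
  in ((λ q → length (𝒜 q)) ∈o (λ q → value q ^ γ) → proportion ⟶ 1ℚ)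
     × ((λ q → value q ^ γ) ∈o (λ q → length (𝒜 q)) → proportion ⟶ 0ℚ)
theorem5p4 N k m h 2≤N 1≤k k≤N 1≤m m≤N∸k 1≤h h≤m∸1 𝔽 X dimX 𝒜 spread 2≤𝒜 = to-one , to-zero
  where
  γ = (h + 1) * (N + h + 1 ∸ k ∸ m)
  E = λ q → evasiveCount (𝔽 q) (X q) (dimX q) (𝒜 q) h k
  G = λ q → gaussianBinomial (𝔽 q) N k
  proportion = λ q → evasiveProportion (𝔽 q) (X q) (dimX q) (𝒜 q) h k k≤N

  k+m≤N : k + m ≤ N
  k+m≤N = ℕ.≤-trans (ℕ.+-monoʳ-≤ k m≤N∸k) (ℕ.≤-reflexive (ℕ.m+[n∸m]≡n k≤N))

  h<m : suc h ≤ m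
  h<m = ℕ.≤-trans (s≤s h≤m∸1) (ℕ.≤-reflexive (ℕ.m+[n∸m]≡n 1≤m))

  module Bound (q : PrimePower) = Bounds (𝔽 q) (X q) (dimX q) (𝒜 q) k m h k+m≤N (spread q)

  to-one : (λ q → length (𝒜 q)) ∈o (λ q → value q ^ γ) → proportion ⟶ 1ℚ
  to-one 𝒜∈o ε 0<ε =
    let n  , near = ratio-near ε 0<ε
        -- The factor obtained is `suc (4 * suc n)`; the surplus copy of `length (𝒜 q)` is dropped
        -- below.
        q₀ , few  = ∈o⇒eventually-*-≤ {λ q → length (𝒜 q)} {λ q → value q ^ γ} 𝒜∈o (4 * suc n)
    -- The sum of the two thresholds serves as a common bound.
    in q₀ + (2 * suc n + 2) * (suc h + k) , λ q q≥ →
      let upper , lower = Bound.near-one q (suc n) (ℕ.m+n≤o⇒n≤o q₀ q≥)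
            (ℕ.≤-trans (ℕ.m≤n+m _ (length (𝒜 q))) (few q (ℕ.m+n≤o⇒m≤o q₀ q≥)))
      in near (E q) (G q) {{gaussianBinomial-nonZero (𝔽 q) k≤N}} 1 upper lower

  to-zero : (λ q → value q ^ γ) ∈o (λ q → length (𝒜 q)) → proportion ⟶ 0ℚ
  to-zero ∈o𝒜 ε 0<ε =
    let n  , near = ratio-near ε 0<ε
        -- One less than the factor that `near-zero` asks for, because the little-o condition is
        -- read off at the successor.
        q₀ , many = ∈o⇒eventually-*-≤ {λ q → value q ^ γ} {λ q → length (𝒜 q)} ∈o𝒜 (2 + (2 + 3 * n) * suc (suc h) ^ k)
    in q₀ + (2 + 3 * n) * k , λ q q≥ →
      let bound = Bound.near-zero q n 1≤m h<m (ℕ.m+n≤o⇒n≤o q₀ q≥) (many q (ℕ.m+n≤o⇒m≤o q₀ q≥))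
      in near (E q) (G q) {{gaussianBinomial-nonZero (𝔽 q) k≤N}} 0
           (ℕ.≤-trans bound (ℕ.m≤n+m (2 * G q) (suc n * 0)))
           (ℕ.≤-trans (ℕ.≤-reflexive (ℕ.*-zeroʳ (suc n))) z≤n)
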